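{- Any scheduling scheme with $b_\lambda\ge 12$ for all $\lambda\le L$ can be simulated using $\mathcal{O}(\log n)$ additional space on top of the space taken by the landmarks and $\mathcal{O}(\log n)$ time to process each character $T[h]$.
   Context: Streaming setting: the characters of a text $T[1..n]$ arrive one by one; time $h$ means just after reading $T[h]$. Space is counted in words of $\Omega(\log\max\{n,|\Sigma|\})$ bits, with $|\Sigma|\le\mathrm{poly}(n)$, and basic operations on words take $\mathcal{O}(1)$ time. Only even-length palindromes are considered: the palindromic radius at $c$ is the largest $R(c)$ such that $T[c..(c+R(c)-1)]$ equals the reversal of $T[(c-R(c))..(c-1)]$. Landmarks: there are levels $0,\dots,L$ with $L\le\log n$, with sizes $b_0=\dots=b_{L-1}$ and no such restriction on $b_L$ (possibly $\infty$). At time $h$, level $\lambda$ consists of the $b_\lambda$ most recently seen positions $\ge 0$ divisible by $2^\lambda$, i.e. $2^\lambda(\lfloor h/2^\lambda\rfloor-i)$ for $i=0,\dots,b_\lambda-1$. A landmark at $h$ is a position belonging to some level; for each landmark $t$ the Karp-Rabin fingerprint of $T[1..t]$ is stored (the space taken by the landmarks is counted up to a constant factor), and the fingerprint of $T[1..h]$ is always available. Processes: for every center $c$ there is a process $P(c)$. At time $h$ it is alive if there is no $\Delta\ge0$ with $c+\Delta\le h$ and $T[c-1-\Delta]\ne T[c+\Delta]$, and dead otherwise. $P(c)$ can be run at time $h$ when $2c-h-2$ is a landmark at $h$: in $\mathcal{O}(1)$ time it checks by fingerprints whether $T[(2c-h-1)..h]$ is a palindrome, and accordingly succeeds (then the reported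 answer becomes the maximum of its previous value and $h-c+1$) or fails. Fingerprint false positives are assumed not to occur (this holds with high probability). Scheduling scheme: an algorithm which after reading each $T[h]$ runs some of the processes, guaranteeing that any alive $P(c)$ such that $2c-h-2$ is a landmark at $h$ is run, unless it can be sure that $P(c)$ would fail anyway, or there is another $P(c')$ with $c'<c$ such that $2c'-h-2$ is also a landmark at $h$ and it can be sure that $P(c')$ succeeds. Simulating a scheduling scheme with given $L$ and sizes $b_\lambda$ means implementing, within the stated resources, a streaming algorithm that provides this guarantee for the corresponding landmarks. -}

module Defs where

open import Data.Bool using (if_then_else_)
open import Data.Fin using (Fin; toℕ)
open import Data.List using (List; []; _∷_; _++_; take; drop; reverse)
open import Data.List.Membership.Propositional using (_∈_)
open import Data.Nat
  using (ℕ; zero; suc; _+_; _*_; _∸_; _^_; _/_; _%_; _≤_; _<_; _⊔_; _⊓_; _≡ᵇ_; _<ᵇ_)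
open import Data.Nat.Properties using (m^n≢0)
open import Data.Product using (∃-syntax; _×_)
open import Data.Sum using (_⊎_)
open import Data.Vec using (Vec; lookup; toList)
open import Relation.Binary.Construct.Add.Supremum.NonStrict _≤_ using (_≤⁺_) public
open import Relation.Binary.Construct.Add.Supremum.Strict _<_ using (_<⁺_)
open import Relation.Binary.PropositionalEquality using (_≡_; _≢_)
open import Relation.Nullary using (¬_)
open import Relation.Nullary.Construct.Add.Supremum using (_⁺; [_]; ⊤⁺)

-- Texts are 1-indexed: the character T[k] is  lookup T i  with  suc (toℕ i) ≡ k.

Text : ℕ → ℕ → Set
Text σ n = Vec (Fin σ) n

-- T[(t+1)..h]
factor : ∀ {σ n} → Text σ n → ℕ → ℕ → List (Fin σ)
factor T t h = take (h ∸ t) (drop t (toList T))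

Palindrome : ∀ {σ} → List (Fin σ) → Set
Palindrome u = u ≡ reverse u

-- ℕ ⁺ is ℕ with ⊤⁺ = ∞ added.  The levels 0, …, L-1 have the common size b,
-- which is meaningless when L = 0; level L has size bᴸ.

record Scheme : Set where
  field
    L  : ℕ
    b  : ℕ
    bᴸ : ℕ ⁺

  size : ℕ → ℕ ⁺
  size ℓ = if ℓ <ᵇ L then [ b ] else bᴸ

open Scheme public

InLevel : Scheme → (ℓ h t : ℕ) → Set
InLevel S ℓ h t = ∃[ i ] [ i ] <⁺ size S ℓ × i ≤ q × t ≡ 2 ^ ℓ * (q ∸ i)
  where
  q : ℕ
  q = (h / 2 ^ ℓ) {{m^n≢0 2 ℓ}}

Landmark : Scheme → (h t : ℕ) → Set
Landmark S h t = ∃[ ℓ ] ℓ ≤ L S × InLevel S ℓ h t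

-- P(c) can be run at time h:  2c-h-2 is a natural number and a landmark at h.
Runnable : Scheme → (h c : ℕ) → Set
Runnable S h c = ∃[ t ] t + h + 2 ≡ 2 * c × Landmark S h t

module _ {σ n : ℕ} (T : Text σ n) (h c : ℕ) where

  -- T[c-1-Δ] ≠ T[c+Δ] for some Δ ≥ 0 with c+Δ ≤ h, both positions lying in the text.
  Dead : Set
  Dead = ∃[ Δ ] ∃[ i ] ∃[ j ]
    suc (toℕ i) + Δ + 1 ≡ c × suc (toℕ j) ≡ c + Δ × c + Δ ≤ h × lookup T i ≢ lookup T j

  Alive : Set
  Alive = ¬ Dead

  -- The outcome of the fingerprint check on T[(2c-h-1)..h], which has no false
  -- positives.  Only used for runnable P(c), where no subtraction is truncated.
  Succeeds : Set
  Succeeds = Palindrome (factor T (2 * c ∸ h ∸ 2) h)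

-- The guarantee at time h when exactly the processes in  rs  are run.  It will be
-- demanded for all texts, so an algorithm may leave out a process only if, whatever
-- the text consistent with what it has read, one of the two excuses holds.
Guarantee : ∀ {σ n} → Scheme → Text σ n → ℕ → List ℕ → Set
Guarantee S T h rs = ∀ c → Alive T h c → Runnable S h c →
    c ∈ rs
  ⊎ ¬ Succeeds T h c
  ⊎ (∃[ c' ] c' < c × Runnable S h c' × Succeeds T h c')

-- A streaming word RAM.  A program is a finite piece of code, executed once after
-- the arrival of each character.  The landmarks and their fingerprints form a
-- separate store, which the program accesses only by running processes.

data Op : Set where
  add sub mul quo rem eq lt : Op

data Param : Set where
  levels commonSize topSize : Param

data Expr : Set where
  lit   : ℕ → Expr
  param : Param → Expr
  char  : Expr                       -- the character that has just arrived
  load  : Expr → Expr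
  op    : Op → Expr → Expr → Expr

infixr 4 _⨾_

data Program : Set where
  skip   : Program
  _⨾_    : Program → Program → Program
  store  : (address value : Expr) → Program
  ifNZ   : Expr → Program → Program → Program
  while  : Expr → Program → Program
  run    : (centre address : Expr) → Program   -- run P(centre), store the outcome (1 or 0)

-- Subtraction is truncated at 0, and x quo 0 = x rem 0 = 0.
⟦_⟧ : Op → ℕ → ℕ → ℕ
⟦ add ⟧ x y = x + y
⟦ sub ⟧ x y = x ∸ y
⟦ mul ⟧ x y = x * y
⟦ quo ⟧ x zero    = 0
⟦ quo ⟧ x (suc y) = x / suc y
⟦ rem ⟧ x zero    = 0
⟦ rem ⟧ x (suc y) = x % suc y
⟦ eq  ⟧ x y = if x ≡ᵇ y then 1 else 0
⟦ lt  ⟧ x y = if x <ᵇ y then 1 else 0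

cost : Expr → ℕ
cost (lit _)      = 1
cost (param _)    = 1
cost char         = 1
cost (load e)     = suc (cost e)
cost (op _ e₁ e₂) = suc (cost e₁ + cost e₂)

-- A size that does not fit into w bits, in particular ∞, is passed to the program
-- as the largest word 2^w - 1.
saturate : ℕ → ℕ ⁺ → ℕ
saturate w [ x ] = x ⊓ (2 ^ w ∸ 1)
saturate w ⊤⁺    = 2 ^ w ∸ 1

paramValue : Scheme → ℕ → Param → ℕ
paramValue S w levels     = L S
paramValue S w commonSize = saturate w [ b S ]
paramValue S w topSize    = saturate w (bᴸ S)

Memory : Set
Memory = ℕ → ℕ

_[_≔_] : Memory → ℕ → ℕ → Memory
(m [ a ≔ v ]) x = if x ≡ᵇ a then v else m x

record State : Set where
  constructor ⟨_,_⟩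
  field
    memory : Memory
    answer : ℕ

initial : State
initial = ⟨ (λ _ → 0) , 0 ⟩

-- Execution just after reading T[h], h = suc (toℕ i), on a machine with s memory
-- cells of w bits.  A program that leaves the memory, produces a value of more than
-- w bits, or runs a process that cannot be run, is stuck and has no execution.

module Machine (w s : ℕ) (S : Scheme) {σ n : ℕ} (T : Text σ n) (i : Fin n) where

  h : ℕ
  h = suc (toℕ i)

  Word : ℕ → Set
  Word v = v < 2 ^ w

  infix 3 _⊢_⇓_ _,_⇓_,_,_

  data _⊢_⇓_ (m : Memory) : Expr → ℕ → Set where
    lit   : ∀ {k} → Word k → m ⊢ lit k ⇓ k
    param : ∀ {p} → Word (paramValue S w p) → m ⊢ param p ⇓ paramValue S w p
    char  : Word (toℕ (lookup T i)) → m ⊢ char ⇓ toℕ (lookup T i)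
    load  : ∀ {e a} → m ⊢ e ⇓ a → a < s → Word (m a) → m ⊢ load e ⇓ m a
    op    : ∀ {o e₁ e₂ x y} → m ⊢ e₁ ⇓ x → m ⊢ e₂ ⇓ y → Word (⟦ o ⟧ x y) →
            m ⊢ op o e₁ e₂ ⇓ ⟦ o ⟧ x y

  -- p , q ⇓ q' , t , rs :  started in state q, p halts in state q' after t steps,
  -- having run the processes P(c) with c in rs.
  data _,_⇓_,_,_ : Program → State → State → ℕ → List ℕ → Set where
    skip : ∀ {q} → skip , q ⇓ q , 1 , []
    _⨾_  : ∀ {p₁ p₂ q q' q'' t₁ t₂ rs₁ rs₂} →
           p₁ , q ⇓ q' , t₁ , rs₁ → p₂ , q' ⇓ q'' , t₂ , rs₂ →
           p₁ ⨾ p₂ , q ⇓ q'' , t₁ + t₂ , rs₁ ++ rs₂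
    store : ∀ {e₁ e₂ m r a v} → m ⊢ e₁ ⇓ a → m ⊢ e₂ ⇓ v → a < s →
           store e₁ e₂ , ⟨ m , r ⟩ ⇓ ⟨ m [ a ≔ v ] , r ⟩ , suc (cost e₁ + cost e₂) , []
    if-nonzero : ∀ {e p₁ p₂ m r v q t rs} → m ⊢ e ⇓ suc v → p₁ , ⟨ m , r ⟩ ⇓ q , t , rs →
           ifNZ e p₁ p₂ , ⟨ m , r ⟩ ⇓ q , suc (cost e + t) , rs
    if-zero : ∀ {e p₁ p₂ m r q t rs} → m ⊢ e ⇓ 0 → p₂ , ⟨ m , r ⟩ ⇓ q , t , rs →
           ifNZ e p₁ p₂ , ⟨ m , r ⟩ ⇓ q , suc (cost e + t) , rs
    while-nonzero : ∀ {e p m r v q t rs} → m ⊢ e ⇓ suc v →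
           p ⨾ while e p , ⟨ m , r ⟩ ⇓ q , t , rs →
           while e p , ⟨ m , r ⟩ ⇓ q , suc (cost e + t) , rs
    while-zero : ∀ {e p m r} → m ⊢ e ⇓ 0 →
           while e p , ⟨ m , r ⟩ ⇓ ⟨ m , r ⟩ , suc (cost e) , []
    run-succeeds : ∀ {e₁ e₂ m r c a} → m ⊢ e₁ ⇓ c → m ⊢ e₂ ⇓ a → a < s →
           Runnable S h c → Succeeds T h c →
           run e₁ e₂ , ⟨ m , r ⟩ ⇓ ⟨ m [ a ≔ 1 ] , r ⊔ (h + 1 ∸ c) ⟩ ,
             suc (cost e₁ + cost e₂) , c ∷ []
    run-fails : ∀ {e₁ e₂ m r c a} → m ⊢ e₁ ⇓ c → m ⊢ e₂ ⇓ a → a < s →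
           Runnable S h c → ¬ Succeeds T h c →
           run e₁ e₂ , ⟨ m , r ⟩ ⇓ ⟨ m [ a ≔ 0 ] , r ⟩ ,
             suc (cost e₁ + cost e₂) , c ∷ []

-- With s additional cells of w bits, p processes T in at most τ steps per character
-- and satisfies the guarantee at all times.  The summand suc (L S) charges O(1) for
-- updating each of the levels 0, …, L of the landmark store (a circular buffer, or a
-- growing array for an infinite level) by the fingerprint of the current prefix.
record Simulates (w s τ : ℕ) (p : Program) (S : Scheme) {σ n : ℕ} (T : Text σ n) : Set where
  field
    state  : ℕ → State
    time   : Fin n → ℕ
    runs   : Fin n → List ℕ
    start  : state 0 ≡ initial
    step   : ∀ i → let open Machine w s S T i in
             p , state (toℕ i) ⇓ state (suc (toℕ i)) , time i , runs i
    fast   : ∀ i → suc (L S) + time i ≤ τ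
    guarantee : ∀ i → Guarantee S T (suc (toℕ i)) (runs i)

{-# OPTIONS --safe #-}

-- Denote the palindrome T[t+1..h] by x = t + h, which depends on its centre only.  It
-- suffices to run, at each time h, some successful process at or to the left of every
-- successful one.  For a scale Λ = 2^a, cut the text into blocks that start at multiples
-- t₀ of Λ.  While h − t₀ runs through [6Λ, 8Λ), the palindromes that start right after t₀
-- are found by running their processes at the landmark t₀ itself.  Their lengths are so
-- similar that, by periodicity, they form an arithmetic progression, which fits into
-- O(1) words.  The same centres are due again at a later time h if x is congruent to h
-- modulo the spacing g of the landmarks, so the candidates are the solutions of a linear
-- congruence; its inverse is found by trying one multiplier per character.  If x
-- succeeds, so does every member of the progression below x that is far enough to the
-- right of the least one known to have succeeded in the preceding g time units
-- (middle-survives), and therefore one of the first three candidates does, or x itself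
-- is among them.  Landmarks at distance less than 8g are tried directly, six blocks are
-- active for each scale, and only O(log n) pairs of a scale and a level matter.

module Submission where

open import Data.Bool using (Bool; true; false; if_then_else_; _∧_; T; not)
open import Data.Empty using (⊥-elim)
open import Data.Fin using (Fin; toℕ; fromℕ<)
import Data.Fin.Properties as Finₚ
open import Data.Fin.Properties using (toℕ-injective; toℕ<n; toℕ-fromℕ<; fromℕ<-toℕ)
open import Data.List using (List; []; _∷_; _++_; take; drop; reverse; length)
open import Data.List.Membership.Propositional using (_∈_)
open import Data.List.Membership.Propositional.Properties using (∈-++⁺ˡ; ∈-++⁺ʳ; ∈-++⁻)
open import Data.List.Properties
  using (++-assoc; ++-identityʳ; unfold-reverse; length-reverse; length-take; length-drop; ≡-dec)
open import Data.List.Relation.Unary.Any using (here)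
open import Data.Nat
open import Data.Nat.Divisibility
open import Data.Nat.DivMod hiding (result)
open import Data.Nat.Logarithm
open import Data.Nat.Properties
open import Data.Nat.Tactic.RingSolver using (solve-∀)
open import Data.Product using (Σ-syntax; ∃-syntax; _×_; _,_; proj₁; proj₂)
open import Data.Sum using (_⊎_; inj₁; inj₂)
open import Data.Unit using (tt)
open import Data.Vec using (toList)
open import Data.Vec.Properties using (length-toList)
open import Function using (case_of_)
open import Relation.Binary.Construct.Add.Supremum.NonStrict _≤_ using (_≤⊤⁺) renaming ([_] to [_]≤)
open import Relation.Binary.Construct.Add.Supremum.Strict _<_ using (_<⁺_; [_]<⊤⁺) renaming ([_] to [_]<)
open import Relation.Binary.Definitions using (tri<; tri≈; tri>)
open import Relation.Binary.PropositionalEquality hiding (J; [_])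
open import Relation.Nullary using (Dec; yes; no; contradiction; ¬_; does)
open import Relation.Nullary.Construct.Add.Supremum using ([_]; ⊤⁺)

-- Linear arithmetic

-- The constants come from one computation. A palindrome of length `D` due at time `h` is served at
-- the scale with `8 * Λ ≤ D < 16 * Λ`. If a sweep meets its centre at time `v`, then
-- `x = t₀ + v = 2 * t₀ + (v - t₀)`; consecutive blocks shift this by `2 * Λ`, so windows of width
-- `2 * Λ` cover every centre. Ending the window at `8 * Λ` puts the sweep no later than `h`, and
-- `2 * (h - t₀) = D + (v - t₀) < 24 * Λ` bounds the life of a block by `12 * Λ`. The obstacle is
-- delay. A process is due only once in `g` time units, so the least living member of a progression
-- is known as of a time less than `2 * g` ago. Two strides, each a positive multiple of `g`, make
-- up for this, whence three candidates. The inverse may come late as well: until `g` multipliers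
-- have been tried, only the first palindrome found in a sweep can be due again. A landmark is
-- treated at the finest level that contains it, so its distance is beyond the reach of all finer
-- levels; this makes the pair of scale and level a corner of the staircase.

infixl 6 _⊕_
infixl 7 _⊛_
infix 8 #_

data Term : Set where
  #_  : ℕ → Term
  con : ℕ → Term
  _⊕_ : Term → Term → Term
  _⊛_ : ℕ → Term → Term

entry : List ℕ → ℕ → ℕ
entry []      _       = 0
entry (x ∷ _) zero    = x
entry (_ ∷ ρ) (suc i) = entry ρ i

value : List ℕ → Term → ℕ
value ρ (# i)   = entry ρ i
value ρ (con k) = k
value ρ (s ⊕ t) = value ρ s + value ρ t
value ρ (k ⊛ t) = k * value ρ t

dot : List ℕ → List ℕ → ℕ
dot []       _        = 0
dot (_ ∷ _)  []       = 0
dot (c ∷ cs) (x ∷ xs) = c * x + dot cs xs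

unit : ℕ → List ℕ
unit zero    = 1 ∷ []
unit (suc i) = 0 ∷ unit i

plus : List ℕ → List ℕ → List ℕ
plus []       ds       = ds
plus (c ∷ cs) []       = c ∷ cs
plus (c ∷ cs) (d ∷ ds) = (c + d) ∷ plus cs ds

times : ℕ → List ℕ → List ℕ
times k []       = []
times k (c ∷ cs) = k * c ∷ times k cs

-- The constant term is the coefficient at the head.
coefficients : Term → List ℕ
coefficients (# i)   = unit (suc i)
coefficients (con k) = k ∷ []
coefficients (s ⊕ t) = plus (coefficients s) (coefficients t)
coefficients (k ⊛ t) = times k (coefficients t)

dot-unit : ∀ i ρ → dot (unit i) ρ ≡ entry ρ i
dot-unit zero    []      = refl
dot-unit zero    (x ∷ ρ) = trans (+-identityʳ (x + 0)) (+-identityʳ x)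
dot-unit (suc i) []      = refl
dot-unit (suc i) (x ∷ ρ) = dot-unit i ρ

dot-plus : ∀ cs ds ρ → dot (plus cs ds) ρ ≡ dot cs ρ + dot ds ρ
dot-plus []       ds       ρ       = refl
dot-plus (c ∷ cs) []       ρ       = sym (+-identityʳ _)
dot-plus (c ∷ cs) (d ∷ ds) []      = refl
dot-plus (c ∷ cs) (d ∷ ds) (x ∷ ρ) = begin
  (c + d) * x + dot (plus cs ds) ρ        ≡⟨ cong₂ _+_ (*-distribʳ-+ x c d) (dot-plus cs ds ρ) ⟩
  c * x + d * x + (dot cs ρ + dot ds ρ)   ≡⟨ +-assoc (c * x) (d * x) _ ⟩
  c * x + (d * x + (dot cs ρ + dot ds ρ)) ≡⟨ cong (c * x +_) (x∙yz≈y∙xz (d * x) (dot cs ρ) (dot ds ρ)) ⟩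
  c * x + (dot cs ρ + (d * x + dot ds ρ)) ≡⟨ +-assoc (c * x) (dot cs ρ) _ ⟨
  c * x + dot cs ρ + (d * x + dot ds ρ)   ∎
  where
  open ≡-Reasoning
  open import Algebra.Properties.CommutativeSemigroup +-commutativeSemigroup using (x∙yz≈y∙xz)

dot-times : ∀ k cs ρ → dot (times k cs) ρ ≡ k * dot cs ρ
dot-times k []       ρ       = sym (*-zeroʳ k)
dot-times k (c ∷ cs) []      = sym (*-zeroʳ k)
dot-times k (c ∷ cs) (x ∷ ρ) = trans (cong₂ _+_ (*-assoc k c x) (dot-times k cs ρ))
                                     (sym (*-distribˡ-+ k (c * x) (dot cs ρ)))

value-coefficients : ∀ ρ t → value ρ t ≡ dot (coefficients t) (1 ∷ ρ)
value-coefficients ρ (# i)   = sym (dot-unit i ρ)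
value-coefficients ρ (con k) = sym (trans (+-identityʳ (k * 1)) (*-identityʳ k))
value-coefficients ρ (s ⊕ t) = trans (cong₂ _+_ (value-coefficients ρ s) (value-coefficients ρ t))
                                     (sym (dot-plus (coefficients s) (coefficients t) (1 ∷ ρ)))
value-coefficients ρ (k ⊛ t) = trans (cong (k *_) (value-coefficients ρ t))
                                     (sym (dot-times k (coefficients t) (1 ∷ ρ)))

-- Domination of coefficients implies `≤` because the variables range over natural numbers. The test
-- is decided by computation, so that every certificate below is checked without a proof term.
below : List ℕ → List ℕ → Bool
below []       _        = true
below (c ∷ cs) []       = (c ≤ᵇ 0) ∧ below cs []
below (c ∷ cs) (d ∷ ds) = (c ≤ᵇ d) ∧ below cs ds

dot-below : ∀ cs ds ρ → T (below cs ds) → dot cs ρ ≤ dot ds ρ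
dot-below []       ds       ρ       p = z≤n
dot-below (c ∷ cs) ds       []      p = z≤n
dot-below (zero ∷ cs) []       (x ∷ ρ) p = ≤-trans (dot-below cs [] ρ p) z≤n
dot-below (c ∷ cs) (d ∷ ds) (x ∷ ρ) p with c ≤ᵇ d in eq
... | true = +-mono-≤ (*-monoˡ-≤ x (≤ᵇ⇒≤ c d (subst T (sym eq) _))) (dot-below cs ds ρ p)

value-below : ∀ ρ s t → T (below (coefficients s) (coefficients t)) → value ρ s ≤ value ρ t
value-below ρ s t p = subst₂ _≤_ (sym (value-coefficients ρ s)) (sym (value-coefficients ρ t))
                             (dot-below (coefficients s) (coefficients t) (1 ∷ ρ) p)

Hypotheses : Set
Hypotheses = List (ℕ × Term × Term)

left right : Hypotheses → Term
left  []                 = con 0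
left  ((k , l , _) ∷ hs) = k ⊛ l ⊕ left hs
right []                 = con 0
right ((k , _ , r) ∷ hs) = k ⊛ r ⊕ right hs

Implies : List ℕ → Hypotheses → Set → Set
Implies ρ []                 G = G
Implies ρ ((_ , l , r) ∷ hs) G = value ρ l ≤ value ρ r → Implies ρ hs G

implies : ∀ ρ hs {G} → (value ρ (left hs) ≤ value ρ (right hs) → G) → Implies ρ hs G
implies ρ []                 f = f z≤n
implies ρ ((k , l , r) ∷ hs) f h = implies ρ hs (λ p → f (+-mono-≤ (*-monoʳ-≤ k h) p))

-- A Farkas certificate: n is the multiplier of the negated conclusion.
farkas : ∀ ρ n l r s t →
         {_ : T (below (coefficients (con 1 ⊕ (r ⊕ n ⊛ s))) (coefficients (l ⊕ n ⊛ (con 1 ⊕ t))))} →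
         value ρ l ≤ value ρ r → value ρ s ≤ value ρ t
farkas ρ n l r s t {p} h with value ρ s ≤? value ρ t
... | yes s≤t = s≤t
... | no  s≰t = contradiction
  (≤-trans (value-below ρ (con 1 ⊕ (r ⊕ n ⊛ s)) (l ⊕ n ⊛ (con 1 ⊕ t)) p)
           (+-mono-≤ h (*-monoʳ-≤ n (≰⇒> s≰t))))
  (<-irrefl refl)

-- A hypothesis  l ≤ r  is paired with its multiplier.
lin : ∀ ρ n hs s t →
      {_ : T (below (coefficients (con 1 ⊕ (right hs ⊕ n ⊛ s))) (coefficients (left hs ⊕ n ⊛ (con 1 ⊕ t))))} →
      Implies ρ hs (value ρ s ≤ value ρ t)
lin ρ n hs s t {p} = implies ρ hs (farkas ρ n (left hs) (right hs) s t {p})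

Equates : List ℕ → Hypotheses → Set → Set
Equates ρ []                 G = G
Equates ρ ((_ , l , r) ∷ hs) G = value ρ l ≡ value ρ r → Equates ρ hs G

equates : ∀ ρ hs {G} → (value ρ (left hs) ≡ value ρ (right hs) → G) → Equates ρ hs G
equates ρ []                 f = f refl
equates ρ ((k , l , r) ∷ hs) f h = equates ρ hs (λ e → f (cong₂ _+_ (cong (k *_) h) e))

lin≡ : ∀ ρ hs s t →
       {_ : T (below (coefficients (con 1 ⊕ (right hs ⊕ 1 ⊛ s))) (coefficients (left hs ⊕ 1 ⊛ (con 1 ⊕ t))))} →
       {_ : T (below (coefficients (con 1 ⊕ (left hs ⊕ 1 ⊛ t))) (coefficients (right hs ⊕ 1 ⊛ (con 1 ⊕ s))))} →
       Equates ρ hs (value ρ s ≡ value ρ t)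
lin≡ ρ hs s t {p} {q} = equates ρ hs (λ e →
  ≤-antisym (farkas ρ 1 (left hs) (right hs) s t {p} (≤-reflexive e))
            (farkas ρ 1 (right hs) (left hs) t s {q} (≤-reflexive (sym e))))

-- Palindromes and periods

module Words {A : Set} (T : ℕ → A) where

  -- T is 0-indexed here.  Pal x h says that the positions x ∸ h, …, h ∸ 1 form a
  -- palindrome, whose centre is determined by x.
  Pal : ℕ → ℕ → Set
  Pal x h = ∀ u v → suc (u + v) ≡ x → u < h → v < h → T u ≡ T v

  Period : ℕ → ℕ → ℕ → Set
  Period p a b = ∀ v → a ≤ v → v + p < b → T v ≡ T (v + p)

  -- This monotonicity is what the description by `x` buys: survival until a later time includes
  -- survival at all earlier ones.
  Pal-≤ : ∀ {x h k} → k ≤ h → Pal x h → Pal x k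
  Pal-≤ k≤h P u v e u< v< = P u v e (<-≤-trans u< k≤h) (<-≤-trans v< k≤h)

  -- The reflections belonging to `x` and `x + p` compose to the translation by `p`.
  reflect-twice : ∀ {x p a b} u v → Pal x a → Pal (x + p) b →
                  suc (u + v) ≡ x → u < a → v < a → u < b → v + p < b → T v ≡ T (v + p)
  reflect-twice {x} {p} u v P Q e u<a v<a u<b vp<b =
    trans (sym (P u v e u<a v<a)) (Q u (v + p) (lin≡ (u ∷ v ∷ x ∷ p ∷ [])
        ((1 , con 1 ⊕ (# 0 ⊕ # 1) , # 2) ∷ []) (con 1 ⊕ (# 0 ⊕ (# 1 ⊕ # 3))) (# 2 ⊕ # 3) e) u<b vp<b)

  -- The condition `x ≤ a + h` keeps the mirror image `x - 1 - v` of a position `v ≥ a` below `h`,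
  -- where both palindromes apply.
  two-palindromes : ∀ {x p h} → Pal x h → Pal (x + p) h → ∀ a → x ≤ a + h → h ≤ x → Period p a h
  two-palindromes {x} {p} {h} P Q a x≤ h≤x v a≤v vp<h =
    reflect-twice u v P Q e u<h (lin (v ∷ p ∷ h ∷ []) 1 ((1 , con 1 ⊕ (# 0 ⊕ # 1) , # 2) ∷ [])
        (con 1 ⊕ # 0) (# 2) vp<h) u<h vp<h
    where
    u = x ∸ suc v
    e : suc (u + v) ≡ x
    e = trans (sym (+-suc u v)) (m∸n+n≡m (lin (v ∷ p ∷ h ∷ x ∷ []) 1
        ((1 , con 1 ⊕ (# 0 ⊕ # 1) , # 2) ∷ (1 , # 2 , # 3) ∷ []) (con 1 ⊕ # 0) (# 3) vp<h h≤x))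
    u<h : u < h
    u<h = (lin (u ∷ v ∷ x ∷ a ∷ h ∷ []) 1 ((1 , con 1 ⊕ (# 0 ⊕ # 1) , # 2) ∷ (1 , # 2 , # 3 ⊕ # 4) ∷
        (1 , # 3 , # 1) ∷ []) (con 1 ⊕ # 0) (# 4) (≤-reflexive e) x≤ a≤v)

  -- A palindromic prefix of a palindrome is also a suffix of it, hence a border, and a border
  -- yields a period.
  two-prefix-palindromes : ∀ {t s p} → Pal (t + s) s → Pal (t + (s + p)) (s + p) → Period p t (s + p)
  two-prefix-palindromes {t} {s} {p} P Q v t≤v vp< =
    reflect-twice u v P (subst (λ x → Pal x (s + p)) (sym (+-assoc t s p)) Q) e u<s v<s (m≤n⇒m≤n+o p u<s) vp<
    where
    v<s : v < s
    v<s = +-cancelʳ-< p v s vp<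
    u = t + s ∸ suc v
    e : suc (u + v) ≡ t + s
    e = trans (sym (+-suc u v)) (m∸n+n≡m (m≤n⇒m≤o+n t v<s))
    u<s : u < s
    u<s = (lin (u ∷ v ∷ t ∷ s ∷ []) 1 ((1 , con 1 ⊕ (# 0 ⊕ # 1) , # 2 ⊕ # 3) ∷ (1 , # 2 , # 1) ∷ [])
        (con 1 ⊕ # 0) (# 3) (≤-reflexive e) t≤v)

  private
    module Extension {p r a b a′ b′ : ℕ} (0<p : 0 < p) (P : Period p a b) (R : Period r a′ b′)
                     (a≤ : a ≤ a′) (≤b : b′ ≤ b) (long : a′ + p + r ≤ b′) where

      -- Left of `a′` the period `p` moves the comparison of `v` with `v + r` to the right until it
      -- falls into the stretch of `R`; `long` prevents it from jumping past the end of that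
      -- stretch. The argument `k` bounds the distance still to go.
      upwards : ∀ k v → a′ ≤ v + k → a ≤ v → v + r < b′ → T v ≡ T (v + r)
      upwards k v near a≤v vr< with a′ ≤? v
      upwards k v near a≤v vr< | yes a′≤v = R v a′≤v vr<
      upwards zero v near a≤v vr< | no a′≰v = contradiction (lin (a′ ∷ v ∷ []) 1
          ((1 , # 0 , # 1 ⊕ con 0) ∷ []) (# 0) (# 1) near) a′≰v
      upwards (suc k) v near a≤v vr< | no a′≰v = begin
        T v           ≡⟨ P v a≤v (lin (v ∷ a′ ∷ p ∷ r ∷ b′ ∷ b ∷ []) 1
            ((1 , con 1 ⊕ # 0 , # 1) ∷ (1 , (# 1 ⊕ # 2) ⊕ # 3 , # 4) ∷ (1 , # 4 , # 5) ∷ [])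
            (con 1 ⊕ (# 0 ⊕ # 2)) (# 5) v<a′ long ≤b) ⟩
        T (v + p)     ≡⟨ upwards k (v + p) (lin (a′ ∷ v ∷ k ∷ p ∷ []) 1
            ((1 , # 0 , # 1 ⊕ (con 1 ⊕ # 2)) ∷ (1 , con 1 ⊕ con 0 , # 3) ∷ []) (# 0) ((# 1 ⊕ # 3) ⊕ # 2) near 0<p)
                           (m≤n⇒m≤n+o p a≤v)
                           (lin (v ∷ a′ ∷ p ∷ r ∷ b′ ∷ []) 1
                               ((1 , con 1 ⊕ # 0 , # 1) ∷ (1 , (# 1 ⊕ # 2) ⊕ # 3 , # 4) ∷ [])
                               (con 1 ⊕ ((# 0 ⊕ # 2) ⊕ # 3)) (# 4) v<a′ long) ⟩
        T (v + p + r) ≡⟨ cong T (lin≡ (v ∷ p ∷ r ∷ []) [] ((# 0 ⊕ # 1) ⊕ # 2) ((# 0 ⊕ # 2) ⊕ # 1)) ⟩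
        T (v + r + p) ≡⟨ P (v + r) (m≤n⇒m≤n+o r a≤v)
                           (lin (v ∷ a′ ∷ p ∷ r ∷ b′ ∷ b ∷ []) 1
                               ((1 , con 1 ⊕ # 0 , # 1) ∷ (1 , (# 1 ⊕ # 2) ⊕ # 3 , # 4) ∷ (1 , # 4 , # 5) ∷
                               []) (con 1 ⊕ ((# 0 ⊕ # 3) ⊕ # 2)) (# 5) v<a′ long ≤b) ⟨
        T (v + r)     ∎
        where
        open ≡-Reasoning
        v<a′ = ≰⇒> a′≰v

      -- The mirror image of `upwards`: comparisons that reach beyond `b′` are moved to the left by
      -- `p`, until `upwards` takes over.
      downwards : ∀ k v → v ≤ k → a ≤ v → v + r < b → T v ≡ T (v + r)
      downwards k v v≤k a≤v vr<b with v + r <? b′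
      downwards k v v≤k a≤v vr<b | yes vr<b′ = upwards a′ v (m≤n+m a′ v) a≤v vr<b′
      downwards zero v v≤k a≤v vr<b | no vr≮b′ =
        contradiction (lin (v ∷ a′ ∷ p ∷ r ∷ b′ ∷ []) 1 ((1 , # 0 , con 0) ∷ (1 , (# 1 ⊕ # 2) ⊕ # 3 , # 4)
            ∷ (1 , con 1 ⊕ con 0 , # 2) ∷ []) (con 1 ⊕ (# 0 ⊕ # 3)) (# 4) v≤k long 0<p) vr≮b′
      downwards (suc k) v v≤k a≤v vr<b | no vr≮b′ = begin
        T v           ≡⟨ cong T back ⟨
        T (v′ + p)    ≡⟨ P v′ a≤v′ (lin (v′ ∷ p ∷ v ∷ r ∷ b ∷ []) 1
            ((1 , # 0 ⊕ # 1 , # 2) ∷ (1 , con 1 ⊕ (# 2 ⊕ # 3) , # 4) ∷ []) (con 1 ⊕ (# 0 ⊕ # 1)) (# 4)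
            (≤-reflexive back) vr<b) ⟨
        T v′          ≡⟨ downwards k v′ (lin (v′ ∷ p ∷ v ∷ k ∷ []) 1
            ((1 , # 0 ⊕ # 1 , # 2) ∷ (1 , # 2 , con 1 ⊕ # 3) ∷ (1 , con 1 ⊕ con 0 , # 1) ∷ []) (# 0) (# 3)
            (≤-reflexive back) v≤k 0<p) a≤v′
                           (lin (v′ ∷ p ∷ v ∷ r ∷ b ∷ []) 1 ((1 , # 0 ⊕ # 1 , # 2) ∷
                               (1 , con 1 ⊕ (# 2 ⊕ # 3) , # 4) ∷ []) (con 1 ⊕ (# 0 ⊕ # 3)) (# 4)
                               (≤-reflexive back) vr<b) ⟩
        T (v′ + r)    ≡⟨ P (v′ + r) (m≤n⇒m≤n+o r a≤v′) (lin (v′ ∷ p ∷ v ∷ r ∷ b ∷ []) 1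
            ((1 , # 0 ⊕ # 1 , # 2) ∷ (1 , con 1 ⊕ (# 2 ⊕ # 3) , # 4) ∷ []) (con 1 ⊕ ((# 0 ⊕ # 3) ⊕ # 1))
            (# 4) (≤-reflexive back) vr<b) ⟩
        T (v′ + r + p) ≡⟨ cong T (lin≡ (v′ ∷ p ∷ v ∷ r ∷ []) ((1 , # 0 ⊕ # 1 , # 2) ∷ [])
            ((# 0 ⊕ # 3) ⊕ # 1) (# 2 ⊕ # 3) back) ⟩
        T (v + r)     ∎
        where
        open ≡-Reasoning
        b′≤vr = ≮⇒≥ vr≮b′
        v′ = v ∸ p
        back : v′ + p ≡ v
        back = m∸n+n≡m (lin (b′ ∷ v ∷ r ∷ a′ ∷ p ∷ []) 1 ((1 , # 0 , # 1 ⊕ # 2) ∷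
            (1 , (# 3 ⊕ # 4) ⊕ # 2 , # 0) ∷ []) (# 4) (# 1) b′≤vr long)
        a≤v′ : a ≤ v′
        a≤v′ = (lin (v′ ∷ p ∷ v ∷ b′ ∷ r ∷ a′ ∷ a ∷ []) 1 ((1 , # 2 , # 0 ⊕ # 1) ∷ (1 , # 3 , # 2 ⊕ # 4) ∷
            (1 , (# 5 ⊕ # 1) ⊕ # 4 , # 3) ∷ (1 , # 6 , # 5) ∷ []) (# 6) (# 0) (≤-reflexive (sym back))
            b′≤vr long a≤)

  -- A second period that holds on a stretch of length at least p + r is carried along by p.
  period-extends : ∀ {p r a b a′ b′} → 0 < p → Period p a b → Period r a′ b′ →
                   a ≤ a′ → b′ ≤ b → a′ + p + r ≤ b′ → Period r a b
  period-extends 0<p P R a≤ ≤b long v = Extension.downwards 0<p P R a≤ ≤b long v v ≤-refl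

  -- The middle palindrome of three that share their left end t survives until h together
  -- with the last one, if it has not left the stretch mirrored by the first one by then.
  middle-survives : ∀ {t s p r k h w} →
    Pal (t + s) s → Pal (t + (s + p)) (s + p) → Pal (t + (s + p + r)) (s + p + r) →
    w ≤ s → t + (p + r) + r ≤ w →
    s ≤ k → k ≤ h → k ≤ t + s → Pal (t + s) k → Pal (t + (s + p + r)) h → h ≤ p + k → Pal (t + (s + p)) h
  middle-survives {t} {s} {p} {zero} {h = h} _ _ _ _ _ _ _ _ _ Q _ = subst (λ x → Pal x h)
      (lin≡ (t ∷ s ∷ p ∷ []) [] (# 0 ⊕ ((# 1 ⊕ # 2) ⊕ con 0)) (# 0 ⊕ (# 1 ⊕ # 2))) Q
  middle-survives {t} {s} {p} {r@(suc r-1)} {k} {h} {w} A B C w≤s long s≤k k≤h k≤x P Q reach = mid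
    where
    -- The first and the last palindrome are both alive at time `k`, and `t + s - k` is where the
    -- first one then begins.
    I : Period (p + r) (t + s ∸ k) k
    I = two-palindromes P (Pal-≤ k≤h (subst (λ x → Pal x h) (lin≡ (t ∷ s ∷ p ∷ r ∷ []) []
        (# 0 ⊕ ((# 1 ⊕ # 2) ⊕ # 3)) ((# 0 ⊕ # 1) ⊕ (# 2 ⊕ # 3))) Q)) (t + s ∸ k)
          (≤-reflexive (sym (m∸n+n≡m k≤x))) k≤x
    a≤t : t + s ∸ k ≤ t
    a≤t = ≤-trans (∸-monoʳ-≤ (t + s) s≤k) (≤-reflexive (m+n∸n≡m t s))
    J : Period r t w
    J v t≤v vr< = two-prefix-palindromes B C v t≤v (lin (v ∷ r ∷ w ∷ s ∷ p ∷ []) 1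
        ((1 , con 1 ⊕ (# 0 ⊕ # 1) , # 2) ∷ (1 , # 2 , # 3) ∷ []) (con 1 ⊕ (# 0 ⊕ # 1)) ((# 3 ⊕ # 4) ⊕ # 1) vr< w≤s)
    E : Period r (t + s ∸ k) k
    E = period-extends (lin (p ∷ r-1 ∷ []) 1 [] (con 1 ⊕ con 0) (# 0 ⊕ (con 1 ⊕ # 1))) I J a≤t (≤-trans w≤s s≤k) long
    -- A position beyond the end of the second palindrome is reflected by the last one to `v + r`,
    -- and `E` brings this back to `v`. The hypothesis `reach` keeps `v` within the stretch of `E`.
    far : ∀ u v → suc (u + v) ≡ t + (s + p) → u < h → s + p ≤ u → T u ≡ T v
    far u v e u<h s≤u =
      trans (Q u (v + r) (lin≡ (u ∷ v ∷ t ∷ s ∷ p ∷ r ∷ []) ((1 , con 1 ⊕ (# 0 ⊕ # 1) , # 2 ⊕ (# 3 ⊕ # 4))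
          ∷ []) (con 1 ⊕ (# 0 ⊕ (# 1 ⊕ # 5))) (# 2 ⊕ ((# 3 ⊕ # 4) ⊕ # 5)) e) u<h
              (lin (v ∷ r ∷ k ∷ h ∷ []) 1 ((1 , con 1 ⊕ (# 0 ⊕ # 1) , # 2) ∷ (1 , # 2 , # 3) ∷ [])
                  (con 1 ⊕ (# 0 ⊕ # 1)) (# 3) vrk k≤h))
            (sym (E v a≤v vrk))
      where
      vrk : v + r < k
      vrk = (lin (u ∷ v ∷ t ∷ s ∷ p ∷ r ∷ w ∷ k ∷ []) 1 ((1 , con 1 ⊕ (# 0 ⊕ # 1) , # 2 ⊕ (# 3 ⊕ # 4)) ∷
          (1 , # 3 ⊕ # 4 , # 0) ∷ (1 , (# 2 ⊕ (# 4 ⊕ # 5)) ⊕ # 5 , # 6) ∷ (1 , # 6 , # 3) ∷ (1 , # 3 , # 7)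
          ∷ []) (con 1 ⊕ (# 1 ⊕ # 5)) (# 7) (≤-reflexive e) s≤u long w≤s s≤k)
      a≤v : t + s ∸ k ≤ v
      a≤v = m≤n+o⇒m∸n≤o (t + s) k (lin (u ∷ v ∷ t ∷ s ∷ p ∷ h ∷ k ∷ []) 1
          ((1 , # 2 ⊕ (# 3 ⊕ # 4) , con 1 ⊕ (# 0 ⊕ # 1)) ∷ (1 , # 5 , # 4 ⊕ # 6) ∷ (1 , con 1 ⊕ # 0 , # 5)
          ∷ []) (# 2 ⊕ # 3) (# 6 ⊕ # 1) (≤-reflexive (sym e)) reach u<h)
    mid : Pal (t + (s + p)) h
    mid u v e u<h v<h with u <? s + p | v <? s + p
    ... | yes u< | yes v< = B u v e u< v<
    ... | no u≮ | _ = far u v e u<h (≮⇒≥ u≮)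
    ... | yes _ | no v≮ = sym (far v u (trans (cong suc (+-comm v u)) e) v<h (≮⇒≥ v≮))

  -- Consecutive gaps between palindromic prefixes of similar lengths agree: a smaller
  -- last gap r could be copied to the left, a larger one contains a copy of the gap q.
  shift-down : ∀ {t s r} → Pal (t + (s + r)) (s + r) → Pal (t + (s + r + r)) (s + r + r) → Pal (t + s) s
  shift-down {t} {s} {r} B C u v e u<s v<s =
    trans (B u (v + r) (lin≡ (u ∷ v ∷ t ∷ s ∷ r ∷ []) ((1 , con 1 ⊕ (# 0 ⊕ # 1) , # 2 ⊕ # 3) ∷ [])
        (con 1 ⊕ (# 0 ⊕ (# 1 ⊕ # 4))) (# 2 ⊕ (# 3 ⊕ # 4)) e) (m≤n⇒m≤n+o r u<s) (+-monoˡ-< r v<s))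
      (sym (two-prefix-palindromes B C v
             (lin (u ∷ v ∷ t ∷ s ∷ []) 1 ((1 , # 2 ⊕ # 3 , con 1 ⊕ (# 0 ⊕ # 1)) ∷ (1 , con 1 ⊕ # 0 , # 3) ∷
                 []) (# 2) (# 1) (≤-reflexive (sym e)) u<s) (lin (v ∷ s ∷ r ∷ []) 1
                 ((1 , con 1 ⊕ # 0 , # 1) ∷ []) (con 1 ⊕ (# 0 ⊕ # 2)) ((# 1 ⊕ # 2) ⊕ # 2) v<s)))

  shift-up : ∀ {t s q k} → Pal (t + s) s → Pal (t + (s + q)) (s + q) → Pal (t + (s + q + (k + q))) (s + q + (k + q)) →
             t + (k + q) + q ≤ s + q → 0 < q → Pal (t + (s + q + k)) (s + q + k)
  shift-up {t} {s} {q} {k} A B C long 0<q u v e u< v< =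
    trans (C u (v + q) (lin≡ (u ∷ v ∷ t ∷ s ∷ q ∷ k ∷ []) ((1 , con 1 ⊕ (# 0 ⊕ # 1) , # 2 ⊕
        ((# 3 ⊕ # 4) ⊕ # 5)) ∷ []) (con 1 ⊕ (# 0 ⊕ (# 1 ⊕ # 4))) (# 2 ⊕ ((# 3 ⊕ # 4) ⊕ (# 5 ⊕ # 4))) e)
             (lin (u ∷ s ∷ q ∷ k ∷ []) 1 ((1 , con 1 ⊕ # 0 , (# 1 ⊕ # 2) ⊕ # 3) ∷ []) (con 1 ⊕ # 0)
                 ((# 1 ⊕ # 2) ⊕ (# 3 ⊕ # 2)) u<) (lin (v ∷ s ∷ q ∷ k ∷ []) 1
                 ((1 , con 1 ⊕ # 0 , (# 1 ⊕ # 2) ⊕ # 3) ∷ []) (con 1 ⊕ (# 0 ⊕ # 2)) ((# 1 ⊕ # 2) ⊕ (# 3 ⊕ # 2)) v<))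
      (sym (E v (lin (u ∷ v ∷ t ∷ s ∷ q ∷ k ∷ []) 1 ((1 , # 2 ⊕ ((# 3 ⊕ # 4) ⊕ # 5) , con 1 ⊕ (# 0 ⊕ # 1))
          ∷ (1 , con 1 ⊕ # 0 , (# 3 ⊕ # 4) ⊕ # 5) ∷ []) (# 2) (# 1) (≤-reflexive (sym e)) u<)
               (lin (v ∷ s ∷ q ∷ k ∷ []) 1 ((1 , con 1 ⊕ # 0 , (# 1 ⊕ # 2) ⊕ # 3) ∷ [])
                   (con 1 ⊕ (# 0 ⊕ # 2)) ((# 1 ⊕ # 2) ⊕ (# 3 ⊕ # 2)) v<)))
    where
    -- The period `q` of the first two palindromes is carried over the whole third one by the period
    -- `k + q` of the last two; `long` provides the overlap.
    E : Period q t (s + q + (k + q))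
    E = period-extends (lin (q ∷ k ∷ []) 1 ((1 , con 1 ⊕ con 0 , # 0) ∷ []) (con 1 ⊕ con 0) (# 1 ⊕ # 0) 0<q)
          (two-prefix-palindromes B C) (two-prefix-palindromes A B) ≤-refl (m≤m+n (s + q) _) long

open import Defs using (⟦_⟧; quo; rem)

-- Congruences

quo-NonZero : ∀ x y .{{_ : NonZero y}} → ⟦ quo ⟧ x y ≡ x / y
quo-NonZero x (suc y) = refl

rem-NonZero : ∀ x y .{{_ : NonZero y}} → ⟦ rem ⟧ x y ≡ x % y
rem-NonZero x (suc y) = refl

-- Multiples of `g` are added on both sides, which avoids subtraction and any distinction of the
-- larger side.
record Congruent (g a b : ℕ) : Set where
  constructor congruent
  field
    k l   : ℕ
    balance : a + k * g ≡ b + l * g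

module _ {g : ℕ} where

  ≈-reflexive : ∀ {a b} → a ≡ b → Congruent g a b
  ≈-reflexive refl = congruent 0 0 refl

  ≈-sym : ∀ {a b} → Congruent g a b → Congruent g b a
  ≈-sym (congruent k l e) = congruent l k (sym e)

  ≈-trans : ∀ {a b c} → Congruent g a b → Congruent g b c → Congruent g a c
  ≈-trans {a} {b} {c} (congruent k l e) (congruent k′ l′ e′) = congruent (k + k′) (l + l′) (begin
    a + (k + k′) * g        ≡⟨ p a k k′ g ⟩
    a + k * g + k′ * g      ≡⟨ cong (_+ k′ * g) e ⟩
    b + l * g + k′ * g      ≡⟨ q b l k′ g ⟩
    b + k′ * g + l * g      ≡⟨ cong (_+ l * g) e′ ⟩
    c + l′ * g + l * g      ≡⟨ r c l′ l g ⟩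
    c + (l + l′) * g        ∎)
    where
    open ≡-Reasoning
    p : ∀ a k k′ g → a + (k + k′) * g ≡ a + k * g + k′ * g
    p = solve-∀
    q : ∀ b l k′ g → b + l * g + k′ * g ≡ b + k′ * g + l * g
    q = solve-∀
    r : ∀ c l′ l g → c + l′ * g + l * g ≡ c + (l + l′) * g
    r = solve-∀

  ≈-+ : ∀ {a b} c → Congruent g a b → Congruent g (a + c) (b + c)
  ≈-+ {a} {b} c (congruent k l e) = congruent k l (begin
    a + c + k * g   ≡⟨ p a c (k * g) ⟩
    a + k * g + c   ≡⟨ cong (_+ c) e ⟩
    b + l * g + c   ≡⟨ p b (l * g) c ⟩
    b + c + l * g   ∎)
    where
    open ≡-Reasoning
    p : ∀ a b c → a + b + c ≡ a + c + b
    p = solve-∀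

  ≈-* : ∀ {a b} c → Congruent g a b → Congruent g (c * a) (c * b)
  ≈-* {a} {b} c (congruent k l e) = congruent (c * k) (c * l) (begin
    c * a + c * k * g ≡⟨ p c a k g ⟩
    c * (a + k * g)   ≡⟨ cong (c *_) e ⟩
    c * (b + l * g)   ≡⟨ p c b l g ⟨
    c * b + c * l * g ∎)
    where
    open ≡-Reasoning
    p : ∀ c a k g → c * a + c * k * g ≡ c * (a + k * g)
    p = solve-∀

  ≈-multiple : ∀ a k → Congruent g (a + k * g) a
  ≈-multiple a k = congruent 0 k (+-identityʳ _)

  module _ .{{_ : NonZero g}} where

    ≈-% : ∀ a → Congruent g (a % g) a
    ≈-% a = congruent (a / g) 0 (trans (sym (m≡m%n+[m/n]*n a g)) (sym (+-identityʳ a)))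

    ≈⇒%≡ : ∀ {a b} → Congruent g a b → a % g ≡ b % g
    ≈⇒%≡ {a} {b} (congruent k l e) =
      trans (sym ([m+kn]%n≡m%n a k g)) (trans (cong (_% g) e) ([m+kn]%n≡m%n b l g))

    %≡⇒≈ : ∀ {a b} → a % g ≡ b % g → Congruent g a b
    %≡⇒≈ {a} {b} e = ≈-trans (≈-sym (≈-% a)) (≈-trans (≈-reflexive e) (≈-% b))

-- (e , ι) is the result of a search through the multiples q, 2q, …, cq modulo g for the
-- least positive residue e, attained by ιq.  After g steps e is the greatest common
-- divisor of q and g, and ι solves all solvable congruences jq ≈ y.
record Search (g q c e ι : ℕ) : Set where
  field
    e>0      : 0 < e
    e≤g      : e ≤ g
    attained : Congruent g (ι * q) e
    least    : ∀ j → 0 < j → j ≤ c → ⟦ rem ⟧ (j * q) g ≡ 0 ⊎ e ≤ ⟦ rem ⟧ (j * q) g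

-- The residue of the empty multiple is represented by `g` instead of 0. This keeps `e` positive,
-- and it is the right greatest common divisor if `q` is a multiple of `g`.
search-start : ∀ {g} q → 0 < g → Search g q 0 g 0
search-start {g} q 0<g = record
  { e>0 = 0<g ; e≤g = ≤-refl ; attained = congruent 1 0 refl
  ; least = λ j 0<j j≤0 → contradiction j≤0 (<⇒≱ 0<j) }

search-keep : ∀ {g q c e ι} → Search g q c e ι →
              ⟦ rem ⟧ (suc c * q) g ≡ 0 ⊎ e ≤ ⟦ rem ⟧ (suc c * q) g → Search g q (suc c) e ι
search-keep {c = c} S new = record
  { e>0 = e>0 ; e≤g = e≤g ; attained = attained
  ; least = λ j 0<j j≤ → case-least j 0<j (m≤n⇒m<n∨m≡n j≤) }
  where
  open Search S
  case-least : ∀ j → 0 < j → j < suc c ⊎ j ≡ suc c → _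
  case-least j 0<j (inj₁ j<)   = least j 0<j (≤-pred j<)
  case-least j 0<j (inj₂ refl) = new

search-improve : ∀ {g q c e ι} → Search g q c e ι → 0 < ⟦ rem ⟧ (suc c * q) g → ⟦ rem ⟧ (suc c * q) g < e →
                 Search g q (suc c) (⟦ rem ⟧ (suc c * q) g) (suc c)
search-improve {suc g-1} {q} {c} S 0<v v<e = record
  { e>0 = 0<v ; e≤g = <⇒≤ (<-≤-trans v<e e≤g) ; attained = ≈-sym (≈-% (suc c * q))
  ; least = λ j 0<j j≤ → case-least j 0<j (m≤n⇒m<n∨m≡n j≤) }
  where
  open Search S
  case-least : ∀ j → 0 < j → j < suc c ⊎ j ≡ suc c → _
  case-least j 0<j (inj₂ refl) = inj₂ ≤-refl
  case-least j 0<j (inj₁ j<) with least j 0<j (≤-pred j<)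
  ... | inj₁ z = inj₁ z
  ... | inj₂ b = inj₂ (≤-trans (<⇒≤ v<e) b)
search-improve {zero} S 0<v v<e = contradiction (<-≤-trans v<e (Search.e≤g S)) n≮0

module Solve {g q e ι : ℕ} .{{g≢0 : NonZero g}} .{{e≢0 : NonZero e}} (S : Search g q g e ι) where
  open Search S

  least-residue : ∀ j → (j * q) % g ≡ 0 ⊎ e ≤ (j * q) % g
  least-residue j with j % g in eq
  ... | zero  = inj₁ (trans (sym (≈⇒%≡ same)) (m*n%n≡0 0 g))
    where
    same : Congruent g 0 (j * q)
    same = subst₂ (Congruent g) (*-zeroʳ q) (*-comm q j) (≈-* q (≈-trans (≈-reflexive (sym eq)) (≈-% j)))
  ... | suc i = subst (λ v → v ≡ 0 ⊎ e ≤ v) (≈⇒%≡ same)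
                  (subst (λ v → v ≡ 0 ⊎ e ≤ v) (rem-NonZero (suc i * q) g)
                    (least (suc i) z<s (≤-trans (≤-reflexive (sym eq)) (<⇒≤ (m%n<n j g)))))
    where
    same : Congruent g (suc i * q) (j * q)
    same = subst₂ (Congruent g) (*-comm q (suc i)) (*-comm q j) (≈-* q (≈-trans (≈-reflexive (sym eq)) (≈-% j)))

  -- As in the Euclidean algorithm, the remainder of `y` modulo `e` is again a residue of a multiple
  -- of `q`. It is smaller than the least positive one, hence 0.
  e∣reachable : ∀ j y → Congruent g (j * q) y → e ∣ y
  e∣reachable j y jq≈y = m%n≡0⇒n∣m y e r≡0
    where
    r = y % e
    a = y / e
    rearrange : ∀ j a ι g-1 q → (j + a * ι * g-1) * q ≡ a * g-1 * (ι * q) + j * q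
    rearrange = solve-∀
    collect : ∀ r a e g-1 → r + a * e + a * g-1 * e ≡ r + a * e * (1 + g-1)
    collect = solve-∀
    -- The factor `pred g` stands for -1 modulo `g`: the intended multiplier is `j - a * ι`.
    j′ = j + a * ι * pred g
    j′q≈r : Congruent g (j′ * q) r
    j′q≈r = ≈-trans (≈-reflexive (rearrange j a ι (pred g) q))
      (≈-trans (≈-+ (j * q) (≈-* (a * pred g) attained))
      (≈-trans (≈-reflexive (+-comm (a * pred g * e) (j * q)))
      (≈-trans (≈-+ (a * pred g * e) jq≈y)
      (≈-trans (≈-reflexive (trans (cong (_+ a * pred g * e) (m≡m%n+[m/n]*n y e))
                 (trans (collect r a e (pred g)) (cong (λ n → r + a * e * n) (suc-pred g)))))
      (≈-multiple r (a * e))))))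
    r<e = m%n<n y e
    residue : (j′ * q) % g ≡ r
    residue = trans (≈⇒%≡ j′q≈r) (m<n⇒m%n≡m (<-≤-trans r<e e≤g))
    r≡0 : r ≡ 0
    r≡0 with least-residue j′
    ... | inj₁ z = trans (sym residue) z
    ... | inj₂ b = contradiction (subst (e ≤_) residue b) (<⇒≱ r<e)

  e∣g : e ∣ g
  e∣g = e∣reachable 0 g (congruent 1 0 refl)

  G : ℕ
  G = g / e

  G*e : G * e ≡ g
  G*e = m/n*n≡m e∣g

  G>0 : 0 < G
  G>0 = m≥n⇒m/n>0 e≤g

  instance
    G≢0 : NonZero G
    G≢0 = >-nonZero G>0

  g∣G*q : g ∣ G * q
  g∣G*q with e∣reachable 1 q (≈-reflexive (+-identityʳ q))
  ... | divides q′ refl = divides q′ (begin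
    G * (q′ * e) ≡⟨ cong (G *_) (*-comm q′ e) ⟩
    G * (e * q′) ≡⟨ *-assoc G e q′ ⟨
    G * e * q′   ≡⟨ cong (_* q′) G*e ⟩
    g * q′       ≡⟨ *-comm g q′ ⟩
    q′ * g       ∎)
    where open ≡-Reasoning

  -- Multiplying  jq ≈ y = (y / e) e ≈ (y / e) ιq  by ι turns q into e on both sides.
  solution : ∀ j y → Congruent g (j * q) y → j % G ≡ (y / e * ι) % G
  solution j y jq≈y = ≈⇒%≡ (cancel je≈ie)
    where
    i = y / e * ι
    swap : ∀ ι j q → ι * (j * q) ≡ j * (ι * q)
    swap = solve-∀
    swap′ : ∀ a ι q → a * (ι * q) ≡ a * ι * q
    swap′ = solve-∀
    y≈ : Congruent g (i * q) y
    y≈ = ≈-trans (≈-reflexive (sym (swap′ (y / e) ι q)))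
           (≈-trans (≈-* (y / e) attained) (≈-reflexive (m/n*n≡m (e∣reachable j y jq≈y))))
    times-ι : ∀ a → Congruent g (ι * (a * q)) (a * e)
    times-ι a = ≈-trans (≈-reflexive (swap ι a q)) (≈-* a attained)
    je≈ie : Congruent g (j * e) (i * e)
    je≈ie = ≈-trans (≈-sym (times-ι j)) (≈-trans (≈-* ι (≈-trans jq≈y (≈-sym y≈))) (times-ι i))
    cancel : Congruent g (j * e) (i * e) → Congruent G j i
    cancel (congruent k l eq) = congruent k l (*-cancelʳ-≡ (j + k * G) (i + l * G) e (begin
      (j + k * G) * e     ≡⟨ distribute j k G e ⟩
      j * e + k * (G * e) ≡⟨ cong (λ n → j * e + k * n) G*e ⟩
      j * e + k * g       ≡⟨ eq ⟩
      i * e + l * g       ≡⟨ cong (λ n → i * e + l * n) G*e ⟨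
      i * e + l * (G * e) ≡⟨ distribute i l G e ⟨
      (i + l * G) * e     ∎))
      where
      open ≡-Reasoning
      distribute : ∀ j k G e → (j + k * G) * e ≡ j * e + k * (G * e)
      distribute = solve-∀

-- After a complete search this is the least `j` for which `g` divides `j * q + d`, if there is one.
-- The solutions repeat with period `g / e`.
first-solution : (g q e ι d : ℕ) → ℕ
first-solution g q e ι d = ⟦ rem ⟧ (⟦ quo ⟧ (⟦ rem ⟧ (g ∸ d) g) e * ι) (⟦ quo ⟧ g e)

-- Valid for arbitrary `e` and `ι`, so a start that is itself due is found even before the search is
-- complete or has begun.
first-solution-0 : ∀ g q e ι → first-solution g q e ι 0 ≡ 0
first-solution-0 zero      q zero    ι = refl
first-solution-0 zero      q (suc e) ι = cong (λ n → ⟦ rem ⟧ n 0) {x = 0 / suc e * ι} {y = 0}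
    (cong (_* ι) (0/n≡0 (suc e)))
first-solution-0 (suc g-1) q e ι = trans (cong (λ n → ⟦ rem ⟧ (⟦ quo ⟧ n e * ι) G) (n%n≡0 (suc g-1))) (zero-rem e)
  where
  G = ⟦ quo ⟧ (suc g-1) e
  rem-0 : ∀ n → ⟦ rem ⟧ 0 n ≡ 0
  rem-0 zero    = refl
  rem-0 (suc n) = m*n%n≡0 0 (suc n)
  zero-rem : ∀ e → ⟦ rem ⟧ (⟦ quo ⟧ 0 e * ι) (⟦ quo ⟧ (suc g-1) e) ≡ 0
  zero-rem zero    = refl
  zero-rem (suc e) = trans (cong (λ n → ⟦ rem ⟧ (n * ι) (⟦ quo ⟧ (suc g-1) (suc e))) (0/n≡0 (suc e)))
      (rem-0 (⟦ quo ⟧ (suc g-1) (suc e)))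

-- The field `step` says that consecutive solutions are a positive multiple of `g` apart when
-- measured in the text. In particular a stride is at least `g`, which `far` relies on.
record Solutions (g q e ι d j : ℕ) : Set where
  field
    multiple  : ℕ
    j≡        : j ≡ first-solution g q e ι d + multiple * ⟦ quo ⟧ g e
    step      : ∃[ k ] 0 < k × q * ⟦ quo ⟧ g e ≡ k * g

solutions : ∀ {g q e ι} → 0 < g → 0 < q → Search g q g e ι →
            ∀ j d → d < g → Congruent g (j * q + d) 0 → Solutions g q e ι d j
solutions {g@(suc _)} {q} {zero} _ _ S = contradiction (Search.e>0 S) n≮0
solutions {g@(suc g-1)} {q@(suc q-1)} {e@(suc e-1)} {ι} _ _ S j d d<g jqd≈0 = record
  { multiple = j / G
  ; j≡ = begin
      j                     ≡⟨ m≡m%n+[m/n]*n j G ⟩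
      j % G + j / G * G     ≡⟨ cong (_+ j / G * G) (trans (solution j y jq≈y) (sym (rem-NonZero (y / e * ι) G))) ⟩
      first-solution g q e ι d + j / G * G ∎
  ; step = k , k>0 , trans (*-comm q G) eq }
  where
  open Solve S
  open ≡-Reasoning
  y = (g ∸ d) % g
  jq≈y : Congruent g (j * q) y
  jq≈y = ≈-trans (≈-sym (≈-trans (≈-reflexive (trans (+-assoc (j * q) d (g ∸ d))
                    (cong (j * q +_) (trans (m+[n∸m]≡n (<⇒≤ d<g)) (sym (+-identityʳ g)))))) (≈-multiple (j * q) 1)))
           (≈-trans (≈-+ (g ∸ d) jqd≈0) (≈-sym (≈-% (g ∸ d))))
  k = quotient g∣G*q
  eq : G * q ≡ k * g
  eq = _∣_.equality g∣G*q
  k>0 : 0 < k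
  k>0 with k | eq
  ... | zero  | z = contradiction (m*n≢0 G q) (λ nz → contradiction z (≢-nonZero⁻¹ (G * q) {{nz}}))
  ... | suc _ | _ = z<s

-- Following the palindromes that start after one position

≡ᵇ-true : ∀ {a b} → (a ≡ᵇ b) ≡ true → a ≡ b
≡ᵇ-true {a} {b} e = ≡ᵇ⇒≡ a b (subst T (sym e) _)

≡ᵇ-false : ∀ {a b} → (a ≡ᵇ b) ≡ false → a ≢ b
≡ᵇ-false {a} {b} e a≡b = subst T e (≡⇒≡ᵇ a b a≡b)

<ᵇ-true : ∀ {a b} → (a <ᵇ b) ≡ true → a < b
<ᵇ-true {a} {b} e = <ᵇ⇒< a b (subst T (sym e) _)

<ᵇ-false : ∀ {a b} → (a <ᵇ b) ≡ false → b ≤ a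
<ᵇ-false {a} {b} e = ≮⇒≥ (λ a<b → subst T e (<⇒<ᵇ a<b))

-- 0 stands for the minimum of the empty set.
min₀ : ℕ → ℕ → ℕ
min₀ y x = if y ≡ᵇ 0 then x else (if x <ᵇ y then x else y)

min₀-sel : ∀ y x → min₀ y x ≡ x ⊎ (0 < y × min₀ y x ≡ y)
min₀-sel zero    x = inj₁ refl
min₀-sel (suc y) x with x <ᵇ suc y
... | true  = inj₁ refl
... | false = inj₂ (z<s , refl)

min₀-≤ʳ : ∀ y x → min₀ y x ≤ x
min₀-≤ʳ zero    x = ≤-refl
min₀-≤ʳ (suc y) x with x <ᵇ suc y in eq
... | true  = ≤-refl
... | false = <ᵇ-false eq

min₀-≤ˡ : ∀ {y} x → 0 < y → min₀ y x ≤ y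
min₀-≤ˡ {suc y} x _ with x <ᵇ suc y in eq
... | true  = <⇒≤ (<ᵇ-true eq)
... | false = ≤-refl

min₀-> : ∀ y {x} → 0 < x → 0 < min₀ y x
min₀-> y {x} 0<x with min₀-sel y x
... | inj₁ e         = subst (0 <_) (sym e) 0<x
... | inj₂ (0<y , e) = subst (0 <_) (sym e) 0<y

-- first and least are the least palindromes known from the previous and the current
-- stretch of g time units, gap and last describe the arithmetic progression of all
-- palindromes found, and count, residue and inverse are a search in the sense of Search.
record Slot : Set where
  constructor slot
  field
    first least gap last count residue inverse : ℕ

open Slot

-- The landmark in question is `x - h`. The bound `R`, which will be at least `h`, expresses that
-- the level has not yet forgotten it, and `x ≤ 2 * h` that it does not lie ahead.
allowed : (h g R x : ℕ) → Bool
allowed h g R x = ((R <ᵇ 1 + x) ∧ (⟦ rem ⟧ (x ∸ h) g ≡ᵇ 0)) ∧ ((⟦ rem ⟧ x 2 ≡ᵇ 0) ∧ (x <ᵇ 1 + (h + h)))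

record Context : Set where
  constructor context
  field
    t₀ Λ g h R : ℕ

module Following (c : Context) (palindrome : ℕ → Bool) where

  open Context c

  permitted : ℕ → Bool
  permitted = allowed h g R

  -- A slot is shared by blocks eight positions apart, so it is cleared when the sweep of its block
  -- begins. Otherwise each multiple of `g` opens a new stretch, for which the minimum of the last
  -- one becomes `first`.
  refresh : Slot → Slot
  refresh s = if h ∸ t₀ ≡ᵇ 6 * Λ then slot 0 0 0 0 0 0 0
              else (if ⟦ rem ⟧ h g ≡ᵇ 0 then record s { first = least s ; least = 0 } else s)

  attempt : ℕ → List ℕ
  attempt x = if permitted x then x ∷ [] else []

  hit : ℕ → Bool
  hit x = permitted x ∧ palindrome x

  follow : Slot → ℕ → Slot
  follow s x = if last s <ᵇ x then s else (if hit x then record s { least = min₀ (least s) x } else s)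

  followed : Slot → ℕ → List ℕ
  followed s x = if last s <ᵇ x then [] else attempt x

  -- The first member of the progression from `first` on that is at least `R`, by division with
  -- rounding up. If the gap is 0, only one palindrome is known, and division by 0 leaves `first`.
  start : Slot → ℕ
  start s = first s + ⟦ quo ⟧ ((R ∸ first s) + (gap s ∸ 1)) (gap s) * gap s

  candidate : Slot → ℕ
  candidate s = start s + first-solution g (gap s) (residue s) (inverse s) (⟦ rem ⟧ (start s ∸ h) g) * gap s

  stride : Slot → ℕ
  stride s = gap s * ⟦ quo ⟧ g (residue s)

  revisit : Slot → Slot
  revisit s = if first s ≡ᵇ 0 then s
              else follow (follow (follow s (candidate s)) (candidate s + stride s)) (candidate s + stride s + stride s)

  revisited : Slot → List ℕ
  revisited s = if first s ≡ᵇ 0 then []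
                else followed s (candidate s) ++ followed s (candidate s + stride s)
                     ++ followed s (candidate s + stride s + stride s)

  -- The first palindrome only sets `last`; the second fixes the gap and starts the search; each
  -- later one merely prolongs the progression, since its gap turns out to be the same.
  append : Slot → ℕ → Slot
  append s x =
    if last s ≡ᵇ 0 then record s { least = min₀ (least s) x ; last = x }
    else (if gap s ≡ᵇ 0
      then slot (first s) (min₀ (least s) x) (x ∸ last s) x 0 g 0
      else record s { least = min₀ (least s) x ; last = x })

  sweep : Slot → Slot
  sweep s = if h ∸ t₀ <ᵇ 8 * Λ then (if hit (t₀ + h) then append s (t₀ + h) else s) else s

  swept : List ℕ
  swept = if h ∸ t₀ <ᵇ 8 * Λ then attempt (t₀ + h) else []

  search : Slot → Slot
  search s =
    if gap s ≡ᵇ 0 then s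
    else (if count s <ᵇ g
      then (let v = ⟦ rem ⟧ (suc (count s) * gap s) g in
        if v ≡ᵇ 0 then record s { count = suc (count s) }
        else (if v <ᵇ residue s then record s { count = suc (count s) ; residue = v ; inverse = suc (count s) }
              else record s { count = suc (count s) }))
      else s)

  abstract

    advance : Slot → Slot
    advance s = search (sweep (revisit (refresh s)))

    attempted : Slot → List ℕ
    attempted s = revisited (refresh s) ++ swept

    advance≡ : ∀ s → advance s ≡ search (sweep (revisit (refresh s)))
    advance≡ s = refl

    attempted≡ : ∀ s → attempted s ≡ revisited (refresh s) ++ swept
    attempted≡ s = refl

≈-cancel : ∀ {g} a b c → Congruent g (a + c) (b + c) → Congruent g a b
≈-cancel a b c (congruent k l e) = congruent k l (+-cancelʳ-≡ c _ _ (begin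
  a + k * _ + c ≡⟨ swap a (k * _) c ⟩
  a + c + k * _ ≡⟨ e ⟩
  b + c + l * _ ≡⟨ swap b c (l * _) ⟩
  b + l * _ + c ∎))
  where
  open ≡-Reasoning
  swap : ∀ a b c → a + b + c ≡ a + c + b
  swap = solve-∀

≈-close : ∀ {g a b} → Congruent g a b → a < b → a + g ≤ b
≈-close {g} {a} {b} (congruent k l e) a<b with k ≤? l
... | yes k≤l = contradiction
        (≤-trans (+-mono-≤ a<b (*-monoˡ-≤ g k≤l)) (≤-reflexive (sym e))) (<-irrefl refl)
... | no  k≰l = +-cancelʳ-≤ (l * g) (a + g) b (≤-trans (≤-reflexive (+-assoc a g (l * g)))
                  (≤-trans (+-monoʳ-≤ a (*-monoˡ-≤ g (≰⇒> k≰l))) (≤-reflexive e)))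

∣⇒≈ : ∀ {g a} → g ∣ a → Congruent g a 0
∣⇒≈ (divides k refl) = congruent 0 k (+-identityʳ _)

≈-∣ : ∀ {g a b} → Congruent g a b → g ∣ a → g ∣ b
≈-∣ {g} {a} {b} (congruent k l e) g∣a =
  ∣m+n∣m⇒∣n (subst (g ∣_) (trans e (+-comm b (l * g))) (∣m∣n⇒∣m+n g∣a (n∣m*n k))) (n∣m*n l)

-- The invariant of a block

module Block {A : Set} (text : ℕ → A) (t₀ Λ g : ℕ) (limit : ℕ → ℕ)
             (Λ>0 : 0 < Λ) (g>0 : 0 < g) (g≤Λ : g ≤ Λ) (g∣t₀ : g ∣ t₀)
             (limit-mono : ∀ {h k} → h ≤ k → limit h ≤ limit k)
             (limit-≥ : ∀ h → h ≤ limit h) where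

  open Words text

  instance
    g≢0 : NonZero g
    g≢0 = >-nonZero g>0

  record Hit (h x : ℕ) : Set where
    field
      inside : limit h ≤ x
      class  : Congruent g x h
      even   : 2 ∣ x
      x≤2h   : x ≤ h + h
      pal    : Pal x h

  -- Here `s` is the time at which the process was due at the landmark `t₀`. The palindrome was
  -- alive then, but may have died since.
  record Swept (c x : ℕ) : Set where
    constructor swept-at
    field
      s     : ℕ
      x≡    : x ≡ t₀ + s
      from  : t₀ + 6 * Λ ≤ s
      until : s < t₀ + 8 * Λ
      s<c   : s < c
      even  : 2 ∣ x
      pal   : Pal x s

  Swept-mono : ∀ {b c x} → b ≤ c → Swept b x → Swept c x
  Swept-mono b≤c (swept-at s x≡ fr un s<c ev pal) = swept-at s x≡ fr un (<-≤-trans s<c b≤c) ev pal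

  Swept-> : ∀ {c x} → Swept c x → 0 < x
  Swept-> {c} {x} (swept-at s x≡ fr un s<c ev pal) = (lin (x ∷ t₀ ∷ s ∷ Λ ∷ []) 1
      ((1 , # 1 ⊕ # 2 , # 0) ∷ (1 , # 1 ⊕ (6 ⊛ (# 3)) , # 2) ∷ (6 , con 1 ⊕ con 0 , # 3) ∷ [])
      (con 1 ⊕ con 0) (# 0) (≤-reflexive (sym x≡)) fr Λ>0)

  -- The state after sweeping up to time c and revisiting at the times from β to b.
  record Invariant (β b c c′ : ℕ) (σ : Slot) : Set where
    field
      last-swept    : 0 < last σ → Swept c (last σ)
      last-greatest : ∀ {x} → Swept c x → x ≤ last σ
      one           : gap σ ≡ 0 → ∀ {x} → Swept c x → x ≡ last σ
      gaps          : 0 < gap σ → ∀ {x x′} → Swept c x → Swept c x′ → x ≤ x′ → ∃[ j ] x′ ≡ x + j * gap σ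
      steps         : 0 < gap σ → ∀ {x} → Swept c x → x + gap σ ≤ last σ → Swept c (x + gap σ)
      previous      : 0 < gap σ → ∃[ x ] Swept c x × x + gap σ ≡ last σ
      least-swept   : 0 < least σ → Swept c (least σ) × Pal (least σ) β × β ≤ least σ
      least-least   : ∀ {x} → Swept c x → ∀ τ → β ≤ τ → τ < b → Congruent g x τ → limit τ ≤ x → Pal x τ →
                      0 < least σ × least σ ≤ x
      first-swept   : 0 < first σ → Swept c (first σ) × Pal (first σ) (β ∸ g) × β ∸ g ≤ first σ
      -- Such a palindrome was due once in the stretch of `g` time units before `β`, if only at its
      -- own sweep, and was alive then.
      first-least   : ∀ {x} → Swept β x → limit β ≤ x → Pal x β → 0 < first σ × first σ ≤ x
      searching     : 0 < gap σ → Search g (gap σ) (count σ) (residue σ) (inverse σ) × count σ ≤ g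
      -- The search began with the second palindrome and has gained one multiplier per time unit up
      -- to `c′`. A palindrome more than `count` time units old is therefore the first one.
      recent        : 0 < gap σ → count σ < g → ∀ {x} → Swept c x → x + count σ < t₀ + c′ →
                      ∀ {x′} → Swept c x′ → x ≤ x′

    steps* : 0 < gap σ → ∀ n {x} → Swept c x → x + n * gap σ ≤ last σ → Swept c (x + n * gap σ)
    steps* 0<q zero    {x} S le = subst (Swept c) (sym (+-identityʳ x)) S
    steps* 0<q (suc n) {x} S le = subst (Swept c) (+-assoc x (gap σ) (n * gap σ))
      (steps* 0<q n (steps 0<q S (≤-trans (m≤m+n (x + gap σ) (n * gap σ)) le′)) le′)
      where
      le′ : x + gap σ + n * gap σ ≤ last σ
      le′ = subst (_≤ last σ) (sym (+-assoc x (gap σ) (n * gap σ))) le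

  open Invariant

  invariant-start : ∀ {h} → h ≡ t₀ + 6 * Λ → Invariant h h h h (slot 0 0 0 0 0 0 0)
  invariant-start {h} h≡ = record
    { last-swept = λ () ; last-greatest = λ S → ⊥-elim (none S) ; one = λ _ S → ⊥-elim (none S)
    ; gaps = λ () ; steps = λ () ; previous = λ () ; least-swept = λ ()
    ; least-least = λ S → ⊥-elim (none S) ; first-swept = λ () ; first-least = λ S → ⊥-elim (none S)
    ; searching = λ () ; recent = λ () }
    where
    none : ∀ {x} → ¬ Swept h x
    -- With multiplier 0 for the conclusion, the hypotheses of `lin` refute each other; `1 ≤ 0` is
    -- only the form in which this is delivered.
    none (swept-at s x≡ fr un s<c ev pal) = (n≮0 (lin (t₀ ∷ Λ ∷ s ∷ h ∷ []) 0
        ((1 , # 0 ⊕ (6 ⊛ (# 1)) , # 2) ∷ (1 , con 1 ⊕ # 2 , # 3) ∷ (1 , # 3 , # 0 ⊕ (6 ⊛ (# 1))) ∷ [])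
        (con 1) (con 0) fr s<c (≤-reflexive h≡)))

  invariant-turn : ∀ {β h σ} → β + g ≡ h → Invariant β h h h σ →
                   Invariant h h h h (record σ { first = least σ ; least = 0 })
  invariant-turn {β} {h} {σ} refl I = record
    { last-swept = last-swept I ; last-greatest = last-greatest I ; one = one I ; gaps = gaps I
    ; steps = steps I ; previous = previous I
    ; least-swept = λ ()
    ; least-least = λ S τ h≤τ τ<h → contradiction τ<h (≤⇒≯ h≤τ)
    ; first-swept = λ 0<l → subst (λ k → Swept h (least σ) × Pal (least σ) k × k ≤ least σ)
                              (sym (m+n∸n≡m β g)) (least-swept I 0<l)
    ; first-least = kept
    ; searching = searching I ; recent = recent I }
    where
    kept : ∀ {x} → Swept (β + g) x → limit (β + g) ≤ x → Pal x (β + g) → 0 < least σ × least σ ≤ x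
    kept {x} S lim P = least-least I S τ (m≤m+n β _) τ< x≈τ (≤-trans (limit-mono (<⇒≤ τ<)) lim) (Pal-≤ (<⇒≤ τ<) P)
      where
      -- The only time of the stretch from `β` to `β + g` that is congruent to `x`.
      τ = β + (x ∸ β) % g
      τ< : τ < β + g
      τ< = +-monoʳ-< β (m%n<n (x ∸ β) g)
      β≤x : β ≤ x
      β≤x = ≤-trans (m≤m+n β g) (≤-trans (limit-≥ (β + g)) lim)
      x≈τ : Congruent g x τ
      x≈τ = ≈-trans (≈-reflexive (sym (m∸n+n≡m β≤x)))
              (≈-trans (≈-+ β (≈-sym (≈-% (x ∸ β)))) (≈-reflexive (+-comm ((x ∸ β) % g) β)))

-- One time unit in the life of a block

module BlockStep {A : Set} (text : ℕ → A) (t₀ Λ g : ℕ) (limit : ℕ → ℕ)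
             (Λ>0 : 0 < Λ) (g>0 : 0 < g) (g≤Λ : g ≤ Λ) (g∣t₀ : g ∣ t₀)
             (limit-mono : ∀ {h k} → h ≤ k → limit h ≤ limit k)
             (limit-≥ : ∀ h → h ≤ limit h)
             (h β : ℕ) (β≤h : β ≤ h) (h<β+g : h < β + g)
             (h>0 : 0 < h) (palindrome : ℕ → Bool)
             where

  open Words text
  open Block text t₀ Λ g limit Λ>0 g>0 g≤Λ g∣t₀ limit-mono limit-≥
  open Following (context t₀ Λ g h (limit h)) palindrome
  open Slot
  open Invariant

  module Correct (hit-sound : ∀ {x} → hit x ≡ true → Hit h x)
                 (hit-complete : ∀ {x} → Hit h x → hit x ≡ true) where

    record Revisited (σ : Slot) (x : ℕ) : Set where
      field
        y       : ℕ
        result  : follow σ x ≡ record σ { least = y }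
        source  : 0 < y → y ≡ least σ ⊎ (y ≡ x × hit x ≡ true × x ≤ last σ)
        ≤-old   : 0 < least σ → 0 < y × y ≤ least σ
        ≤-hit   : hit x ≡ true → x ≤ last σ → 0 < x → 0 < y × y ≤ x

    hit⇒attempt : ∀ x → hit x ≡ true → x ∈ attempt x
    hit⇒attempt x e with permitted x
    ... | true = here refl

    hit⇒followed : ∀ σ x → hit x ≡ true → x ≤ last σ → x ∈ followed σ x
    hit⇒followed σ x e x≤ with last σ <ᵇ x in eq
    ... | true  = contradiction (<ᵇ-true eq) (≤⇒≯ x≤)
    ... | false = hit⇒attempt x e

    follow≡ : ∀ σ x {b c} → (last σ <ᵇ x) ≡ b → hit x ≡ c →
              follow σ x ≡ (if b then σ else (if c then record σ { least = min₀ (least σ) x } else σ))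
    follow≡ σ x refl refl = refl

    follow-spec : ∀ σ x → Revisited σ x
    follow-spec σ x with last σ <ᵇ x in eq
    ... | true = record
      { y = least σ ; result = follow≡ σ x eq refl ; source = λ _ → inj₁ refl ; ≤-old = λ 0<l → 0<l , ≤-refl
      ; ≤-hit = λ _ x≤ → contradiction (<ᵇ-true eq) (≤⇒≯ x≤) }
    ... | false with hit x in ok
    ...   | false = record
      { y = least σ ; result = follow≡ σ x eq ok ; source = λ _ → inj₁ refl ; ≤-old = λ 0<l → 0<l , ≤-refl
      ; ≤-hit = λ e → contradiction (trans (sym ok) e) (λ ()) }
    ...   | true  = record
      { y = min₀ (least σ) x ; result = follow≡ σ x eq ok ; source = λ _ → origin (min₀-sel (least σ) x)
      ; ≤-old = λ 0<l → min₀-> (least σ) 0<x , min₀-≤ˡ x 0<l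
      ; ≤-hit = λ _ _ 0<x → min₀-> (least σ) 0<x , min₀-≤ʳ (least σ) x }
      where
      0<x : 0 < x
      0<x = <-≤-trans h>0 (≤-trans (limit-≥ h) (Hit.inside (hit-sound ok)))
      origin : min₀ (least σ) x ≡ x ⊎ (0 < least σ × min₀ (least σ) x ≡ least σ) →
               min₀ (least σ) x ≡ least σ ⊎ (min₀ (least σ) x ≡ x × hit x ≡ true × x ≤ last σ)
      origin (inj₁ e)       = inj₂ (e , ok , <ᵇ-false eq)
      origin (inj₂ (_ , e)) = inj₁ e

    Hit-> : ∀ {x} → Hit h x → 0 < x
    Hit-> H = <-≤-trans h>0 (≤-trans (limit-≥ h) (Hit.inside H))

    module Revisit (σ : Slot) (I : Invariant β h h h σ) where

      private
        q = gap σ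
        xₘ = first σ
        z₀ = start σ
        z = candidate σ
        st = stride σ

      known : ∀ n → 0 < xₘ → xₘ + n * q ≤ last σ → Swept h (xₘ + n * q)
      known n 0<xₘ le with q in eq
      ... | zero  = subst (Swept h) (sym (trans (cong (xₘ +_) (*-zeroʳ n)) (+-identityʳ xₘ)))
          (proj₁ (first-swept I 0<xₘ))
      ... | suc _ = subst (λ p → Swept h (xₘ + n * p)) eq
                      (steps* I (subst (0 <_) (sym eq) z<s) n (proj₁ (first-swept I 0<xₘ))
                        (subst (λ p → xₘ + n * p ≤ last σ) (sym eq) le))

      i₀ = ⟦ quo ⟧ ((limit h ∸ xₘ) + (q ∸ 1)) q
      i₁ = first-solution g q (residue σ) (inverse σ) (⟦ rem ⟧ (z₀ ∸ h) g)
      G  = ⟦ quo ⟧ g (residue σ)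

      z≡ : z ≡ xₘ + (i₀ + i₁) * q
      z≡ = shape xₘ i₀ i₁ q
        where
        shape : ∀ x i j q → x + i * q + j * q ≡ x + (i + j) * q
        shape = solve-∀

      z+st≡ : z + st ≡ xₘ + (i₀ + i₁ + G) * q
      z+st≡ = shape xₘ i₀ i₁ q G
        where
        shape : ∀ x i j q G → x + i * q + j * q + q * G ≡ x + (i + j + G) * q
        shape = solve-∀

      z+st+st≡ : z + st + st ≡ xₘ + (i₀ + i₁ + G + G) * q
      z+st+st≡ = shape xₘ i₀ i₁ q G
        where
        shape : ∀ x i j q G → x + i * q + j * q + q * G + q * G ≡ x + (i + j + G + G) * q
        shape = solve-∀

      record Found (x : ℕ) : Set where
        field
          x″     : ℕ
          x″≤x   : x″ ≤ x
          hit″   : Hit h x″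
          x″≤    : x″ ≤ last σ
          among  : x″ ≡ z ⊎ x″ ≡ z + st ⊎ x″ ≡ z + st + st

      module _ {x : ℕ} (S : Swept h x) (H : Hit h x) where
        open Swept S using (s; x≡; s<c) renaming (from to s-from; until to s-until)
        open Hit H

        -- Since `g` divides `t₀`, the times `s` and `h` are both congruent to `x`, and `s` is the
        -- earlier one.
        sg≤h : s + g ≤ h
        sg≤h = ≈-close (≈-trans (≈-trans (≈-sym (≈-+ s (∣⇒≈ g∣t₀))) (≈-reflexive (sym x≡))) class) s<c

        -- Hence `x` was swept before the current stretch began, and the minimum `first` of the
        -- previous stretch accounts for it.
        early : Swept β x
        early = record { Swept S ; s<c = (lin (s ∷ g ∷ h ∷ β ∷ []) 1
            ((1 , # 0 ⊕ # 1 , # 2) ∷ (1 , con 1 ⊕ # 2 , # 3 ⊕ # 1) ∷ []) (con 1 ⊕ # 0) (# 3) sg≤h h<β+g) }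

        first-≤ : 0 < xₘ × xₘ ≤ x
        first-≤ = first-least I early (≤-trans (limit-mono β≤h) inside) (Pal-≤ β≤h pal)

        0<xₘ = proj₁ first-≤
        xₘ≤x = proj₂ first-≤
        Sₘ = proj₁ (first-swept I 0<xₘ)

        -- If `x` is the least palindrome, the start is itself due, so the first solution is 0 and
        -- the candidate is `x`, whatever the state of the search.
        only-first : x ≡ xₘ → z₀ ≡ xₘ → Found x
        only-first refl z₀≡ = record
          { x″ = x ; x″≤x = ≤-refl ; hit″ = H ; x″≤ = last-greatest I S ; among = inj₁ (sym z≡x) }
          where
          d≡0 : ⟦ rem ⟧ (z₀ ∸ h) g ≡ 0
          d≡0 = trans (cong (λ n → ⟦ rem ⟧ (n ∸ h) g) z₀≡) (trans (rem-NonZero (x ∸ h) g)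
                  (trans (≈⇒%≡ (≈-cancel (x ∸ h) 0 h (≈-trans
                      (≈-reflexive (m∸n+n≡m (≤-trans (limit-≥ h) inside))) class)))
                    (m*n%n≡0 0 g)))
          z≡x : z ≡ x
          z≡x = trans (cong₂ (λ a d → a + first-solution g q (residue σ) (inverse σ) d * q) z₀≡ d≡0)
                  (trans (cong (λ i → x + i * q) (first-solution-0 g q (residue σ) (inverse σ))) (+-identityʳ x))

        found : Found x
        found = by-gap (q ≟ 0)
          where
          by-gap : _ → Found x
          by-gap (yes q≡0) = only-first (trans (one I q≡0 S) (sym (one I q≡0 Sₘ)))
            (trans (cong (λ p → xₘ + ⟦ quo ⟧ ((limit h ∸ xₘ) + (p ∸ 1)) p * p) q≡0) (+-identityʳ xₘ))
          by-gap (no q≢0) = progression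
            where
            0<q : 0 < q
            0<q = n≢0⇒n>0 q≢0
            instance
              q-NonZero : NonZero q
              q-NonZero = ≢-nonZero q≢0
            j₀ = proj₁ (gaps I 0<q Sₘ S xₘ≤x)
            x≡j₀ : x ≡ xₘ + j₀ * q
            x≡j₀ = proj₂ (gaps I 0<q Sₘ S xₘ≤x)
            a = limit h ∸ xₘ
            i₀≡ : i₀ ≡ (a + (q ∸ 1)) / q
            i₀≡ = quo-NonZero (a + (q ∸ 1)) q
            q-1 : suc (q ∸ 1) ≡ q
            q-1 = suc-pred q
            a≤ : a ≤ j₀ * q
            a≤ = m≤n+o⇒m∸n≤o (limit h) xₘ (subst (limit h ≤_) x≡j₀ inside)
            i₀≤j₀ : i₀ ≤ j₀
            i₀≤j₀ = ≤-pred (subst (_< suc j₀) (sym i₀≡) (m<n*o⇒m/o<n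
                (lin (a ∷ (j₀ * q) ∷ (q ∸ 1) ∷ q ∷ []) 1 ((1 , # 0 , # 1) ∷ (1 , con 1 ⊕ # 2 , # 3) ∷ [])
                (con 1 ⊕ (# 0 ⊕ # 2)) (# 3 ⊕ # 1) a≤ (≤-reflexive q-1))))
            a≤i₀q : a ≤ i₀ * q
            a≤i₀q = (lin (a ∷ (q ∸ 1) ∷ ((a + (q ∸ 1)) % q) ∷ (i₀ * q) ∷ q ∷ []) 1
                ((1 , # 0 ⊕ # 1 , # 2 ⊕ # 3) ∷ (1 , con 1 ⊕ # 2 , # 4) ∷ (1 , # 4 , con 1 ⊕ # 1) ∷ [])
                (# 0) (# 3) (≤-reflexive dm) (m%n<n (a + (q ∸ 1)) q) (≤-reflexive (sym q-1)))
              where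
              dm = trans (m≡m%n+[m/n]*n (a + (q ∸ 1)) q) (cong (λ n → (a + (q ∸ 1)) % q + n * q) (sym i₀≡))
            z₀≥ : limit h ≤ z₀
            z₀≥ = ≤-trans (m≤n+m∸n (limit h) xₘ) (+-monoʳ-≤ xₘ a≤i₀q)
            j = j₀ ∸ i₀
            x≡z₀ : x ≡ z₀ + j * q
            x≡z₀ = trans x≡j₀ (trans (cong (λ n → xₘ + n * q) (sym (m+[n∸m]≡n i₀≤j₀))) (shape xₘ i₀ j q))
              where
              shape : ∀ x i j q → x + (i + j) * q ≡ x + i * q + j * q
              shape = solve-∀
            SR = proj₁ (searching I 0<q)
            h≤z₀ : h ≤ z₀
            h≤z₀ = ≤-trans (limit-≥ h) z₀≥

            by-multiple : (k : ℕ) → x ≡ z + k * st → (∃[ l ] 0 < l × st ≡ l * g) → Found x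
            by-multiple 0 e _ = record { x″ = x ; x″≤x = ≤-refl ; hit″ = H ; x″≤ = last-greatest I S
              ; among = inj₁ (trans e (+-identityʳ z)) }
            by-multiple 1 e _ = record { x″ = x ; x″≤x = ≤-refl ; hit″ = H ; x″≤ = last-greatest I S
              ; among = inj₂ (inj₁ (lin≡ (x ∷ z ∷ st ∷ []) ((1 , # 0 , # 1 ⊕ (1 ⊛ (# 2))) ∷ []) (# 0) (# 1 ⊕ # 2) e)) }
            by-multiple 2 e _ = record { x″ = x ; x″≤x = ≤-refl ; hit″ = H ; x″≤ = last-greatest I S
              ; among = inj₂ (inj₂ (lin≡ (x ∷ z ∷ st ∷ []) ((1 , # 0 , # 1 ⊕ (2 ⊛ (# 2))) ∷ []) (# 0)
                  ((# 1 ⊕ # 2) ⊕ # 2) e)) }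
            -- Now `x` is beyond the three candidates. The third one, `f`, lies between `xₘ` and `x`
            -- and survives together with `x`; it is swept because `known` covers all members of the
            -- progression up to `last`.
            by-multiple (suc (suc (suc k))) e (l , 0<l , st≡) = record
              { x″ = f ; x″≤x = f≤x ; x″≤ = f≤last ; among = inj₂ (inj₂ refl)
              ; hit″ = record
                { inside = ≤-trans z₀≥ (lin (z₀ ∷ (i₁ * q) ∷ st ∷ []) 1 [] (# 0) (((# 0 ⊕ # 1) ⊕ # 2) ⊕ # 2))
                ; class  = ≈-trans (≈-sym (≈-trans (≈-reflexive (trans x≡f (cong (λ n → f + r * n) st≡)))
                             (≈-trans (≈-reflexive (cong (f +_) (sym (*-assoc r l g)))) (≈-multiple f (r * l))))) class
                ; even   = Swept.even Sf
                ; x≤2h   = ≤-trans f≤x x≤2h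
                ; pal    = subst (λ y → Pal y h) (sym f≡)
                             -- All swept palindromes reach `t₀ + 6 * Λ`, and their ends differ by
                             -- less than `2 * Λ`. So `p + ρ < 2 * Λ`, and the overlap `p + ρ + ρ`
                             -- fits between `t₀` and `t₀ + 6 * Λ`.
                             (middle-survives {w = t₀ + 6 * Λ} Pₘ
                               (subst₂ Pal f≡ (sym sf≡) (Swept.pal Sf))
                               (subst₂ Pal x≡′ s≡ (Swept.pal S))
                               fromₘ (lin (x ∷ t₀ ∷ s ∷ Λ ∷ xₘ ∷ sₘ ∷ p ∷ ρ ∷ []) 1
                                   ((3 , # 0 , # 1 ⊕ # 2) ∷ (3 , con 1 ⊕ # 2 , # 1 ⊕ (8 ⊛ (# 3))) ∷
                                   (3 , # 1 ⊕ # 5 , # 4) ∷ (3 , # 1 ⊕ (6 ⊛ (# 3)) , # 5) ∷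
                                   (3 , (# 4 ⊕ # 6) ⊕ # 7 , # 0) ∷ []) ((# 1 ⊕ (# 6 ⊕ # 7)) ⊕ # 7)
                                   (# 1 ⊕ (6 ⊛ (# 3))) (≤-reflexive x≡) s-until
                                   (≤-reflexive (sym (Swept.x≡ Sₘ))) fromₘ (≤-reflexive (sym x≡p)))
                               (m≤n⊔m (β ∸ g) sₘ) (⊔-lub (≤-trans (m∸n≤m β g) β≤h) (<⇒≤ (Swept.s<c Sₘ)))
                               (⊔-lub (subst (β ∸ g ≤_) (Swept.x≡ Sₘ) (proj₂ (proj₂ (first-swept I 0<xₘ))))
                                   (m≤n+m sₘ t₀))
                               (by-max (≤-total (β ∸ g) sₘ))
                               (subst (λ y → Pal y h) x≡′ pal)
                               far) } }
              where
              f = z + st + st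
              r = suc k
              x≡f : x ≡ f + r * st
              x≡f = (lin≡ (x ∷ z ∷ st ∷ (k * st) ∷ []) ((1 , # 0 , # 1 ⊕ (# 2 ⊕ (# 2 ⊕ (# 2 ⊕ # 3)))) ∷ [])
                  (# 0) (((# 1 ⊕ # 2) ⊕ # 2) ⊕ (# 2 ⊕ # 3)) e)
              f≤x : f ≤ x
              f≤x = subst (f ≤_) (sym x≡f) (m≤m+n f (r * st))
              f≤last = ≤-trans f≤x (last-greatest I S)
              Sf : Swept h f
              Sf = subst (Swept h) (sym z+st+st≡)
                     (known (i₀ + i₁ + G + G) 0<xₘ (subst (_≤ last σ) z+st+st≡ f≤last))
              sₘ = Swept.s Sₘ
              fromₘ = Swept.from Sₘ
              p = (i₀ + i₁ + G + G) * q
              ρ = r * st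
              f≡xp : f ≡ xₘ + p
              f≡xp = z+st+st≡
              x≡p : x ≡ xₘ + p + ρ
              x≡p = trans x≡f (cong (_+ ρ) f≡xp)
              f≡ : f ≡ t₀ + (sₘ + p)
              f≡ = (lin≡ (f ∷ xₘ ∷ p ∷ t₀ ∷ sₘ ∷ []) ((1 , # 0 , # 1 ⊕ # 2) ∷ (1 , # 1 , # 3 ⊕ # 4) ∷ [])
                  (# 0) (# 3 ⊕ (# 4 ⊕ # 2)) f≡xp (Swept.x≡ Sₘ))
              sf≡ : sₘ + p ≡ Swept.s Sf
              sf≡ = (lin≡ (f ∷ t₀ ∷ sₘ ∷ p ∷ (Swept.s Sf) ∷ [])
                  ((1 , # 1 ⊕ (# 2 ⊕ # 3) , # 0) ∷ (1 , # 0 , # 1 ⊕ # 4) ∷ []) (# 2 ⊕ # 3) (# 4) (sym f≡)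
                  (Swept.x≡ Sf))
              x≡′ : x ≡ t₀ + (sₘ + p + ρ)
              x≡′ = (lin≡ (x ∷ xₘ ∷ p ∷ ρ ∷ t₀ ∷ sₘ ∷ []) ((1 , # 0 , (# 1 ⊕ # 2) ⊕ # 3) ∷
                  (1 , # 1 , # 4 ⊕ # 5) ∷ []) (# 0) (# 4 ⊕ ((# 5 ⊕ # 2) ⊕ # 3)) x≡p (Swept.x≡ Sₘ))
              s≡ : s ≡ sₘ + p + ρ
              s≡ = (lin≡ (x ∷ t₀ ∷ sₘ ∷ p ∷ ρ ∷ s ∷ []) ((1 , # 0 , # 1 ⊕ ((# 2 ⊕ # 3) ⊕ # 4)) ∷
                  (1 , # 1 ⊕ # 5 , # 0) ∷ []) (# 5) ((# 2 ⊕ # 3) ⊕ # 4) x≡′ (sym x≡))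
              Pₘ : Pal (t₀ + sₘ) sₘ
              Pₘ = subst (λ y → Pal y sₘ) (Swept.x≡ Sₘ) (Swept.pal Sₘ)
              by-max : β ∸ g ≤ sₘ ⊎ sₘ ≤ β ∸ g → Pal (t₀ + sₘ) (β ∸ g ⊔ sₘ)
              by-max (inj₁ le) = subst (Pal (t₀ + sₘ)) (sym (m≤n⇒m⊔n≡n le)) Pₘ
              by-max (inj₂ ge) = subst₂ Pal (Swept.x≡ Sₘ) (sym (m≥n⇒m⊔n≡m ge)) (proj₁ (proj₂ (first-swept I 0<xₘ)))
              g≤st : g ≤ st
              g≤st = subst (g ≤_) (sym st≡) (≤-trans (≤-reflexive (sym (*-identityˡ g))) (*-monoˡ-≤ g 0<l))
              -- The last known survival of `xₘ` dates from `β - g` or from its own sweep. As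
              -- `h < β + g`, the delay is less than `2 * g`, and `p` contains two strides of at
              -- least `g` each.
              far : h ≤ p + (β ∸ g ⊔ sₘ)
              far = (lin (h ∷ β ∷ g ∷ (β ∸ g) ∷ (β ∸ g ⊔ sₘ) ∷ st ∷ z₀ ∷ (i₁ * q) ∷ xₘ ∷ p ∷ []) 1
                  ((1 , con 1 ⊕ # 0 , # 1 ⊕ # 2) ∷ (1 , # 1 , # 2 ⊕ # 3) ∷ (1 , # 3 , # 4) ∷
                  (2 , # 2 , # 5) ∷ (1 , ((# 6 ⊕ # 7) ⊕ # 5) ⊕ # 5 , # 8 ⊕ # 9) ∷ (1 , # 8 , # 6) ∷ [])
                  (# 0) (# 9 ⊕ # 4) h<β+g (m≤n+m∸n β g) (m≤m⊔n (β ∸ g) sₘ) g≤st (≤-reflexive f≡xp)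
                  (m≤m+n xₘ (i₀ * q)))

            progression : Found x
            progression with count σ <? g
            -- While the search is unfinished, `s + g ≤ h` makes `x` older than the search. By
            -- `recent` it is the first palindrome found, hence equal to `xₘ`.
            ... | yes c<g = only-first (≤-antisym x≤xₘ xₘ≤x) (≤-antisym (≤-trans z₀≤x x≤xₘ) (m≤m+n xₘ (i₀ * q)))
              where
              x≤xₘ : x ≤ xₘ
              x≤xₘ = recent I 0<q c<g S (lin (x ∷ t₀ ∷ s ∷ g ∷ h ∷ (count σ) ∷ []) 1
                  ((1 , # 0 , # 1 ⊕ # 2) ∷ (1 , # 2 ⊕ # 3 , # 4) ∷ (1 , con 1 ⊕ # 5 , # 3) ∷ [])
                  (con 1 ⊕ (# 0 ⊕ # 5)) (# 1 ⊕ # 4) (≤-reflexive x≡) sg≤h c<g) Sₘ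
              z₀≤x : z₀ ≤ x
              z₀≤x = subst (z₀ ≤_) (sym x≡z₀) (m≤m+n z₀ (j * q))
            ... | no c≮g = by-multiple multiple x≡z step
              where
              SR′ : Search g q g (residue σ) (inverse σ)
              SR′ = subst (λ c → Search g q c (residue σ) (inverse σ))
                  (≤-antisym (proj₂ (searching I 0<q)) (≮⇒≥ c≮g)) SR
              d = (z₀ ∸ h) % g
              jqd : Congruent g (j * q + d) 0
              jqd = ≈-trans (≈-trans (≈-reflexive (+-comm (j * q) d))
                  (≈-trans (≈-+ (j * q) (≈-% (z₀ ∸ h))) (≈-reflexive (+-comm (z₀ ∸ h) (j * q)))))
                (≈-cancel (j * q + (z₀ ∸ h)) 0 h (≈-trans (≈-reflexive (trans (+-assoc (j * q) (z₀ ∸ h) h)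
                   (trans (cong (j * q +_) (m∸n+n≡m h≤z₀)) (trans (+-comm (j * q) z₀) (sym x≡z₀))))) class))
              open Solutions (solutions g>0 0<q SR′ j d (m%n<n (z₀ ∸ h) g) jqd)
              x≡z : x ≡ z + multiple * st
              x≡z = trans x≡z₀ (trans (cong (λ n → z₀ + n * q)
                  (trans j≡ (cong (λ n → first-solution g q (residue σ) (inverse σ) n + multiple * G)
                  (sym (rem-NonZero (z₀ ∸ h) g)))))
                      (shape z₀ i₁ multiple G q))
                where
                shape : ∀ z i m G q → z + (i + m * G) * q ≡ z + i * q + m * (q * G)
                shape = solve-∀

      record Outcome : Set where
        field
          y      : ℕ
          result : revisit σ ≡ record σ { least = y }
          source : 0 < y → Swept h y × Pal y β × β ≤ y
          ≤-old  : 0 < least σ → 0 < y × y ≤ least σ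
          covers : ∀ {x} → Swept h x → Hit h x → 0 < y × y ≤ x
          finds  : ∀ {x} → Swept h x → Hit h x → ∃[ x″ ] x″ ≤ x × Hit h x″ × x″ ∈ revisited σ

      revisit≡ : ∀ {b} → (first σ ≡ᵇ 0) ≡ b →
                 revisit σ ≡ (if b then σ else follow (follow (follow σ z) (z + st)) (z + st + st))
      revisit≡ refl = refl

      revisited≡ : ∀ {b} → (first σ ≡ᵇ 0) ≡ b →
                   revisited σ ≡ (if b then [] else followed σ z ++ followed σ (z + st) ++ followed σ (z + st + st))
      revisited≡ refl = refl

      outcome : Outcome
      outcome with first σ ≡ᵇ 0 in eq
      ... | true = record
        { y = least σ ; result = revisit≡ eq ; source = least-swept I ; ≤-old = λ 0<l → 0<l , ≤-refl
        ; covers = λ S H → ⊥-elim (none S H) ; finds = λ S H → ⊥-elim (none S H) }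
        where
        none : ∀ {x} → Swept h x → ¬ Hit h x
        none S H = <⇒≢ (0<xₘ S H) (sym (≡ᵇ-true eq))
      ... | false = record
        { y = R₃.y
        ; result = trans (revisit≡ eq) (trans (cong (λ τ → follow (follow τ (z + st)) (z + st + st)) R₁.result)
                     (trans (cong (λ τ → follow τ (z + st + st)) R₂.result) R₃.result))
        ; source = source₃
        ; ≤-old = λ 0<l → chain₃ (chain₂ (R₁.≤-old 0<l))
        ; covers = λ S H → let open Found (found S H) in ≤-trans′ x″≤x (covered hit″ x″≤ among)
        ; finds = λ S H → let open Found (found S H) in x″ , x″≤x , hit″ ,
                    subst (x″ ∈_) (sym (revisited≡ eq)) (member (hit-complete hit″) x″≤ among) }
        where
        module R₁ = Revisited (follow-spec σ z)
        σ₁ : Slot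
        σ₁ = record σ { least = R₁.y }
        module R₂ = Revisited (follow-spec σ₁ (z + st))
        σ₂ : Slot
        σ₂ = record σ { least = R₂.y }
        module R₃ = Revisited (follow-spec σ₂ (z + st + st))
        0<first : 0 < xₘ
        0<first = n≢0⇒n>0 (≡ᵇ-false eq)
        Fine : ℕ → Set
        Fine y = Swept h y × Pal y β × β ≤ y
        fine : ∀ n x → x ≡ xₘ + n * q → hit x ≡ true → x ≤ last σ → Fine x
        fine n x x≡ ok x≤ = subst (Swept h) (sym x≡) (known n 0<first (subst (_≤ last σ) x≡ x≤))
          , Pal-≤ β≤h (Hit.pal (hit-sound ok)) , ≤-trans β≤h (≤-trans (limit-≥ h) (Hit.inside (hit-sound ok)))
        carry : ∀ {y y′ x} n → x ≡ xₘ + n * q → (0 < y′ → Fine y′) →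
                (0 < y → y ≡ y′ ⊎ (y ≡ x × hit x ≡ true × x ≤ last σ)) → 0 < y → Fine y
        carry n x≡ old src 0<y with src 0<y
        ... | inj₁ refl = old 0<y
        ... | inj₂ (refl , ok , x≤) = fine n _ x≡ ok x≤
        source₃ : 0 < R₃.y → Fine R₃.y
        source₃ = carry (i₀ + i₁ + G + G) z+st+st≡
                    (carry (i₀ + i₁ + G) z+st≡ (carry (i₀ + i₁) z≡ (least-swept I) R₁.source) R₂.source) R₃.source
        ≤-trans′ : ∀ {y a b} → a ≤ b → 0 < y × y ≤ a → 0 < y × y ≤ b
        ≤-trans′ a≤b (p , y≤a) = p , ≤-trans y≤a a≤b
        chain₂ : ∀ {x} → 0 < R₁.y × R₁.y ≤ x → 0 < R₂.y × R₂.y ≤ x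
        chain₂ (p , le) = ≤-trans′ le (R₂.≤-old p)
        chain₃ : ∀ {x} → 0 < R₂.y × R₂.y ≤ x → 0 < R₃.y × R₃.y ≤ x
        chain₃ (p , le) = ≤-trans′ le (R₃.≤-old p)
        covered : ∀ {x} → Hit h x → x ≤ last σ → x ≡ z ⊎ x ≡ z + st ⊎ x ≡ z + st + st → 0 < R₃.y × R₃.y ≤ x
        covered H x≤ (inj₁ refl)        = chain₃ (chain₂ (R₁.≤-hit (hit-complete H) x≤ (Hit-> H)))
        covered H x≤ (inj₂ (inj₁ refl)) = chain₃ (R₂.≤-hit (hit-complete H) x≤ (Hit-> H))
        covered H x≤ (inj₂ (inj₂ refl)) = R₃.≤-hit (hit-complete H) x≤ (Hit-> H)
        member : ∀ {x} → hit x ≡ true → x ≤ last σ → x ≡ z ⊎ x ≡ z + st ⊎ x ≡ z + st + st →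
                 x ∈ followed σ z ++ followed σ (z + st) ++ followed σ (z + st + st)
        member ok x≤ (inj₁ refl)        = ∈-++⁺ˡ (hit⇒followed σ z ok x≤)
        member ok x≤ (inj₂ (inj₁ refl)) = ∈-++⁺ʳ (followed σ z) (∈-++⁺ˡ (hit⇒followed σ (z + st) ok x≤))
        member ok x≤ (inj₂ (inj₂ refl)) =
          ∈-++⁺ʳ (followed σ z) (∈-++⁺ʳ (followed σ (z + st)) (hit⇒followed σ (z + st + st) ok x≤))

      open Outcome outcome public using (finds)

      invariant-revisit : Invariant β (suc h) h h (revisit σ)
      invariant-revisit = subst (Invariant β (suc h) h h) (sym result) (record
        { last-swept = last-swept I ; last-greatest = last-greatest I ; one = one I ; gaps = gaps I
        ; steps = steps I ; previous = previous I ; least-swept = source ; least-least = least-least′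
        ; first-swept = first-swept I ; first-least = first-least I ; searching = searching I ; recent = recent I })
        where
        open Outcome outcome
        least-least′ : ∀ {x} → Swept h x → ∀ τ → β ≤ τ → τ < suc h → Congruent g x τ → limit τ ≤ x → Pal x
            τ → 0 < y × y ≤ x
        least-least′ {x} S τ β≤τ τ<sh x≈τ lim P with m≤n⇒m<n∨m≡n (≤-pred τ<sh)
        ... | inj₁ τ<h = let p , le = least-least I S τ β≤τ τ<h x≈τ lim P
                             p′ , le′ = ≤-old p in p′ , ≤-trans le′ le
        ... | inj₂ refl = covers S (record { inside = lim ; class = x≈τ ; even = Swept.even S ; x≤2h = x≤2h ; pal = P })
          where
          open Swept S using (s; x≡; s<c)
          x≤2h : x ≤ h + h
          x≤2h = (lin (x ∷ t₀ ∷ s ∷ h ∷ Λ ∷ []) 1 ((1 , # 0 , # 1 ⊕ # 2) ∷ (2 , con 1 ⊕ # 2 , # 3) ∷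
              (1 , # 1 ⊕ (6 ⊛ (# 4)) , # 2) ∷ []) (# 0) (# 3 ⊕ # 3) (≤-reflexive x≡) s<c (Swept.from S))

    module Sweep (σ : Slot) (I : Invariant β (suc h) h h σ) (from : t₀ + 6 * Λ ≤ h)
                 (sweepable : h < t₀ + 8 * Λ → limit h ≤ t₀ + h) where

      private
        X = t₀ + h
        q = gap σ
        l = last σ

      t₀≤h : t₀ ≤ h
      t₀≤h = ≤-trans (m≤m+n t₀ _) from

      in-time : h < t₀ + 8 * Λ → (h ∸ t₀ <ᵇ 8 * Λ) ≡ true
      in-time h< with h ∸ t₀ <ᵇ 8 * Λ in eq
      ... | true  = refl
      ... | false = contradiction (<ᵇ-false eq) (<⇒≱ (lin (h ∷ t₀ ∷ Λ ∷ (h ∸ t₀) ∷ []) 1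
          ((1 , con 1 ⊕ # 0 , # 1 ⊕ (8 ⊛ (# 2))) ∷ (1 , # 3 ⊕ # 1 , # 0) ∷ []) (con 1 ⊕ # 3) (8 ⊛ (# 2)) h<
          (≤-reflexive (m∸n+n≡m t₀≤h))))

      split : ∀ {x} → Swept (suc h) x → Swept h x ⊎ (x ≡ X × h < t₀ + 8 * Λ × Hit h X)
      split (swept-at s x≡ fr un s<c ev pal) with m≤n⇒m<n∨m≡n (≤-pred s<c)
      ... | inj₁ s<h = inj₁ (swept-at s x≡ fr un s<h ev pal)
      ... | inj₂ refl = inj₂ (x≡ , un , record
        { inside = sweepable un ; class = ≈-+ h (∣⇒≈ g∣t₀) ; even = subst (2 ∣_) x≡ ev
        ; x≤2h = +-monoˡ-≤ h t₀≤h ; pal = subst (λ x → Pal x h) x≡ pal })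

      newly : ∀ {x} → Swept (suc h) x → Swept h x ⊎ x ∈ swept
      newly S with split S
      ... | inj₁ old = inj₁ old
      ... | inj₂ (refl , h< , H) = inj₂ (subst (X ∈_) (swept≡ (in-time h<)) (hit⇒attempt X (hit-complete H)))
        where
        swept≡ : ∀ {b} → (h ∸ t₀ <ᵇ 8 * Λ) ≡ b → (if b then attempt X else []) ≡ swept
        swept≡ refl = refl

      old-≤ : ∀ {x} → Swept h x → Swept (suc h) x
      old-≤ = Swept-mono (n≤1+n h)

      unchanged : (∀ {x} → Swept (suc h) x → Swept h x) → Invariant β (suc h) (suc h) h σ
      unchanged old = record
        { last-swept = λ p → old-≤ (last-swept I p) ; last-greatest = λ S → last-greatest I (old S)
        ; one = λ e S → one I e (old S) ; gaps = λ p S S′ → gaps I p (old S) (old S′)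
        ; steps = λ p S le → old-≤ (steps I p (old S) le)
        ; previous = λ p → let x , S , e = previous I p in x , old-≤ S , e
        ; least-swept = λ p → let S , r = least-swept I p in old-≤ S , r
        ; least-least = λ S → least-least I (old S)
        ; first-swept = λ p → let S , r = first-swept I p in old-≤ S , r
        ; first-least = first-least I
        ; searching = searching I ; recent = λ p c S lt S′ → recent I p c (old S) lt (old S′) }

      module Append (H : Hit h X) (until : h < t₀ + 8 * Λ) where

        SX : Swept (suc h) X
        SX = swept-at h refl from until ≤-refl (Hit.even H) (Hit.pal H)

        old-< : ∀ {x} → Swept h x → x < X
        old-< {x} S = (lin (x ∷ t₀ ∷ (Swept.s S) ∷ h ∷ []) 1
            ((1 , # 0 , # 1 ⊕ # 2) ∷ (1 , con 1 ⊕ # 2 , # 3) ∷ []) (con 1 ⊕ # 0) (# 1 ⊕ # 3)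
            (≤-reflexive (Swept.x≡ S)) (Swept.s<c S))

        either : ∀ {x} → Swept (suc h) x → Swept h x ⊎ x ≡ X
        either S with split S
        ... | inj₁ old = inj₁ old
        ... | inj₂ (e , _) = inj₂ e

        ≤X : ∀ {x} → Swept (suc h) x → x ≤ X
        ≤X S with either S
        ... | inj₁ old  = <⇒≤ (old-< old)
        ... | inj₂ refl = ≤-refl

        y = min₀ (least σ) X

        y-swept : 0 < y → Swept (suc h) y × Pal y β × β ≤ y
        y-swept _ with min₀-sel (least σ) X
        ... | inj₁ e = subst (λ y → Swept (suc h) y × Pal y β × β ≤ y) (sym e)
            (SX , Pal-≤ β≤h (Hit.pal H) , ≤-trans β≤h (m≤n+m h t₀))
        ... | inj₂ (p , e) = subst (λ y → Swept (suc h) y × Pal y β × β ≤ y) (sym e)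
            (let S , r = least-swept I p in old-≤ S , r)

        y-least : ∀ {x} → Swept (suc h) x → ∀ τ → β ≤ τ → τ < suc h → Congruent g x τ → limit τ ≤ x → Pal x
            τ → 0 < y × y ≤ x
        y-least S τ a b c d e with either S
        ... | inj₁ old  = let p , le = least-least I old τ a b c d e in min₀-> (least σ) (Swept-> SX) , ≤-trans (min₀-≤ˡ X p) le
        ... | inj₂ refl = min₀-> (least σ) (Swept-> SX) , min₀-≤ʳ (least σ) X

        first-swept′ : 0 < first σ → Swept (suc h) (first σ) × Pal (first σ) (β ∸ g) × β ∸ g ≤ first σ
        first-swept′ p = let S , r = first-swept I p in old-≤ S , r

        append-first : l ≡ 0 → Invariant β (suc h) (suc h) h (record σ { least = y ; last = X })
        append-first l≡0 = record
          { last-swept = λ _ → SX ; last-greatest = ≤X ; one = λ _ → only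
          ; gaps = λ p → ⊥-elim (no-gap p) ; steps = λ p → ⊥-elim (no-gap p) ; previous = λ p → ⊥-elim (no-gap p)
          ; least-swept = y-swept ; least-least = y-least ; first-swept = first-swept′ ; first-least = first-least I
          ; searching = λ p → ⊥-elim (no-gap p) ; recent = λ p → ⊥-elim (no-gap p) }
          where
          none : ∀ {x} → ¬ Swept h x
          none S = contradiction (subst (_ ≤_) l≡0 (last-greatest I S)) (<⇒≱ (Swept-> S))
          no-gap : ¬ 0 < q
          no-gap p = none (proj₁ (proj₂ (previous I p)))
          only : ∀ {x} → Swept (suc h) x → x ≡ X
          only S with either S
          ... | inj₁ old = ⊥-elim (none old)
          ... | inj₂ e   = e

        append-second : 0 < l → q ≡ 0 → Invariant β (suc h) (suc h) h (slot (first σ) y (X ∸ l) X 0 g 0)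
        append-second 0<l q≡0 = record
          { last-swept = λ _ → SX ; last-greatest = ≤X ; one = λ e → contradiction e (>⇒≢ 0<r)
          ; gaps = λ _ → gaps′ ; steps = λ _ → steps′ ; previous = λ _ → l , old-≤ Sl , l+r
          ; least-swept = y-swept ; least-least = y-least ; first-swept = first-swept′ ; first-least = first-least I
          ; searching = λ _ → search-start (X ∸ l) g>0 , z≤n ; recent = λ _ _ → recent′ }
          where
          Sl : Swept h l
          Sl = last-swept I 0<l
          l<X = old-< Sl
          0<r : 0 < X ∸ l
          0<r = m<n⇒0<n∸m l<X
          l+r : l + (X ∸ l) ≡ X
          l+r = m+[n∸m]≡n (<⇒≤ l<X)
          which : ∀ {x} → Swept (suc h) x → x ≡ l ⊎ x ≡ X
          which S with either S
          ... | inj₁ old = inj₁ (one I q≡0 old)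
          ... | inj₂ e   = inj₂ e
          gaps′ : ∀ {x x′} → Swept (suc h) x → Swept (suc h) x′ → x ≤ x′ → ∃[ j ] x′ ≡ x + j * (X ∸ l)
          gaps′ S S′ x≤x′ with which S | which S′
          ... | inj₁ refl | inj₁ refl = 0 , sym (+-identityʳ l)
          ... | inj₁ refl | inj₂ refl = 1 , trans (sym l+r) (cong (l +_) (sym (+-identityʳ (X ∸ l))))
          ... | inj₂ refl | inj₁ refl = contradiction x≤x′ (<⇒≱ l<X)
          ... | inj₂ refl | inj₂ refl = 0 , sym (+-identityʳ X)
          steps′ : ∀ {x} → Swept (suc h) x → x + (X ∸ l) ≤ X → Swept (suc h) (x + (X ∸ l))
          steps′ S le with which S
          ... | inj₁ refl = subst (Swept (suc h)) (sym l+r) SX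
          ... | inj₂ refl = contradiction le (<⇒≱ (m<m+n X 0<r))
          recent′ : ∀ {x} → Swept (suc h) x → x + 0 < X → ∀ {x′} → Swept (suc h) x′ → x ≤ x′
          recent′ {x} S lt S′ with which S | which S′
          ... | inj₁ refl | inj₁ refl = ≤-refl
          ... | inj₁ refl | inj₂ refl = <⇒≤ l<X
          ... | inj₂ refl | _ = contradiction lt (≤⇒≯ (m≤m+n X 0))

        append-next : 0 < l → 0 < q → Invariant β (suc h) (suc h) h (record σ { least = y ; last = X })
        append-next 0<l 0<q = record
          { last-swept = λ _ → SX ; last-greatest = ≤X ; one = λ e → contradiction e (>⇒≢ 0<q)
          ; gaps = λ _ → gaps′ ; steps = λ _ → steps′ ; previous = λ _ → l , old-≤ Sl , l+q
          ; least-swept = y-swept ; least-least = y-least ; first-swept = first-swept′ ; first-least = first-least I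
          ; searching = searching I ; recent = recent′ }
          where
          Sl : Swept h l
          Sl = last-swept I 0<l
          l<X = old-< Sl
          x₀ = proj₁ (previous I 0<q)
          S₀ : Swept h x₀
          S₀ = proj₁ (proj₂ (previous I 0<q))
          x₀+q : x₀ + q ≡ l
          x₀+q = proj₂ (proj₂ (previous I 0<q))
          s₀ = Swept.s S₀
          r = X ∸ l
          l+r : l + r ≡ X
          l+r = m+[n∸m]≡n (<⇒≤ l<X)
          -- Parity matters: a palindrome copied by `r` or `q` contradicts the invariant only if it
          -- is even, since odd ones are not recorded.
          2∣r : 2 ∣ r
          2∣r = ∣m+n∣m⇒∣n (subst (2 ∣_) (sym l+r) (Hit.even H)) (Swept.even Sl)
          2∣q : 2 ∣ q
          2∣q = ∣m+n∣m⇒∣n (subst (2 ∣_) (sym x₀+q) (Swept.even Sl)) (Swept.even S₀)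
          sl≡ : Swept.s Sl ≡ s₀ + q
          sl≡ = (lin≡ (l ∷ t₀ ∷ (Swept.s Sl) ∷ x₀ ∷ s₀ ∷ q ∷ [])
              ((1 , # 1 ⊕ # 2 , # 0) ∷ (1 , # 3 , # 1 ⊕ # 4) ∷ (1 , # 0 , # 3 ⊕ # 5) ∷ []) (# 2)
              (# 4 ⊕ # 5) (sym (Swept.x≡ Sl)) (Swept.x≡ S₀) (sym x₀+q))
          h≡ : h ≡ s₀ + q + r
          h≡ = (lin≡ (x₀ ∷ t₀ ∷ s₀ ∷ q ∷ l ∷ r ∷ h ∷ []) ((1 , # 0 , # 1 ⊕ # 2) ∷ (1 , # 4 , # 0 ⊕ # 3) ∷
              (1 , # 1 ⊕ # 6 , # 4 ⊕ # 5) ∷ []) (# 6) ((# 2 ⊕ # 3) ⊕ # 5) (Swept.x≡ S₀) (sym x₀+q) (sym l+r))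
          from₀ = Swept.from S₀
          P₀ : Pal (t₀ + s₀) s₀
          P₀ = subst (λ x → Pal x s₀) (Swept.x≡ S₀) (Swept.pal S₀)
          Pl : Pal (t₀ + (s₀ + q)) (s₀ + q)
          Pl = subst₂ Pal (trans (Swept.x≡ Sl) (cong (t₀ +_) sl≡)) sl≡ (Swept.pal Sl)
          PX : Pal (t₀ + (s₀ + q + r)) (s₀ + q + r)
          PX = subst₂ Pal (cong (t₀ +_) h≡) h≡ (Hit.pal H)
          -- The copy from `shift-down` would end strictly between the last two palindromes, but
          -- `gaps` puts multiples of `q` between swept palindromes.
          not-smaller : ¬ r < q
          not-smaller r<q = between (gaps I 0<q S₀ Sx (lin (x₀ ∷ t₀ ∷ s₀ ∷ d ∷ []) 1
              ((1 , # 0 , # 1 ⊕ # 2) ∷ []) (# 0) (# 1 ⊕ (# 2 ⊕ # 3)) (≤-reflexive (Swept.x≡ S₀))))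
            where
            d = q ∸ r
            d+r : d + r ≡ q
            d+r = m∸n+n≡m (<⇒≤ r<q)
            0<d : 0 < d
            0<d = m<n⇒0<n∸m r<q
            0<r : 0 < r
            0<r = m<n⇒0<n∸m l<X
            Sx : Swept h (t₀ + (s₀ + d))
            Sx = swept-at (s₀ + d) refl (lin (t₀ ∷ Λ ∷ s₀ ∷ d ∷ []) 1 ((1 , # 0 ⊕ (6 ⊛ (# 1)) , # 2) ∷ [])
                (# 0 ⊕ (6 ⊛ (# 1))) (# 2 ⊕ # 3) from₀)
                   (lin (h ∷ s₀ ∷ q ∷ r ∷ d ∷ t₀ ∷ Λ ∷ []) 1
                       ((1 , (# 1 ⊕ # 2) ⊕ # 3 , # 0) ∷ (1 , # 4 ⊕ # 3 , # 2) ∷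
                       (1 , con 1 ⊕ # 0 , # 5 ⊕ (8 ⊛ (# 6))) ∷ []) (con 1 ⊕ (# 1 ⊕ # 4))
                       (# 5 ⊕ (8 ⊛ (# 6))) (≤-reflexive (sym h≡)) (≤-reflexive d+r) until)
                   (lin (h ∷ s₀ ∷ q ∷ r ∷ d ∷ []) 1 ((1 , (# 1 ⊕ # 2) ⊕ # 3 , # 0) ∷ (1 , # 4 ⊕ # 3 , # 2)
                       ∷ (2 , con 1 ⊕ con 0 , # 3) ∷ []) (con 1 ⊕ (# 1 ⊕ # 4)) (# 0) (≤-reflexive (sym h≡))
                       (≤-reflexive d+r) 0<r)
                   (∣m+n∣m⇒∣n (subst (2 ∣_) (lin≡ (x₀ ∷ t₀ ∷ s₀ ∷ q ∷ l ∷ d ∷ r ∷ [])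
                       ((1 , # 0 , # 1 ⊕ # 2) ∷ (1 , # 4 , # 0 ⊕ # 3) ∷ (1 , # 3 , # 5 ⊕ # 6) ∷ []) (# 4)
                       (# 6 ⊕ (# 1 ⊕ (# 2 ⊕ # 5))) (Swept.x≡ S₀) (sym x₀+q) (sym d+r)) (Swept.even Sl)) 2∣r)
                   (shift-down {t₀} {s₀ + d} {r} (subst (λ s → Pal (t₀ + s) s)
                       (lin≡ (d ∷ r ∷ q ∷ s₀ ∷ []) ((1 , # 2 , # 0 ⊕ # 1) ∷ []) (# 3 ⊕ # 2)
                       ((# 3 ⊕ # 0) ⊕ # 1) (sym d+r)) Pl)
                               (subst (λ s → Pal (t₀ + s) s)
                                   (lin≡ (d ∷ r ∷ q ∷ s₀ ∷ []) ((1 , # 2 , # 0 ⊕ # 1) ∷ [])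
                                   ((# 3 ⊕ # 2) ⊕ # 1) (((# 3 ⊕ # 0) ⊕ # 1) ⊕ # 1) (sym d+r)) PX))
            between : ∃[ j ] t₀ + (s₀ + d) ≡ x₀ + j * q → _
            between (zero , e) = (n≮0 (lin (t₀ ∷ s₀ ∷ d ∷ x₀ ∷ []) 0
                ((1 , # 0 ⊕ (# 1 ⊕ # 2) , # 3 ⊕ con 0) ∷ (1 , # 3 , # 0 ⊕ # 1) ∷ (1 , con 1 ⊕ con 0 , # 2)
                ∷ []) (con 1) (con 0) (≤-reflexive e) (≤-reflexive (Swept.x≡ S₀)) 0<d))
            between (suc j , e) = (n≮0 (lin (t₀ ∷ s₀ ∷ d ∷ x₀ ∷ q ∷ (j * q) ∷ r ∷ []) 0
                ((1 , # 3 ⊕ (# 4 ⊕ # 5) , # 0 ⊕ (# 1 ⊕ # 2)) ∷ (1 , # 0 ⊕ # 1 , # 3) ∷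
                (1 , con 1 ⊕ con 0 , # 6) ∷ (1 , # 2 ⊕ # 6 , # 4) ∷ []) (con 1) (con 0)
                (≤-reflexive (sym e)) (≤-reflexive (sym (Swept.x≡ S₀))) 0<r (≤-reflexive d+r)))
          -- The copy from `shift-up` would end after the last palindrome and `q` time units before
          -- `h`, so it would have been swept already and exceed `last`.
          not-larger : ¬ q < r
          not-larger q<r = <⇒≱ (lin (x₀ ∷ t₀ ∷ s₀ ∷ q ∷ l ∷ k ∷ []) 1
              ((1 , # 0 , # 1 ⊕ # 2) ∷ (1 , # 4 , # 0 ⊕ # 3) ∷ (1 , con 1 ⊕ con 0 , # 5) ∷ [])
              (con 1 ⊕ # 4) (# 1 ⊕ ((# 2 ⊕ # 3) ⊕ # 5)) (≤-reflexive (Swept.x≡ S₀))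
              (≤-reflexive (sym x₀+q)) 0<k) (last-greatest I Sx)
            where
            k = r ∸ q
            k+q : k + q ≡ r
            k+q = m∸n+n≡m (<⇒≤ q<r)
            0<k : 0 < k
            0<k = m<n⇒0<n∸m q<r
            Sx : Swept h (t₀ + (s₀ + q + k))
            Sx = swept-at (s₀ + q + k) refl (lin (t₀ ∷ Λ ∷ s₀ ∷ q ∷ k ∷ []) 1
                ((1 , # 0 ⊕ (6 ⊛ (# 1)) , # 2) ∷ []) (# 0 ⊕ (6 ⊛ (# 1))) ((# 2 ⊕ # 3) ⊕ # 4) from₀)
                   (lin (h ∷ s₀ ∷ q ∷ r ∷ k ∷ t₀ ∷ Λ ∷ []) 1
                       ((1 , (# 1 ⊕ # 2) ⊕ # 3 , # 0) ∷ (1 , # 4 ⊕ # 2 , # 3) ∷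
                       (1 , con 1 ⊕ # 0 , # 5 ⊕ (8 ⊛ (# 6))) ∷ []) (con 1 ⊕ ((# 1 ⊕ # 2) ⊕ # 4))
                       (# 5 ⊕ (8 ⊛ (# 6))) (≤-reflexive (sym h≡)) (≤-reflexive k+q) until)
                   (lin (h ∷ s₀ ∷ q ∷ r ∷ k ∷ []) 1 ((1 , (# 1 ⊕ # 2) ⊕ # 3 , # 0) ∷ (1 , # 4 ⊕ # 2 , # 3)
                       ∷ (1 , con 1 ⊕ con 0 , # 2) ∷ []) (con 1 ⊕ ((# 1 ⊕ # 2) ⊕ # 4)) (# 0)
                       (≤-reflexive (sym h≡)) (≤-reflexive k+q) 0<q)
                   (∣m+n∣m⇒∣n (subst (2 ∣_) (lin≡ (h ∷ s₀ ∷ q ∷ r ∷ k ∷ t₀ ∷ [])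
                       ((1 , # 0 , (# 1 ⊕ # 2) ⊕ # 3) ∷ (1 , # 3 , # 4 ⊕ # 2) ∷ []) (# 5 ⊕ # 0)
                       (# 2 ⊕ (# 5 ⊕ ((# 1 ⊕ # 2) ⊕ # 4))) h≡ (sym k+q)) (Hit.even H)) 2∣q)
                   (shift-up {t₀} {s₀} {q} {k} P₀ Pl (subst (λ s → Pal (t₀ + s) s) (cong (s₀ + q +_) (sym k+q)) PX)
                     (lin (h ∷ s₀ ∷ q ∷ r ∷ k ∷ t₀ ∷ Λ ∷ []) 1
                         ((1 , (# 1 ⊕ # 2) ⊕ # 3 , # 0) ∷ (1 , # 4 ⊕ # 2 , # 3) ∷
                         (1 , con 1 ⊕ # 0 , # 5 ⊕ (8 ⊛ (# 6))) ∷ (2 , # 5 ⊕ (6 ⊛ (# 6)) , # 1) ∷ [])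
                         ((# 5 ⊕ (# 4 ⊕ # 2)) ⊕ # 2) (# 1 ⊕ # 2) (≤-reflexive (sym h≡)) (≤-reflexive k+q)
                         until from₀) 0<q)
          r≡q : r ≡ q
          r≡q = ≤-antisym (≮⇒≥ not-larger) (≮⇒≥ not-smaller)
          l+q : l + q ≡ X
          l+q = trans (cong (l +_) (sym r≡q)) l+r
          gaps′ : ∀ {x x′} → Swept (suc h) x → Swept (suc h) x′ → x ≤ x′ → ∃[ j ] x′ ≡ x + j * q
          gaps′ {x} S S′ x≤x′ with either S | either S′
          ... | inj₁ o | inj₁ o′ = gaps I 0<q o o′ x≤x′
          ... | inj₁ o | inj₂ refl = let j , e = gaps I 0<q o Sl (last-greatest I o) in
                suc j , (lin≡ (l ∷ x ∷ (j * q) ∷ q ∷ t₀ ∷ h ∷ [])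
                    ((1 , # 0 , # 1 ⊕ # 2) ∷ (1 , # 4 ⊕ # 5 , # 0 ⊕ # 3) ∷ []) (# 4 ⊕ # 5)
                    (# 1 ⊕ (# 3 ⊕ # 2)) e (sym l+q))
          ... | inj₂ refl | inj₁ o′ = contradiction x≤x′ (<⇒≱ (old-< o′))
          ... | inj₂ refl | inj₂ refl = 0 , sym (+-identityʳ X)
          steps′ : ∀ {x} → Swept (suc h) x → x + q ≤ X → Swept (suc h) (x + q)
          steps′ {x} S le with either S
          ... | inj₂ refl = contradiction le (<⇒≱ (m<m+n X 0<q))
          ... | inj₁ o with gaps I 0<q o Sl (last-greatest I o)
          ...   | zero , e = subst (Swept (suc h)) (trans (sym l+q) (cong (_+ q) (trans e (+-identityʳ x)))) SX
          ...   | suc j , e = old-≤ (steps I 0<q o (lin (l ∷ x ∷ q ∷ (j * q) ∷ []) 1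
              ((1 , # 1 ⊕ (# 2 ⊕ # 3) , # 0) ∷ []) (# 1 ⊕ # 2) (# 0) (≤-reflexive (sym e))))
          recent′ : 0 < q → count σ < g → ∀ {x} → Swept (suc h) x → x + count σ < X → ∀ {x′} → Swept (suc h) x′ → x ≤ x′
          recent′ p c S lt S′ with either S | either S′
          ... | inj₁ o | inj₁ o′   = recent I p c o lt o′
          ... | inj₁ o | inj₂ refl = <⇒≤ (old-< o)
          ... | inj₂ refl | _      = contradiction lt (≤⇒≯ (m≤m+n X (count σ)))

        invariant-append : Invariant β (suc h) (suc h) h (append σ X)
        invariant-append with last σ ≡ᵇ 0 in el
        ... | true = append-first (≡ᵇ-true el)
        ... | false with gap σ ≡ᵇ 0 in eq
        ...   | true  = append-second (n≢0⇒n>0 (≡ᵇ-false el)) (≡ᵇ-true eq)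
        ...   | false = append-next (n≢0⇒n>0 (≡ᵇ-false el)) (n≢0⇒n>0 (≡ᵇ-false eq))

      invariant-sweep : Invariant β (suc h) (suc h) h (sweep σ)
      invariant-sweep with h ∸ t₀ <ᵇ 8 * Λ in et
      ... | false = unchanged (λ S → old (split S))
        where
        old : ∀ {x} → Swept h x ⊎ (x ≡ X × h < t₀ + 8 * Λ × Hit h X) → Swept h x
        old (inj₁ S) = S
        old (inj₂ (_ , h< , _)) = contradiction (trans (sym et) (in-time h<)) (λ ())
      ... | true with hit X in eh
      ...   | true  = Append.invariant-append (hit-sound eh)
                        (lin ((h ∸ t₀) ∷ Λ ∷ t₀ ∷ h ∷ []) 1 ((1 , con 1 ⊕ # 0 , 8 ⊛ (# 1)) ∷
                            (1 , # 3 , # 0 ⊕ # 2) ∷ []) (con 1 ⊕ # 3) (# 2 ⊕ (8 ⊛ (# 1))) (<ᵇ-true et)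
                            (≤-reflexive (sym (m∸n+n≡m t₀≤h))))
      ...   | false = unchanged (λ S → old (split S))
        where
        old : ∀ {x} → Swept h x ⊎ (x ≡ X × h < t₀ + 8 * Λ × Hit h X) → Swept h x
        old (inj₁ S) = S
        old (inj₂ (_ , _ , H)) = contradiction (trans (sym eh) (hit-complete H)) (λ ())

    invariant-search : ∀ {σ} → Invariant β (suc h) (suc h) h σ → Invariant β (suc h) (suc h) (suc h) (search σ)
    invariant-search {σ} I with gap σ ≡ᵇ 0 in eq
    ... | true = record { Invariant I ; recent = λ 0<q → contradiction (≡ᵇ-true eq) (>⇒≢ 0<q) }
    ... | false with count σ <ᵇ g in ec
    ...   | false = record { Invariant I ; recent = λ 0<q c<g → contradiction c<g (≤⇒≯ (<ᵇ-false ec)) }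
    ...   | true  with ⟦ rem ⟧ (suc (count σ) * gap σ) g ≡ᵇ 0 in ev
    ...     | true = record { Invariant I
      ; searching = λ 0<q → search-keep (proj₁ (searching I 0<q)) (inj₁ (≡ᵇ-true ev)) , <ᵇ-true ec
      ; recent = λ 0<q c<g {x} S lt → recent I 0<q (<ᵇ-true ec) S
          (lin (x ∷ (count σ) ∷ t₀ ∷ h ∷ []) 1 ((1 , con 1 ⊕ (# 0 ⊕ (con 1 ⊕ # 1)) , # 2 ⊕ (con 1 ⊕ # 3)) ∷
          []) (con 1 ⊕ (# 0 ⊕ # 1)) (# 2 ⊕ # 3) lt) }
    ...     | false with ⟦ rem ⟧ (suc (count σ) * gap σ) g <ᵇ residue σ in er
    ...       | true = record { Invariant I
      ; searching = λ 0<q → search-improve (proj₁ (searching I 0<q)) (n≢0⇒n>0 (≡ᵇ-false ev)) (<ᵇ-true er) , <ᵇ-true ec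
      ; recent = λ 0<q c<g {x} S lt → recent I 0<q (<ᵇ-true ec) S
          (lin (x ∷ (count σ) ∷ t₀ ∷ h ∷ []) 1 ((1 , con 1 ⊕ (# 0 ⊕ (con 1 ⊕ # 1)) , # 2 ⊕ (con 1 ⊕ # 3)) ∷
          []) (con 1 ⊕ (# 0 ⊕ # 1)) (# 2 ⊕ # 3) lt) }
    ...       | false = record { Invariant I
      ; searching = λ 0<q → search-keep (proj₁ (searching I 0<q)) (inj₂ (<ᵇ-false er)) , <ᵇ-true ec
      ; recent = λ 0<q c<g {x} S lt → recent I 0<q (<ᵇ-true ec) S
          (lin (x ∷ (count σ) ∷ t₀ ∷ h ∷ []) 1 ((1 , con 1 ⊕ (# 0 ⊕ (con 1 ⊕ # 1)) , # 2 ⊕ (con 1 ⊕ # 3)) ∷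
          []) (con 1 ⊕ (# 0 ⊕ # 1)) (# 2 ⊕ # 3) lt) }

    step-correct : ∀ σ → Invariant β h h h σ → t₀ + 6 * Λ ≤ h → (h < t₀ + 8 * Λ → limit h ≤ t₀ + h) →
      Invariant β (suc h) (suc h) (suc h) (search (sweep (revisit σ))) ×
      (∀ {x} → Swept (suc h) x → Hit h x → ∃[ x″ ] x″ ≤ x × Hit h x″ × x″ ∈ revisited σ ++ swept)
    step-correct σ I from sweepable =
      invariant-search (Sweep.invariant-sweep σ′ I′ from sweepable) , λ S → find (Sweep.newly σ′ I′ from sweepable S)
      where
      σ′ = revisit σ
      I′ = Revisit.invariant-revisit σ I
      find : ∀ {x} → Swept h x ⊎ x ∈ swept → Hit h x → ∃[ x″ ] x″ ≤ x × Hit h x″ × x″ ∈ revisited σ ++ swept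
      find (inj₂ m) H = _ , ≤-refl , H , ∈-++⁺ʳ (revisited σ) m
      find (inj₁ o) H = let x″ , le , H″ , m = Revisit.finds σ I o H in x″ , le , H″ , ∈-++⁺ˡ m

-- The life of a block, from the beginning of its sweep on

module Advance {A : Set} (text : ℕ → A) (t₀ Λ g : ℕ) (limit : ℕ → ℕ)
               (Λ>0 : 0 < Λ) (g>0 : 0 < g) (g≤Λ : g ≤ Λ) (g∣t₀ : g ∣ t₀) (g∣Λ : g ∣ Λ)
               (limit-mono : ∀ {h k} → h ≤ k → limit h ≤ limit k)
               (limit-≥ : ∀ h → h ≤ limit h)
               (sweepable : ∀ h → h < t₀ + 8 * Λ → limit h ≤ t₀ + h) where

  open Block text t₀ Λ g limit Λ>0 g>0 g≤Λ g∣t₀ limit-mono limit-≥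

  record After (h : ℕ) (σ : Slot) : Set where
    field
      β         : ℕ
      g∣β       : g ∣ β
      β≤h       : β ≤ h
      h<β+g     : h < β + g
      invariant : Invariant β (suc h) (suc h) (suc h) σ

  module AtTime (h : ℕ) (from : t₀ + 6 * Λ ≤ h) (palindrome : ℕ → Bool) where

    open Following (context t₀ Λ g h (limit h)) palindrome

    module _ (hit-sound : ∀ {x} → hit x ≡ true → Hit h x)
             (hit-complete : ∀ {x} → Hit h x → hit x ≡ true) where

      private
        Before : Slot → Set
        Before σ = ∃[ β ] g ∣ β × β ≤ h × h < β + g × Invariant β h h h σ

        h>0 : 0 < h
        h>0 = (lin (t₀ ∷ Λ ∷ h ∷ []) 1 ((1 , # 0 ⊕ (6 ⊛ (# 1)) , # 2) ∷ (6 , con 1 ⊕ con 0 , # 1) ∷ [])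
            (con 1 ⊕ con 0) (# 2) from Λ>0)

        t₀≤h : t₀ ≤ h
        t₀≤h = ≤-trans (m≤m+n t₀ _) from

        refresh≡ : ∀ σ {b c} → (h ∸ t₀ ≡ᵇ 6 * Λ) ≡ b → (⟦ rem ⟧ h g ≡ᵇ 0) ≡ c →
          refresh σ ≡ (if b then slot 0 0 0 0 0 0 0 else (if c then record σ
              { first = Slot.least σ ; least = 0 } else σ))
        refresh≡ σ refl refl = refl

        decide : ∀ b → (b ≡ true) ⊎ (b ≡ false)
        decide true  = inj₁ refl
        decide false = inj₂ refl

        before : ∀ σ → t₀ + 6 * Λ < h → (∀ k → h ≡ suc k → After k σ) → Before (refresh σ)
        before σ later prior = turn (decide (⟦ rem ⟧ h g ≡ᵇ 0))
          where
          not-first : (h ∸ t₀ ≡ᵇ 6 * Λ) ≡ false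
          not-first with h ∸ t₀ ≡ᵇ 6 * Λ in eq
          ... | false = refl
          ... | true  = contradiction (lin ((h ∸ t₀) ∷ t₀ ∷ h ∷ Λ ∷ []) 1
              ((1 , # 2 , # 0 ⊕ # 1) ∷ (1 , # 0 , 6 ⊛ (# 3)) ∷ []) (# 2) (# 1 ⊕ (6 ⊛ (# 3)))
              (≤-reflexive (sym (m∸n+n≡m t₀≤h))) (≤-reflexive (≡ᵇ-true eq))) (<⇒≱ later)
          h≡ : h ≡ suc (pred h)
          h≡ = sym (suc-pred h {{>-nonZero h>0}})
          open After (prior (pred h) h≡)
          I : Invariant β h h h σ
          I = subst (λ k → Invariant β k k k σ) (sym h≡) invariant
          β<h : β < h
          β<h = subst (β <_) (sym h≡) (s≤s β≤h)
          h≤β+g : h ≤ β + g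
          h≤β+g = subst (_≤ β + g) (sym h≡) h<β+g
          turn : (⟦ rem ⟧ h g ≡ᵇ 0) ≡ true ⊎ (⟦ rem ⟧ h g ≡ᵇ 0) ≡ false → Before (refresh σ)
          turn (inj₁ e) = subst Before (sym (refresh≡ σ not-first e))
            (h , g∣h , ≤-refl , m<m+n h g>0 , invariant-turn β+g≡ I)
            where
            g∣h : g ∣ h
            g∣h = m%n≡0⇒n∣m h g (trans (sym (rem-NonZero h g)) (≡ᵇ-true e))
            β+g≡ : β + g ≡ h
            β+g≡ = ≤-antisym (≈-close (≈-trans (∣⇒≈ g∣β) (≈-sym (∣⇒≈ g∣h))) β<h) h≤β+g
          turn (inj₂ e) = subst Before (sym (refresh≡ σ not-first e))
            (β , g∣β , <⇒≤ β<h , ≤∧≢⇒< h≤β+g not-multiple , I)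
            where
            not-multiple : h ≢ β + g
            not-multiple h≡ = ≡ᵇ-false e (trans (rem-NonZero h g)
              (n∣m⇒m%n≡0 h g (subst (g ∣_) (sym h≡) (∣m∣n⇒∣m+n g∣β ∣-refl))))

        begin-block : ∀ σ → h ≡ t₀ + 6 * Λ → Before (refresh σ)
        -- The slot may still describe another block; all of it is discarded. As `g` divides `t₀`
        -- and `Λ`, a stretch begins at this very time.
        begin-block σ h≡ = subst Before (sym (refresh≡ σ is-first refl))
          (h , subst (g ∣_) (sym h≡) (∣m∣n⇒∣m+n g∣t₀ (∣n⇒∣m*n 6 g∣Λ)) , ≤-refl , m<m+n h g>0 , invariant-start h≡)
          where
          is-first : (h ∸ t₀ ≡ᵇ 6 * Λ) ≡ true
          is-first with h ∸ t₀ ≡ᵇ 6 * Λ in eq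
          ... | true  = refl
          ... | false = contradiction (trans (cong (_∸ t₀) h≡) (m+n∸m≡n t₀ (6 * Λ))) (≡ᵇ-false eq)

        finish : ∀ σ → Before (refresh σ) → After h (advance σ) ×
                 (∀ {x} → Swept (suc h) x → Hit h x → ∃[ x″ ] x″ ≤ x × Hit h x″ × x″ ∈ attempted σ)
        finish σ (β , g∣β , β≤h , h<β+g , I) =
          subst₂ (λ τ xs → After h τ × (∀ {x} → Swept (suc h) x → Hit h x → ∃[ x″ ] x″ ≤ x × Hit h x″ × x″ ∈ xs))
            (sym (advance≡ σ)) (sym (attempted≡ σ))
            (record { β = β ; g∣β = g∣β ; β≤h = β≤h ; h<β+g = h<β+g ; invariant = proj₁ next } , proj₂ next)
          where
          next = BlockStep.Correct.step-correct text t₀ Λ g limit Λ>0 g>0 g≤Λ g∣t₀ limit-mono limit-≥ h β β≤h h<β+g h>0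
                   palindrome hit-sound hit-complete (refresh σ) I from (sweepable h)

      advance-correct : ∀ σ → (∀ k → h ≡ suc k → t₀ + 6 * Λ ≤ k → After k σ) → After h (advance σ) ×
        (∀ {x} → Swept (suc h) x → Hit h x → ∃[ x″ ] x″ ≤ x × Hit h x″ × x″ ∈ attempted σ)
      advance-correct σ prior = by-phase (m≤n⇒m<n∨m≡n from)
        where
        by-phase : t₀ + 6 * Λ < h ⊎ t₀ + 6 * Λ ≡ h → _
        by-phase (inj₁ later) = finish σ (before σ later (λ k e → prior k e (≤-pred (subst (t₀ + 6 * Λ <_) e later))))
        by-phase (inj₂ e)     = finish σ (begin-block σ (sym e))

open import Defs

-- Branching programs with static bounds

reg : ℕ → Expr
reg r = load (lit r)

infixr 4 _▸_
infix 5 _:=_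

data Test : Set where
  _≟ₑ_ _<ₑ_ : Expr → Expr → Test

-- Registers: 0 time, 1 scale, 2 spacing, 3 level, 4 storage base, 5 limit, 6 level size,
-- 7 offset of a slot, 8 … 15 temporary, 16 … 23 contents of the slot.  The slots
-- themselves are kept from address 32 on.  A palindrome is denoted by x = 2c - 2, where
-- c is its centre in the sense of Runnable.
data Code : Set where
  nop    : Code
  _▸_    : Code → Code → Code
  _:=_   : ℕ → Expr → Code
  choose : Test → Code → Code → Code
  try    : Code                 -- runs the process of register 9 if permitted
  locate : Expr → Code
  fetch  : ℕ → Code
  flush  : ℕ → Code

test : Test → Expr
test (e ≟ₑ f) = op eq e f
test (e <ₑ f) = op lt e f

permit : Expr
permit = op mul (op mul (op lt (reg 5) (op add (lit 1) (reg 9)))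
    (op eq (op rem (op sub (reg 9) (reg 0)) (reg 2)) (lit 0)))
                (op mul (op eq (op rem (reg 9) (lit 2)) (lit 0))
                    (op lt (reg 9) (op add (lit 1) (op add (reg 0) (reg 0)))))

program : Code → Program
program nop            = skip
program (c ▸ d)        = program c ⨾ program d
program (r := e)       = store (lit r) e
program (choose b c d) = ifNZ (test b) (program c) (program d)
program try            = store (lit 10) (lit 0)
                         ⨾ ifNZ permit (run (op add (lit 1) (op quo (reg 9) (lit 2))) (lit 10)) skip
program (locate e)     = store (lit 7) (op add (reg 4) (op mul (lit 8) (op rem e (lit 8))))
program (fetch f)      = store (lit (16 + f)) (load (op add (lit (32 + f)) (reg 7)))
program (flush f)      = store (op add (lit (32 + f)) (reg 7)) (reg (16 + f))

duration : Code → ℕ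
duration nop            = 1
duration (c ▸ d)        = duration c + duration d
duration (r := e)       = suc (1 + cost e)
duration (choose b c d) = suc (cost (test b) + (duration c ⊔ duration d))
duration try            = 100
duration (locate e)     = suc (1 + cost (op add (reg 4) (op mul (lit 8) (op rem e (lit 8)))))
duration (fetch f)      = 10
duration (flush f)      = 10

-- The bound  power d  stands for M ^ d, where M exceeds the length of the text.
data Bound : Set where
  power : ℕ → Bound
  word  : Bound

-- A word has at least 32 times as many bits as are needed for numbers below `M`, which is the
-- origin of the constant 32 in the word size.
degree-limit : ℕ
degree-limit = 32

power? : Bound → Bool
power? (power d) = d <ᵇ degree-limit
power? word      = false

-- Generous exponents for which the code below passes the check `safe`. Registers 4 and 7 hold
-- addresses, and the memory size is at most `M ^ 10`; the level size in register 6 may be saturated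
-- and is bounded by the word size alone.
lowRegisterBound : ℕ → Bound
lowRegisterBound 0 = power 1
lowRegisterBound 1 = power 2
lowRegisterBound 2 = power 2
lowRegisterBound 3 = power 1
lowRegisterBound 4 = power 10
lowRegisterBound 5 = power 5
lowRegisterBound 6 = word
lowRegisterBound 7 = power 10
lowRegisterBound 8 = power 1
lowRegisterBound _ = power 20

registerBound : ℕ → Bound
registerBound r = if 15 <ᵇ r then power 2 else lowRegisterBound r

sumBound productBound meetBound : Bound → Bound → Bound
sumBound (power a) (power b) = power (suc (a ⊔ b))
sumBound _         _         = word
productBound (power a) (power b) = power (a + b)
productBound _         _         = word
meetBound (power a) (power b) = power (a ⊓ b)
meetBound (power a) word      = power a
meetBound word      b         = b

bound : Expr → Bound
bound (lit k)         = if k <ᵇ 2 then power 1 else power 8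
bound (param levels)  = power 1
bound (param _)       = word
bound char            = word
bound (load (lit r))  = registerBound r
bound (load _)        = word
bound (op add e f)    = sumBound (bound e) (bound f)
bound (op sub e f)    = bound e
bound (op mul e f)    = productBound (bound e) (bound f)
bound (op quo e f)    = bound e
bound (op rem e f)    = meetBound (bound e) (bound f)
bound (op eq e f)     = power 1
bound (op lt e f)     = power 1

-- Only sums and products can leave a word. Characters are excluded: everything that the program
-- learns about the text comes from the outcomes of processes.
bounded : Expr → Bool
bounded (lit k)         = k <ᵇ 256
bounded (param _)       = true
bounded char            = false
bounded (load (lit r))  = r <ᵇ 32
bounded (load _)        = false
bounded (op add e f)    = power? (bound (op add e f)) ∧ bounded e ∧ bounded f
bounded (op mul e f)    = power? (bound (op mul e f)) ∧ bounded e ∧ bounded f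
bounded (op _ e f)      = bounded e ∧ bounded f

within : Bound → Bound → Bool
within (power a) (power b) = (a ≤ᵇ b) ∧ (b <ᵇ degree-limit)
within (power a) word      = a <ᵇ degree-limit
within word      word      = true
within word      (power _) = false

-- Code that may run processes must preserve the registers 0 … 6.
writable : Bool → ℕ → Bool
writable true  r = (7 <ᵇ r) ∧ (r <ᵇ 32)
writable false r = not (r ≡ᵇ 0) ∧ not (r ≡ᵇ 4) ∧ not (r ≡ᵇ 7) ∧ (r <ᵇ 32)

boundedTest : Test → Bool
boundedTest (e ≟ₑ f) = bounded e ∧ bounded f
boundedTest (e <ₑ f) = bounded e ∧ bounded f

safe : Bool → Code → Bool
safe b nop            = true
safe b (c ▸ d)        = safe b c ∧ safe b d
safe b (r := e)       = writable b r ∧ bounded e ∧ within (bound e) (registerBound r)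
safe b (choose t c d) = boundedTest t ∧ safe b c ∧ safe b d
safe b try            = b
safe b (locate e)     = bounded e
safe b (fetch f)      = f <ᵇ 7
safe b (flush f)      = f <ᵇ 7

T-∧ˡ : ∀ {a b} → T (a ∧ b) → T a
T-∧ˡ {true} _ = tt

T-∧ʳ : ∀ {a b} → T (a ∧ b) → T b
T-∧ʳ {true} p = p

centre : ℕ → ℕ
centre x = 1 + ⟦ quo ⟧ x 2

-- A total semantics in which running a process asks the oracle `palindrome`. The algorithm is
-- verified here; that the machine follows it without getting stuck is a separate matter, settled by
-- `safe`.
module Semantics (parameters : Param → ℕ) (palindrome : ℕ → Bool) where

  eval : Memory → Expr → ℕ
  eval m (lit k)    = k
  eval m (param p)  = parameters p
  -- An arbitrary value, as `bounded` rejects `char`.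
  eval m char       = 0
  eval m (load e)   = m (eval m e)
  eval m (op o e f) = ⟦ o ⟧ (eval m e) (eval m f)

  holds : Memory → Test → Bool
  holds m (e ≟ₑ f) = eval m e ≡ᵇ eval m f
  holds m (e <ₑ f) = eval m e <ᵇ eval m f

  permitted : Memory → ℕ → Bool
  permitted m = allowed (m 0) (m 2) (m 5)

  outcome : Bool → ℕ
  outcome b = if b then 1 else 0

  memory : Code → Memory → Memory
  memory nop            m = m
  memory (c ▸ d)        m = memory d (memory c m)
  memory (r := e)       m = m [ r ≔ eval m e ]
  memory (choose t c d) m = if holds m t then memory c m else memory d m
  memory try            m = if permitted m (m 9) then (m [ 10 ≔ 0 ]) [ 10 ≔ outcome (palindrome (m 9)) ]
      else m [ 10 ≔ 0 ]
  memory (locate e)     m = m [ 7 ≔ m 4 + 8 * ⟦ rem ⟧ (eval m e) 8 ]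
  memory (fetch f)      m = m [ 16 + f ≔ m (32 + (f + m 7)) ]
  memory (flush f)      m = m [ 32 + (f + m 7) ≔ m (16 + f) ]

  runs : Code → Memory → List ℕ
  runs (c ▸ d)        m = runs c m ++ runs d (memory c m)
  runs (choose t c d) m = if holds m t then runs c m else runs d m
  runs try            m = if permitted m (m 9) then m 9 ∷ [] else []
  runs _              m = []

update-same : ∀ (m : Memory) a v → (m [ a ≔ v ]) a ≡ v
update-same m a v with a ≡ᵇ a in e
... | true  = refl
... | false = contradiction refl (≡ᵇ-false {a} {a} e)

update-other : ∀ (m : Memory) a v x → x ≢ a → (m [ a ≔ v ]) x ≡ m x
update-other m a v x x≢a with x ≡ᵇ a in e
... | true  = contradiction (≡ᵇ-true {x} {a} e) x≢a
... | false = refl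

module Bounds (w s M : ℕ) where

  amount : Bound → ℕ
  amount (power d) = M ^ d
  amount word      = 2 ^ w

  -- The first 32 cells are the registers, a slot takes 8 cells (seven are used), and a pair of a
  -- scale and a level takes 64, for eight slots. The last two fields say that the storage addressed
  -- by registers 4 and 7 exists.
  record Bounded (m : Memory) : Set where
    field
      registers : ∀ r → r < 32 → m r < amount (registerBound r)
      cells     : ∀ k → m (32 + k) < M ^ 2
      base      : m 4 + 64 + 32 ≤ s
      slot-base : m 7 + 8 + 32 ≤ s

-- The parameter `Env` stands for the knowledge that the registers describe a level at the present
-- time, which makes permitted processes runnable. It concerns registers below 7 only, whence the
-- form of `Env-pres`.
module Execution (w s : ℕ) (S : Scheme) {σ n : ℕ} (T′ : Text σ n) (i : Fin n)
                 (M : ℕ) (M≥2 : 2 ≤ M) (powers : ∀ d → d ≤ degree-limit → M ^ d ≤ 2 ^ w)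
                 (L<M : L S < M) (s≥40 : 40 ≤ s) (s≤ : s ≤ M ^ 10)
                 (succeeds? : ∀ c → Dec (Succeeds T′ (suc (toℕ i)) c))
                 (Env : Memory → Set)
                 (Env-pres : ∀ {m} a v → 7 ≤ a → Env m → Env (m [ a ≔ v ]))
                 (runnable : ∀ {m x} → Env m → Semantics.permitted (paramValue S w) (λ _ → false) m x ≡ true →
                             Runnable S (suc (toℕ i)) (centre x)) where

  open Machine w s S T′ i
  open Bounds w s M public
  open Semantics (paramValue S w) (λ x → does (succeeds? (centre x))) public

  instance
    M≢0 : NonZero M
    M≢0 = >-nonZero (≤-trans (s≤s z≤n) M≥2)

  M^>0 : ∀ d → 0 < M ^ d
  M^>0 d = m^n>0 M d

  M^-mono : ∀ {a b} → a ≤ b → M ^ a ≤ M ^ b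
  M^-mono = ^-monoʳ-≤ M

  M≤M^1 : ∀ {k} → k < M → k < M ^ 1
  M≤M^1 = subst (_ <_) (sym (*-identityʳ M))

  1<M^1 : 1 < M ^ 1
  1<M^1 = M≤M^1 M≥2

  256≤M^8 : 256 ≤ M ^ 8
  256≤M^8 = ^-monoˡ-≤ 8 M≥2

  register-word : ∀ r → amount (registerBound r) ≤ 2 ^ w
  register-word r with 15 <ᵇ r
  ... | true  = powers 2 (≤ᵇ⇒≤ 2 degree-limit tt)
  ... | false = low r
    where
    low : ∀ r → amount (lowRegisterBound r) ≤ 2 ^ w
    low 0 = powers 1 (≤ᵇ⇒≤ 1 degree-limit tt)
    low 1 = powers 2 (≤ᵇ⇒≤ 2 degree-limit tt)
    low 2 = powers 2 (≤ᵇ⇒≤ 2 degree-limit tt)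
    low 3 = powers 1 (≤ᵇ⇒≤ 1 degree-limit tt)
    low 4 = powers 10 (≤ᵇ⇒≤ 10 degree-limit tt)
    low 5 = powers 5 (≤ᵇ⇒≤ 5 degree-limit tt)
    low 6 = ≤-refl
    low 7 = powers 10 (≤ᵇ⇒≤ 10 degree-limit tt)
    low 8 = powers 1 (≤ᵇ⇒≤ 1 degree-limit tt)
    low (suc (suc (suc (suc (suc (suc (suc (suc (suc r))))))))) = powers 20 (≤ᵇ⇒≤ 20 degree-limit tt)

  amount-sum : ∀ {x y} β γ → T (power? (sumBound β γ)) → x < amount β → y < amount γ → x + y < amount (sumBound β γ)
  amount-sum {x} {y} (power a) (power b) _ x< y< =
    ≤-trans (+-mono-< x< y<) (≤-trans (+-mono-≤ (M^-mono (m≤m⊔n a b)) (M^-mono (m≤n⊔m a b)))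
      (≤-trans (≤-reflexive (cong (M ^ (a ⊔ b) +_) (sym (+-identityʳ _)))) (*-monoˡ-≤ (M ^ (a ⊔ b)) M≥2)))

  amount-product : ∀ {x y} β γ → T (power? (productBound β γ)) → x < amount β → y < amount γ → x * y <
      amount (productBound β γ)
  amount-product {x} {y} (power a) (power b) _ x< y< =
    subst (x * y <_) (sym (^-distribˡ-+-* M a b)) (*-mono-< x< y<)

  amount-meet : ∀ {x} β γ → x < amount β → x < amount γ → x < amount (meetBound β γ)
  amount-meet (power a) (power b) x<a x<b with ≤-total a b
  ... | inj₁ a≤b = subst (λ d → _ < M ^ d) (sym (m≤n⇒m⊓n≡m a≤b)) x<a
  ... | inj₂ b≤a = subst (λ d → _ < M ^ d) (sym (m≥n⇒m⊓n≡n b≤a)) x<b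
  amount-meet (power a) word      x<a x<b = x<a
  amount-meet word      γ         x<a x<b = x<b

  amount-within : ∀ {x} β γ → T (within β γ) → x < amount β → x < amount γ
  amount-within (power a) (power b) p x< = <-≤-trans x< (M^-mono (≤ᵇ⇒≤ a b (T-∧ˡ p)))
  amount-within (power a) word      p x< = <-≤-trans x< (powers a (<⇒≤ (<ᵇ⇒< a degree-limit p)))
  amount-within word      word      p x< = x<

  quo-≤ : ∀ x y → ⟦ quo ⟧ x y ≤ x
  quo-≤ x zero    = z≤n
  quo-≤ x (suc y) = m/n≤m x (suc y)

  rem-≤ : ∀ x y → ⟦ rem ⟧ x y ≤ x
  rem-≤ x zero    = z≤n
  rem-≤ x (suc y) = m%n≤m x (suc y)

  rem-≤ʳ : ∀ x y → ⟦ rem ⟧ x y ≤ y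
  rem-≤ʳ x zero    = z≤n
  rem-≤ʳ x (suc y) = <⇒≤ (m%n<n x (suc y))

  truth<M : ∀ b → (if b then 1 else 0) < M ^ 1
  truth<M true  = 1<M^1
  truth<M false = M^>0 1

  word-of : ∀ {x} β → T (power? β) → x < amount β → x < 2 ^ w
  word-of (power d) p x< = <-≤-trans x< (powers d (<⇒≤ (<ᵇ⇒< d degree-limit p)))

  saturate-word : ∀ x → saturate w x < 2 ^ w
  saturate-word [ x ] = ≤-<-trans (m⊓n≤n x _) (≤-reflexive (suc-pred (2 ^ w) {{m^n≢0 2 w}}))
  saturate-word ⊤⁺    = ≤-reflexive (suc-pred (2 ^ w) {{m^n≢0 2 w}})

  literal-bound : ∀ k → T (k <ᵇ 256) → k < amount (bound (lit k))
  literal-bound k p with k <ᵇ 2 in e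
  ... | true  = <-≤-trans (<ᵇ-true e) (subst (2 ≤_) (sym (*-identityʳ M)) M≥2)
  ... | false = <-≤-trans (<ᵇ⇒< k 256 p) 256≤M^8

  literal-word : ∀ k → T (k <ᵇ 256) → k < 2 ^ w
  literal-word k p = <-≤-trans (<ᵇ⇒< k 256 p) (≤-trans 256≤M^8 (powers 8 (≤ᵇ⇒≤ 8 degree-limit tt)))

  32≤s : 32 ≤ s
  32≤s = ≤-trans (≤ᵇ⇒≤ 32 40 tt) s≥40

  -- Sums and products fit into a word by their static bounds. The other operations yield a truth
  -- value or at most their first operand, and there `in-word` descends.
  evaluates : ∀ {m} → Bounded m → ∀ e → T (bounded e) → (m ⊢ e ⇓ eval m e) × eval m e < amount (bound e)
  in-word : ∀ {m} → Bounded m → ∀ e → T (bounded e) → eval m e < 2 ^ w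

  evaluates B (lit k) p = lit (literal-word k p) , literal-bound k p
  evaluates B (param levels) p = param (<-≤-trans (M≤M^1 L<M) (powers 1 (≤ᵇ⇒≤ 1 degree-limit tt))) , M≤M^1 L<M
  evaluates B (param commonSize) p = param (saturate-word [ b S ]) , saturate-word [ b S ]
  evaluates B (param topSize) p = param (saturate-word (bᴸ S)) , saturate-word (bᴸ S)
  evaluates {m} B (load (lit r)) p =
    load (lit (literal-word r (<⇒<ᵇ (<-≤-trans r<32 (≤ᵇ⇒≤ 32 256 tt))))) (<-≤-trans r<32 32≤s)
      (<-≤-trans (Bounded.registers B r r<32) (register-word r)) ,
    Bounded.registers B r r<32
    where
    r<32 = <ᵇ⇒< r 32 p
  evaluates {m} B (op add e f) p = op (proj₁ E) (proj₁ F) (word-of (sumBound (bound e) (bound f)) ok lim) , lim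
    where
    ok = T-∧ˡ p
    E = evaluates B e (T-∧ˡ (T-∧ʳ {power? (bound (op add e f))} p))
    F = evaluates B f (T-∧ʳ {bounded e} (T-∧ʳ {power? (bound (op add e f))} p))
    lim : eval m e + eval m f < amount (sumBound (bound e) (bound f))
    lim = amount-sum (bound e) (bound f) ok (proj₂ E) (proj₂ F)
  evaluates {m} B (op mul e f) p = op (proj₁ E) (proj₁ F) (word-of (productBound (bound e) (bound f)) ok lim) , lim
    where
    ok = T-∧ˡ p
    E = evaluates B e (T-∧ˡ (T-∧ʳ {power? (bound (op mul e f))} p))
    F = evaluates B f (T-∧ʳ {bounded e} (T-∧ʳ {power? (bound (op mul e f))} p))
    lim : eval m e * eval m f < amount (productBound (bound e) (bound f))
    lim = amount-product (bound e) (bound f) ok (proj₂ E) (proj₂ F)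
  evaluates {m} B (op sub e f) p =
    op (proj₁ (evaluates B e (T-∧ˡ p))) (proj₁ (evaluates B f (T-∧ʳ {bounded e} p)))
       (≤-<-trans (m∸n≤m (eval m e) (eval m f)) (in-word B e (T-∧ˡ p))) ,
    ≤-<-trans (m∸n≤m (eval m e) (eval m f)) (proj₂ (evaluates B e (T-∧ˡ p)))
  evaluates {m} B (op quo e f) p =
    op (proj₁ (evaluates B e (T-∧ˡ p))) (proj₁ (evaluates B f (T-∧ʳ {bounded e} p)))
       (≤-<-trans (quo-≤ (eval m e) (eval m f)) (in-word B e (T-∧ˡ p))) ,
    ≤-<-trans (quo-≤ (eval m e) (eval m f)) (proj₂ (evaluates B e (T-∧ˡ p)))
  evaluates {m} B (op rem e f) p =
    op (proj₁ E) (proj₁ F) (≤-<-trans (rem-≤ (eval m e) (eval m f)) (in-word B e (T-∧ˡ p))) ,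
    amount-meet (bound e) (bound f) (≤-<-trans (rem-≤ (eval m e) (eval m f)) (proj₂ E))
                                    (≤-<-trans (rem-≤ʳ (eval m e) (eval m f)) (proj₂ F))
    where
    E = evaluates B e (T-∧ˡ p)
    F = evaluates B f (T-∧ʳ {bounded e} p)
  evaluates {m} B (op eq e f) p =
    op (proj₁ (evaluates B e (T-∧ˡ p))) (proj₁ (evaluates B f (T-∧ʳ {bounded e} p)))
       (<-≤-trans (truth<M (eval m e ≡ᵇ eval m f)) (powers 1 (≤ᵇ⇒≤ 1 degree-limit tt))) , truth<M (eval m e ≡ᵇ eval m f)
  evaluates {m} B (op lt e f) p =
    op (proj₁ (evaluates B e (T-∧ˡ p))) (proj₁ (evaluates B f (T-∧ʳ {bounded e} p)))
       (<-≤-trans (truth<M (eval m e <ᵇ eval m f)) (powers 1 (≤ᵇ⇒≤ 1 degree-limit tt))) , truth<M (eval m e <ᵇ eval m f)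

  in-word B (lit k) p = literal-word k p
  in-word B e@(param levels) p = <-≤-trans (M≤M^1 L<M) (powers 1 (≤ᵇ⇒≤ 1 degree-limit tt))
  in-word B (param commonSize) p = saturate-word [ b S ]
  in-word B (param topSize) p = saturate-word (bᴸ S)
  in-word B (load (lit r)) p = <-≤-trans (proj₂ (evaluates B (load (lit r)) p)) (register-word r)
  in-word B e@(op add a b) p = word-of (bound e) (T-∧ˡ p) (proj₂ (evaluates B e p))
  in-word B e@(op mul a b) p = word-of (bound e) (T-∧ˡ p) (proj₂ (evaluates B e p))
  in-word {m} B (op sub a b) p = ≤-<-trans (m∸n≤m (eval m a) (eval m b)) (in-word B a (T-∧ˡ p))
  in-word {m} B (op quo a b) p = ≤-<-trans (quo-≤ (eval m a) (eval m b)) (in-word B a (T-∧ˡ p))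
  in-word {m} B (op rem a b) p = ≤-<-trans (rem-≤ (eval m a) (eval m b)) (in-word B a (T-∧ˡ p))
  in-word {m} B (op eq a b) p = <-≤-trans (truth<M (eval m a ≡ᵇ eval m b)) (powers 1 (≤ᵇ⇒≤ 1 degree-limit tt))
  in-word {m} B (op lt a b) p = <-≤-trans (truth<M (eval m a <ᵇ eval m b)) (powers 1 (≤ᵇ⇒≤ 1 degree-limit tt))

  open Bounded

  write-register : ∀ {m} r v → r < 32 → r ≢ 4 → r ≢ 7 → v < amount (registerBound r) → Bounded m → Bounded (m [ r ≔ v ])
  write-register {m} r v r< r≢4 r≢7 v< B = record
    { registers = registers′
    ; cells = λ k → subst (_< M ^ 2) (sym (update-other m r v (32 + k) (>⇒≢ (<-≤-trans r< (m≤m+n 32 k))))) (cells B k)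
    ; base = subst (λ a → a + 64 + 32 ≤ s) (sym (update-other m r v 4 (≢-sym r≢4))) (base B)
    ; slot-base = subst (λ a → a + 8 + 32 ≤ s) (sym (update-other m r v 7 (≢-sym r≢7))) (slot-base B) }
    where
    registers′ : ∀ r′ → r′ < 32 → (m [ r ≔ v ]) r′ < amount (registerBound r′)
    registers′ r′ r′< with r′ ≡ᵇ r in e
    ... | true  = subst (λ r → v < amount (registerBound r)) (sym (≡ᵇ-true {r′} {r} e)) v<
    ... | false = registers B r′ r′<

  write-cell : ∀ {m} k v → v < M ^ 2 → Bounded m → Bounded (m [ 32 + k ≔ v ])
  write-cell {m} k v v< B = record
    { registers = λ r r< → subst (_< amount (registerBound r))
        (sym (update-other m (32 + k) v r (<⇒≢ (<-≤-trans r< (m≤m+n 32 k))))) (registers B r r<)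
    ; cells = cells′ ; base = base B ; slot-base = slot-base B }
    where
    cells′ : ∀ k′ → (m [ 32 + k ≔ v ]) (32 + k′) < M ^ 2
    cells′ k′ with 32 + k′ ≡ᵇ 32 + k
    ... | true  = v<
    ... | false = cells B k′

  write-slot : ∀ {m} v → v + 8 + 32 ≤ s → Bounded m → Bounded (m [ 7 ≔ v ])
  write-slot {m} v v≤ B = record { registers = registers′ ; cells = cells B ; base = base B ; slot-base = v≤ }
    where
    registers′ : ∀ r′ → r′ < 32 → (m [ 7 ≔ v ]) r′ < amount (registerBound r′)
    registers′ r′ r′< with r′ ≡ᵇ 7 in e
    ... | true  = subst (λ r → v < amount (registerBound r)) (sym (≡ᵇ-true {r′} {7} e))
                    (≤-trans (lin (v ∷ s ∷ []) 1 ((1 , (# 0 ⊕ con 8) ⊕ con 32 , # 1) ∷ []) (con 1 ⊕ # 0) (# 1) v≤) s≤)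
    ... | false = registers B r′ r′<

  write-base : ∀ {m} v → v + 64 + 32 ≤ s → Bounded m → Bounded (m [ 4 ≔ v ])
  write-base {m} v v≤ B = record { registers = registers′ ; cells = cells B ; base = v≤ ; slot-base = slot-base B }
    where
    registers′ : ∀ r′ → r′ < 32 → (m [ 4 ≔ v ]) r′ < amount (registerBound r′)
    registers′ r′ r′< with r′ ≡ᵇ 4 in e
    ... | true  = subst (λ r → v < amount (registerBound r)) (sym (≡ᵇ-true {r′} {4} e))
                    (≤-trans (lin (v ∷ s ∷ []) 1 ((1 , (# 0 ⊕ con 64) ⊕ con 32 , # 1) ∷ []) (con 1 ⊕ # 0) (# 1) v≤) s≤)
    ... | false = registers B r′ r′<

  -- Quantified over the answer `r`, which no expression can read, so that memory and runs do not
  -- depend on it. Of the runs, only the inclusion that the guarantee needs is kept.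
  record Executes (p : Program) (m m′ : Memory) (t : ℕ) (xs : List ℕ) : Set where
    constructor executes
    field
      derive : ∀ r → ∃[ r′ ] ∃[ t′ ] ∃[ rs ] (p , ⟨ m , r ⟩ ⇓ ⟨ m′ , r′ ⟩ , t′ , rs) × t′ ≤ t ×
          (∀ {x} → x ∈ xs → centre x ∈ rs)

  truth-∧ : ∀ a b → (if a then 1 else 0) * (if b then 1 else 0) ≡ (if a ∧ b then 1 else 0)
  truth-∧ true  b = +-identityʳ _
  truth-∧ false b = refl

  eval-permit : ∀ m → eval m permit ≡ (if permitted m (m 9) then 1 else 0)
  eval-permit m = trans (cong₂ _*_ (truth-∧ (m 5 <ᵇ 1 + m 9) (⟦ rem ⟧ (m 9 ∸ m 0) (m 2) ≡ᵇ 0))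
                                   (truth-∧ (⟦ rem ⟧ (m 9) 2 ≡ᵇ 0) (m 9 <ᵇ 1 + (m 0 + m 0))))
                        (truth-∧ ((m 5 <ᵇ 1 + m 9) ∧ (⟦ rem ⟧ (m 9 ∸ m 0) (m 2) ≡ᵇ 0))
                            ((⟦ rem ⟧ (m 9) 2 ≡ᵇ 0) ∧ (m 9 <ᵇ 1 + (m 0 + m 0))))

  test-value : ∀ m t → eval m (test t) ≡ (if holds m t then 1 else 0)
  test-value m (e ≟ₑ f) = refl
  test-value m (e <ₑ f) = refl

  test-bounded : ∀ t → T (boundedTest t) → T (bounded (test t))
  test-bounded (e ≟ₑ f) p = p
  test-bounded (e <ₑ f) p = p

  execute-seq : ∀ {p p′ m m′ m″ t t′ xs xs′} → Executes p m m′ t xs → Executes p′ m′ m″ t′ xs′ →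
                Executes (p ⨾ p′) m m″ (t + t′) (xs ++ xs′)
  execute-seq {xs = xs} {xs′} (executes f) (executes g) = executes λ r →
    let r₁ , t₁ , rs₁ , d₁ , le₁ , in₁ = f r
        r₂ , t₂ , rs₂ , d₂ , le₂ , in₂ = g r₁
    in r₂ , t₁ + t₂ , rs₁ ++ rs₂ , (d₁ ⨾ d₂) , +-mono-≤ le₁ le₂ ,
       λ x∈ → case ∈-++⁻ xs x∈ of λ { (inj₁ a) → ∈-++⁺ˡ (in₁ a) ; (inj₂ b) → ∈-++⁺ʳ rs₁ (in₂ b) }

  execute-store : ∀ {m e f a v} → m ⊢ e ⇓ a → m ⊢ f ⇓ v → a < s →
                  Executes (store e f) m (m [ a ≔ v ]) (suc (cost e + cost f)) []
  execute-store E F a<s = executes λ r → r , _ , [] , store E F a<s , ≤-refl , λ ()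

  execute-register : ∀ {m r e} → Bounded m → T (r <ᵇ 32) → T (bounded e) →
                     Executes (store (lit r) e) m (m [ r ≔ eval m e ]) (suc (1 + cost e)) []
  execute-register {m} {r} {e} B r< p =
    execute-store (lit (literal-word r (<⇒<ᵇ (<-≤-trans (<ᵇ⇒< r 32 r<) (≤ᵇ⇒≤ 32 256 tt))))) (proj₁ (evaluates B e p))
                  (<-≤-trans (<ᵇ⇒< r 32 r<) 32≤s)

  record Safely (b : Bool) (c : Code) (m : Memory) : Set where
    field
      execution : Executes (program c) m (memory c m) (duration c) (runs c m)
      bounded′  : Bounded (memory c m)
      env′      : T b → Env (memory c m)

  open Safely

  slot-word : ∀ {m} → Bounded m → ∀ f → f < 7 → m ⊢ op add (lit (32 + f)) (reg 7) ⇓ 32 + (f + m 7)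
  slot-word {m} B f f< = op (lit (literal-word (32 + f) (<⇒<ᵇ
      (<-≤-trans (+-monoʳ-< 32 f<) (≤ᵇ⇒≤ 39 256 tt))))) (proj₁ (evaluates B (reg 7) tt))
    (<-≤-trans (lin ((m 7) ∷ s ∷ f ∷ []) 1 ((1 , (# 0 ⊕ con 8) ⊕ con 32 , # 1) ∷ (1 , con 1 ⊕ # 2 , con 7)
        ∷ []) (con 1 ⊕ (con 32 ⊕ (# 2 ⊕ # 0))) (# 1) (slot-base B) f<)
        (≤-trans s≤ (powers 10 (≤ᵇ⇒≤ 10 degree-limit tt))))

  slot-address : ∀ {m} → Bounded m → ∀ f → f < 7 → 32 + (f + m 7) < s
  slot-address {m} B f f< = (lin ((m 7) ∷ s ∷ f ∷ []) 1 ((1 , (# 0 ⊕ con 8) ⊕ con 32 , # 1) ∷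
      (1 , con 1 ⊕ # 2 , con 7) ∷ []) (con 1 ⊕ (con 32 ⊕ (# 2 ⊕ # 0))) (# 1) (slot-base B) f<)

  assign : ∀ b r e {m} → T (safe b (r := e)) → Bounded m → (T b → Env m) → Safely b (r := e) m
  assign b r e {m} p B E = record
    { execution = execute-register B (in-range b r (T-∧ˡ p)) (T-∧ˡ (T-∧ʳ {writable b r} p))
    ; bounded′ = write-register r (eval m e) (<ᵇ⇒< r 32 (in-range b r (T-∧ˡ p))) (not-4 b r (T-∧ˡ p))
        (not-7 b r (T-∧ˡ p))
        (amount-within (bound e) (registerBound r) (T-∧ʳ {bounded e} (T-∧ʳ {writable b r} p))
          (proj₂ (evaluates B e (T-∧ˡ (T-∧ʳ {writable b r} p))))) B
    ; env′ = preserved b p E }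
    where
    in-range : ∀ b r → T (writable b r) → T (r <ᵇ 32)
    in-range true  r p = T-∧ʳ {7 <ᵇ r} p
    in-range false r p = T-∧ʳ {not (r ≡ᵇ 7)} (T-∧ʳ {not (r ≡ᵇ 4)} (T-∧ʳ {not (r ≡ᵇ 0)} p))
    not-4 : ∀ b r → T (writable b r) → r ≢ 4
    not-4 true  .4 () refl
    not-4 false .4 () refl
    not-7 : ∀ b r → T (writable b r) → r ≢ 7
    not-7 true  .7 () refl
    not-7 false .7 () refl
    preserved : ∀ b → T (safe b (r := e)) → (T b → Env m) → T b → Env (m [ r ≔ eval m e ])
    preserved true p E _ = Env-pres r (eval m e) (<⇒≤ (<ᵇ⇒< 7 r (T-∧ˡ {7 <ᵇ r} (T-∧ˡ p)))) (E tt)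

  attempt : ∀ {m} → Bounded m → Env m → Safely true try m
  attempt {m} B E = record { execution = run-it (permitted m (m 9)) refl ; bounded′ = bounded″ ; env′ = λ _ → env″ }
    where
    m₀ : Memory
    m₀ = m [ 10 ≔ 0 ]
    bound-10 : ∀ {m} v → v ≤ 1 → Bounded m → Bounded (m [ 10 ≔ v ])
    bound-10 v v≤ = write-register 10 v (≤ᵇ⇒≤ 11 32 tt) (λ ()) (λ ())
        (<-≤-trans (≤-<-trans v≤ 1<M^1) (M^-mono (≤ᵇ⇒≤ 1 20 tt)))
    B₀ : Bounded m₀
    B₀ = bound-10 0 z≤n B
    outcome≤1 : ∀ b → outcome b ≤ 1
    outcome≤1 true  = ≤-refl
    outcome≤1 false = z≤n
    bounded″ : Bounded (memory try m)
    bounded″ with permitted m (m 9)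
    ... | true  = bound-10 _ (outcome≤1 (does (succeeds? (centre (m 9))))) B₀
    ... | false = B₀
    env″ : Env (memory try m)
    env″ with permitted m (m 9)
    ... | true  = Env-pres 10 _ (≤ᵇ⇒≤ 7 10 tt) (Env-pres 10 0 (≤ᵇ⇒≤ 7 10 tt) E)
    ... | false = Env-pres 10 0 (≤ᵇ⇒≤ 7 10 tt) E
    begin-try : Executes (store (lit 10) (lit 0)) m m₀ 3 []
    begin-try = execute-register B tt tt
    permit⇓ : ∀ {b} → permitted m (m 9) ≡ b → m₀ ⊢ permit ⇓ (if b then 1 else 0)
    permit⇓ {b} e = subst (m₀ ⊢ permit ⇓_) (trans (eval-permit m₀) (cong (λ b → if b then 1 else 0) e))
                          (proj₁ (evaluates B₀ permit tt))
    centre⇓ : m₀ ⊢ op add (lit 1) (op quo (reg 9) (lit 2)) ⇓ centre (m 9)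
    centre⇓ = proj₁ (evaluates B₀ (op add (lit 1) (op quo (reg 9) (lit 2))) tt)
    outcome⇓ : m₀ ⊢ lit 10 ⇓ 10
    outcome⇓ = lit (literal-word 10 tt)
    10<s : 10 < s
    10<s = <-≤-trans (≤ᵇ⇒≤ 11 32 tt) 32≤s
    run-it : ∀ b → permitted m (m 9) ≡ b → Executes (program try) m (memory try m) 100 (runs try m)
    run-it false e = subst₂ (λ m′ xs → Executes (program try) m m′ 100 xs)
      (cong (λ b → if b then (m₀ [ 10 ≔ outcome (does (succeeds? (centre (m 9)))) ]) else m₀) (sym e))
      (cong (λ b → if b then m 9 ∷ [] else []) (sym e))
      (executes λ r → let r₁ , t₁ , rs₁ , d₁ , le₁ , _ = Executes.derive begin-try r in
        r₁ , _ , _ , (d₁ ⨾ if-zero (permit⇓ e) skip) , ≤-trans (+-monoˡ-≤ _ le₁) (≤ᵇ⇒≤ _ 100 tt) , λ ())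
    run-it true e = subst₂ (λ m′ xs → Executes (program try) m m′ 100 xs)
      (cong (λ b → if b then (m₀ [ 10 ≔ outcome (does (succeeds? (centre (m 9)))) ]) else m₀) (sym e))
      (cong (λ b → if b then m 9 ∷ [] else []) (sym e))
      (executes by-outcome)
      where
      can : Runnable S h (centre (m 9))
      can = runnable E e
      by-outcome : ∀ r → ∃[ r′ ] ∃[ t′ ] ∃[ rs ]
        (program try , ⟨ m , r ⟩ ⇓ ⟨ m₀ [ 10 ≔ outcome (does (succeeds? (centre (m 9)))) ] , r′ ⟩ , t′ ,
            rs) × t′ ≤ 100 ×
        (∀ {x} → x ∈ m 9 ∷ [] → centre x ∈ rs)
      by-outcome r with Executes.derive begin-try r | succeeds? (centre (m 9))
      ... | r₁ , t₁ , rs₁ , d₁ , le₁ , _ | yes y =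
        _ , _ , _ , (d₁ ⨾ if-nonzero (permit⇓ e) (run-succeeds centre⇓ outcome⇓ 10<s can y)) ,
        ≤-trans (+-monoˡ-≤ _ le₁) (≤ᵇ⇒≤ _ 100 tt) , λ { (here refl) → ∈-++⁺ʳ rs₁ (here refl) }
      ... | r₁ , t₁ , rs₁ , d₁ , le₁ , _ | no n =
        _ , _ , _ , (d₁ ⨾ if-nonzero (permit⇓ e) (run-fails centre⇓ outcome⇓ 10<s can n)) ,
        ≤-trans (+-monoˡ-≤ _ le₁) (≤ᵇ⇒≤ _ 100 tt) , λ { (here refl) → ∈-++⁺ʳ rs₁ (here refl) }

  -- By induction on the code: `safe` supplies the bounds that keep the machine from getting stuck,
  -- and `Env` legitimates the runs. The index `b` tells whether processes may be run and thus
  -- whether `Env` must be preserved.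
  execute : ∀ b c {m} → T (safe b c) → Bounded m → (T b → Env m) → Safely b c m
  execute b nop p B E = record { execution = executes (λ r → r , 1 , [] , skip , ≤-refl , λ ()) ; bounded′
      = B ; env′ = E }
  execute b (c ▸ d) p B E = record
    { execution = execute-seq (execution C) (execution D) ; bounded′ = bounded′ D ; env′ = env′ D }
    where
    C = execute b c (T-∧ˡ p) B E
    D = execute b d (T-∧ʳ {safe b c} p) (bounded′ C) (env′ C)
  execute b (r := e) p B E = assign b r e p B E
  execute b (choose t c d) {m} p B E = branch (holds m t) refl
    where
    C = execute b c (T-∧ˡ (T-∧ʳ {boundedTest t} p)) B E
    D = execute b d (T-∧ʳ {safe b c} (T-∧ʳ {boundedTest t} p)) B E
    t⇓ : ∀ {v} → holds m t ≡ v → m ⊢ test t ⇓ (if v then 1 else 0)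
    t⇓ e = subst (m ⊢ test t ⇓_) (trans (test-value m t) (cong (λ b → if b then 1 else 0) e))
                 (proj₁ (evaluates B (test t) (test-bounded t (T-∧ˡ p))))
    Result : Bool → Set
    Result v = Executes (program (choose t c d)) m (if v then memory c m else memory d m) (duration (choose t c d))
                        (if v then runs c m else runs d m)
             × Bounded (if v then memory c m else memory d m) × (T b → Env (if v then memory c m else memory d m))
    package : Result (holds m t) → Safely b (choose t c d) m
    package (x , y , z) = record { execution = x ; bounded′ = y ; env′ = z }
    branch : ∀ v → holds m t ≡ v → Safely b (choose t c d) m
    branch true e = package (subst Result (sym e)
      (executes (λ r → let r′ , t′ , rs , δ , le , ∈rs = Executes.derive (execution C) r in
         r′ , _ , rs , if-nonzero (t⇓ e) δ , s≤s (+-monoʳ-≤ (cost (test t)) (≤-trans le (m≤m⊔n _ _))) , ∈rs) ,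
       bounded′ C , env′ C))
    branch false e = package (subst Result (sym e)
      (executes (λ r → let r′ , t′ , rs , δ , le , ∈rs = Executes.derive (execution D) r in
         r′ , _ , rs , if-zero (t⇓ e) δ , s≤s (+-monoʳ-≤ (cost (test t)) (≤-trans le (m≤n⊔m _ _))) , ∈rs) ,
       bounded′ D , env′ D))
  execute true try p B E = attempt B (E tt)
  execute b (locate e) {m} p B E = record
    { execution = execute-store (lit (literal-word 7 tt)) address⇓ (<-≤-trans (≤ᵇ⇒≤ 8 32 tt) 32≤s)
    ; bounded′ = write-slot v v-fits B
    ; env′ = λ Tb → Env-pres 7 v ≤-refl (E Tb) }
    where
    z = ⟦ rem ⟧ (eval m e) 8
    v = m 4 + 8 * z
    z<8 : z < 8
    z<8 = m%n<n (eval m e) 8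
    v-fits : v + 8 + 32 ≤ s
    v-fits = (lin ((m 4) ∷ s ∷ z ∷ []) 1 ((1 , (# 0 ⊕ con 64) ⊕ con 32 , # 1) ∷ (8 , con 1 ⊕ # 2 , con 8) ∷
        []) (((# 0 ⊕ (8 ⊛ (# 2))) ⊕ con 8) ⊕ con 32) (# 1) (base B) z<8)
    fits : ∀ {x} → x ≤ v → x < 2 ^ w
    fits x≤v = ≤-trans (<-≤-trans (s≤s x≤v) (≤-trans (lin (v ∷ []) 1 [] (con 1 ⊕ # 0)
        ((# 0 ⊕ con 8) ⊕ con 32)) v-fits)) (≤-trans s≤ (powers 10 (≤ᵇ⇒≤ 10 degree-limit tt)))
    address⇓ : m ⊢ op add (reg 4) (op mul (lit 8) (op rem e (lit 8))) ⇓ v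
    address⇓ = op (proj₁ (evaluates B (reg 4) tt))
                 (op (lit (literal-word 8 tt)) (op (proj₁ (evaluates B e p)) (lit (literal-word 8 tt))
                     (fits (≤-trans (m≤m+n z _) (m≤n+m (8 * z) (m 4)))))
                     (fits (m≤n+m (8 * z) (m 4))))
                 (fits ≤-refl)
  execute b (fetch f) {m} p B E = record
    { execution = executes (λ r → r , _ , [] ,
        store (lit (literal-word (16 + f) (<⇒<ᵇ (<-≤-trans (+-monoʳ-< 16 f<) (≤ᵇ⇒≤ 23 256 tt)))))
              (load (slot-word B f f<) (slot-address B f f<)
                  (<-≤-trans (cells B (f + m 7)) (powers 2 (≤ᵇ⇒≤ 2 degree-limit tt))))
              (<-≤-trans (+-monoʳ-< 16 f<) (≤-trans (≤ᵇ⇒≤ 23 32 tt) 32≤s)) , ≤ᵇ⇒≤ _ 10 tt , λ ())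
    ; bounded′ = write-register (16 + f) _ (<-≤-trans (+-monoʳ-< 16 f<) (≤ᵇ⇒≤ 23 32 tt)) (λ ()) (λ ())
        (cells B (f + m 7)) B
    ; env′ = λ Tb → Env-pres (16 + f) _ (≤-trans (≤ᵇ⇒≤ 7 16 tt) (m≤m+n 16 f)) (E Tb) }
    where
    f< = <ᵇ⇒< f 7 p
  execute b (flush f) {m} p B E = record
    { execution = executes (λ r → r , _ , [] ,
        store (slot-word B f f<) (proj₁ (evaluates B (reg (16 + f))
            (<⇒<ᵇ (<-≤-trans (+-monoʳ-< 16 f<) (≤ᵇ⇒≤ 23 32 tt)))))
              (slot-address B f f<) , ≤ᵇ⇒≤ _ 10 tt , λ ())
    ; bounded′ = write-cell (f + m 7) _ (registers B (16 + f) (<-≤-trans (+-monoʳ-< 16 f<) (≤ᵇ⇒≤ 23 32 tt))) B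
    ; env′ = λ Tb → Env-pres (32 + (f + m 7)) _ (≤-trans (≤ᵇ⇒≤ 7 32 tt) (m≤m+n 32 _)) (E Tb) }
    where
    f< = <ᵇ⇒< f 7 p

-- The program

infixl 6 _+ₑ_ _-ₑ_
infixl 7 _*ₑ_ _/ₑ_ _%ₑ_

_+ₑ_ _-ₑ_ _*ₑ_ _/ₑ_ _%ₑ_ : Expr → Expr → Expr
_+ₑ_ = op add
_-ₑ_ = op sub
_*ₑ_ = op mul
_/ₑ_ = op quo
_%ₑ_ = op rem

time scale spacing level limitₑ origin x success : Expr
time    = reg 0
scale   = reg 1
spacing = reg 2
level   = reg 3
limitₑ  = reg 5
origin  = reg 8
x       = reg 9
success = reg 10

firstₑ leastₑ gapₑ lastₑ countₑ residueₑ inverseₑ : Expr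
firstₑ   = reg 16
leastₑ   = reg 17
gapₑ     = reg 18
lastₑ    = reg 19
countₑ   = reg 20
residueₑ = reg 21
inverseₑ = reg 22

-- a - (a - b) is b if b ≤ a, and bounded by a anyway.
cap : Expr → Expr → Expr
cap a b = a -ₑ (a -ₑ b)

refreshCode : Code
refreshCode = choose ((time -ₑ origin) ≟ₑ (lit 6 *ₑ scale))
  (16 := lit 0 ▸ 17 := lit 0 ▸ 18 := lit 0 ▸ 19 := lit 0 ▸ 20 := lit 0 ▸ 21 := lit 0 ▸ 22 := lit 0)
  (choose ((time %ₑ spacing) ≟ₑ lit 0) (16 := leastₑ ▸ 17 := lit 0) nop)

-- The cap gives the new minimum a static bound. It is exact because `x` is at most `last` wherever
-- this code is used.
lowerCode : Code
lowerCode = choose (leastₑ ≟ₑ lit 0) (17 := cap lastₑ x) (choose (x <ₑ leastₑ) (17 := cap lastₑ x) nop)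

followCode : Code
followCode = choose (lastₑ <ₑ x) nop (try ▸ choose (success ≟ₑ lit 1) lowerCode nop)

startₑ candidateₑ strideₑ : Expr
startₑ     = firstₑ +ₑ ((limitₑ -ₑ firstₑ) +ₑ (gapₑ -ₑ lit 1)) /ₑ gapₑ *ₑ gapₑ
candidateₑ = startₑ +ₑ ((spacing -ₑ (startₑ -ₑ time) %ₑ spacing) %ₑ spacing /ₑ residueₑ *ₑ inverseₑ)
                       %ₑ (spacing /ₑ residueₑ) *ₑ gapₑ
strideₑ    = gapₑ *ₑ (spacing /ₑ residueₑ)

prepareCode : Code
prepareCode = 11 := candidateₑ ▸ 12 := candidateₑ +ₑ strideₑ ▸ 13 := candidateₑ +ₑ strideₑ +ₑ strideₑ

followThree : Code
followThree = (9 := reg 11 ▸ followCode) ▸ (9 := reg 12 ▸ followCode) ▸ (9 := reg 13 ▸ followCode)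

revisitCode : Code
revisitCode = choose (firstₑ ≟ₑ lit 0) nop (prepareCode ▸ followThree)

appendCode : Code
appendCode =
  choose (lastₑ ≟ₑ lit 0) nop
    (choose (gapₑ ≟ₑ lit 0) (18 := origin +ₑ time -ₑ lastₑ ▸ 20 := lit 0 ▸ 21 := spacing ▸ 22 := lit 0) nop)
  -- The assignment to `last` comes first, as `lowerCode` caps by it.
  ▸ 19 := origin +ₑ time ▸ lowerCode

sweepCode : Code
sweepCode = choose ((time -ₑ origin) <ₑ (lit 8 *ₑ scale))
  (9 := origin +ₑ time ▸ try ▸ choose (success ≟ₑ lit 1) appendCode nop) nop

searchCode : Code
searchCode = choose (gapₑ ≟ₑ lit 0) nop (choose (countₑ <ₑ spacing)
  (choose (residue′ ≟ₑ lit 0) nop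
     (choose (residue′ <ₑ residueₑ) (21 := residue′ ▸ 22 := cap spacing (lit 1 +ₑ countₑ)) nop)
   ▸ 20 := cap spacing (lit 1 +ₑ countₑ))
  nop)
  where
  residue′ = (lit 1 +ₑ countₑ) *ₑ gapₑ %ₑ spacing

advanceCode : Code
advanceCode = refreshCode ▸ revisitCode ▸ sweepCode ▸ searchCode

fetchAll : Code
fetchAll = fetch 0 ▸ fetch 1 ▸ fetch 2 ▸ fetch 3 ▸ fetch 4 ▸ fetch 5 ▸ fetch 6

flushes : ℕ → Code
flushes zero    = nop
flushes (suc f) = flushes f ▸ flush f

-- The block at distance `u` has the number `h / Λ - u`, and this number modulo 8 is its slot. Six
-- consecutive blocks never share one.
locateCode : ℕ → Code
locateCode u = 8 := time -ₑ time %ₑ scale -ₑ lit u *ₑ scale ▸ locate (time /ₑ scale -ₑ lit u)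

blockWith : Code → ℕ → Code
blockWith advancing u = choose ((time /ₑ scale) <ₑ lit u) nop (locateCode u ▸ fetchAll ▸ advancing ▸ flushes 7)

-- For `k = 6` these are the distances from 6 to 11, that is, the blocks with
-- `6 * Λ ≤ h - t₀ < 12 * Λ`.
blocksWith : Code → ℕ → Code
blocksWith advancing zero    = nop
blocksWith advancing (suc k) = blocksWith advancing k ▸ blockWith advancing (6 + k)

-- Aims at the `u`-th multiple of the spacing before the latest one. If there is none, truncation
-- yields position 0, and `try` checks the permission in any case.
directCode : ℕ → Code
directCode u = 9 := time +ₑ (time -ₑ time %ₑ spacing -ₑ lit u *ₑ spacing) ▸ try

directs : ℕ → Code
directs zero    = nop
directs (suc u) = directs u ▸ directCode u

pairWith : Code → ℕ → ℕ → Code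
pairWith advancing n k = directs n ▸ blocksWith advancing k

-- Abstract, since normal forms in which the program is unfolded are huge.
abstract

  pairCode : Code
  pairCode = pairWith advanceCode 8 6

  pairCode≡ : pairCode ≡ pairWith advanceCode 8 6
  pairCode≡ = refl

  pair-safe : T (safe true pairCode)
  pair-safe = tt

setupCode : Code
setupCode = choose (level <ₑ param levels) (6 := param commonSize) (6 := param topSize)
  ▸ 5 := time +ₑ spacing *ₑ (time /ₑ spacing +ₑ lit 1 -ₑ reg 6)

-- One step of the staircase `next`. Scales and spacings are at most `h` whenever they are doubled,
-- so capping by `2 * h` does not change them.
proceedCode : Code
proceedCode = choose (level <ₑ param levels)
  (choose (reg 6 <ₑ ((lit 16 *ₑ scale) /ₑ spacing))
    (3 := cap (param levels) (lit 1 +ₑ level) ▸ 2 := cap (time +ₑ time) (spacing +ₑ spacing))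
    (1 := cap (time +ₑ time) (scale +ₑ scale)))
  (1 := cap (time +ₑ time) (scale +ₑ scale))

resetCode : Code
resetCode = 1 := lit 1 ▸ 2 := lit 1 ▸ 3 := lit 0

bodyWith : Code → Program
bodyWith pair = program setupCode ⨾ program pair ⨾ program proceedCode ⨾ store (lit 4) (reg 4 +ₑ lit 64)

continueₑ : Expr
continueₑ = op lt scale (time +ₑ lit 1)

passTimeOf passCostOf : Code → ℕ
passTimeOf pair = duration setupCode + (duration pair + (duration proceedCode + suc (1 + cost (reg 4 +ₑ lit 64))))
passCostOf pair = passTimeOf pair + suc (cost continueₑ)

startTime : ℕ
startTime = suc (1 + cost (reg 0 +ₑ lit 1)) + (suc (1 + cost (lit 0)) + duration resetCode)

mainWith : Code → Program
mainWith pair = store (lit 0) (reg 0 +ₑ lit 1) ⨾ store (lit 4) (lit 0) ⨾ program resetCode ⨾ while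
    continueₑ (bodyWith pair)

-- What the program does to a slot

slot-at : Memory → ℕ → Slot
slot-at m k = slot (m (32 + k)) (m (33 + k)) (m (34 + k)) (m (35 + k)) (m (36 + k)) (m (37 + k)) (m (38 + k))

module Blocks (parameters : Param → ℕ) (palindrome : ℕ → Bool) where

  open Semantics parameters palindrome

  -- A sufficient syntactic condition for leaving the address `a` alone. The target of `flush` is
  -- computed at run time, so `flush` never passes.
  keeps : Code → ℕ → Bool
  keeps nop            a = true
  keeps (c ▸ d)        a = keeps c a ∧ keeps d a
  keeps (r := e)       a = not (a ≡ᵇ r)
  keeps (choose t c d) a = keeps c a ∧ keeps d a
  keeps try            a = not (a ≡ᵇ 10)
  keeps (locate e)     a = not (a ≡ᵇ 7)
  keeps (fetch f)      a = not (a ≡ᵇ 16 + f)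
  keeps (flush f)      a = false

  update-kept : ∀ (m : Memory) r v a → T (not (a ≡ᵇ r)) → (m [ r ≔ v ]) a ≡ m a
  update-kept m r v a p with a ≡ᵇ r
  ... | false = refl

  kept : ∀ c m a → T (keeps c a) → memory c m a ≡ m a
  kept nop m a p = refl
  kept (c ▸ d) m a p = trans (kept d (memory c m) a (T-∧ʳ {keeps c a} p)) (kept c m a (T-∧ˡ p))
  kept (r := e) m a p = update-kept m r (eval m e) a p
  kept (choose t c d) m a p with holds m t
  ... | true  = kept c m a (T-∧ˡ p)
  ... | false = kept d m a (T-∧ʳ {keeps c a} p)
  kept try m a p with permitted m (m 9)
  ... | true  = trans (update-kept (m [ 10 ≔ 0 ]) 10 _ a p) (update-kept m 10 0 a p)
  ... | false = update-kept m 10 0 a p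
  kept (locate e) m a p = update-kept m 7 _ a p
  kept (fetch f) m a p = update-kept m (16 + f) _ a p

  here-context : Memory → Context
  here-context m = context (m 8) (m 1) (m 2) (m 0) (m 5)

  here-slot : Memory → Slot
  here-slot m = slot (m 16) (m 17) (m 18) (m 19) (m 20) (m 21) (m 22)

  keeps-context : Code → Bool
  keeps-context c = (keeps c 8 ∧ keeps c 1) ∧ (keeps c 2 ∧ keeps c 0) ∧ keeps c 5

  kept-context : ∀ c m → T (keeps-context c) → here-context (memory c m) ≡ here-context m
  kept-context c m p
    rewrite kept c m 8 (T-∧ˡ {keeps c 8} (T-∧ˡ p))
          | kept c m 1 (T-∧ʳ {keeps c 8} (T-∧ˡ p))
          | kept c m 2 (T-∧ˡ {keeps c 2} (T-∧ˡ (T-∧ʳ {keeps c 8 ∧ keeps c 1} p)))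
          | kept c m 0 (T-∧ʳ {keeps c 2} (T-∧ˡ (T-∧ʳ {keeps c 8 ∧ keeps c 1} p)))
          | kept c m 5 (T-∧ʳ {keeps c 2 ∧ keeps c 0} (T-∧ʳ {keeps c 8 ∧ keeps c 1} p)) = refl

  refresh-code : ∀ m → here-slot (memory refreshCode m) ≡ Following.refresh (here-context m) palindrome (here-slot m)
  refresh-code m with m 0 ∸ m 8 ≡ᵇ 6 * m 1
  ... | true = refl
  ... | false with ⟦ rem ⟧ (m 0) (m 2) ≡ᵇ 0
  ...   | true  = refl
  ...   | false = refl

  lower-code : ∀ m → m 9 ≤ m 19 → here-slot (memory lowerCode m) ≡ record (here-slot m) { least = min₀ (m 17) (m 9) }
  lower-code m le with m 17 ≡ᵇ 0
  ... | true = cong (λ y → record (here-slot m) { least = y }) (m∸[m∸n]≡n le)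
  ... | false with m 9 <ᵇ m 17
  ...   | true  = cong (λ y → record (here-slot m) { least = y }) (m∸[m∸n]≡n le)
  ...   | false = refl

  success-value : ∀ m → memory try m 10 ≡ outcome (Following.hit (here-context m) palindrome (m 9))
  success-value m with permitted m (m 9)
  ... | true  = refl
  ... | false = refl

  outcome-test : ∀ b → (outcome b ≡ᵇ 1) ≡ b
  outcome-test true  = refl
  outcome-test false = refl

  try-slot : ∀ m → here-slot (memory try m) ≡ here-slot m
  try-slot m with permitted m (m 9)
  ... | true  = refl
  ... | false = refl

  follow-code : ∀ m → here-slot (memory followCode m) ≡ Following.follow (here-context m) palindrome (here-slot m) (m 9)
  follow-code m = by-order (m 19 <ᵇ m 9) refl
    where
    c = here-context m
    σ = here-slot m
    m₁ = memory try m
    Lowered : Bool → Slot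
    Lowered b = if b then record σ { least = min₀ (Slot.least σ) (m 9) } else σ
    tried : (m 19 <ᵇ m 9) ≡ false → ∀ b → here-slot (if b then memory lowerCode m₁ else m₁) ≡ Lowered b
    tried e true  = trans (lower-code m₁ (subst₂ _≤_ (sym (kept try m 9 tt)) (sym (kept try m 19 tt)) (<ᵇ-false e)))
                      (cong₂ (λ σ a → record σ { least = min₀ (Slot.least σ) a }) (try-slot m) (kept try m 9 tt))
    tried e false = try-slot m
    by-order : ∀ b → (m 19 <ᵇ m 9) ≡ b → here-slot (if b then m else (if m₁ 10 ≡ᵇ 1 then memory lowerCode m₁ else m₁)) ≡
               (if b then σ else Lowered (Following.hit c palindrome (m 9)))
    by-order true  e = refl
    by-order false e = trans (tried e (m₁ 10 ≡ᵇ 1))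
      (cong Lowered (trans (cong (_≡ᵇ 1) (success-value m)) (outcome-test (Following.hit c palindrome (m 9)))))

  quiet : Code → Bool
  quiet (c ▸ d)        = quiet c ∧ quiet d
  quiet (choose t c d) = quiet c ∧ quiet d
  quiet try            = false
  quiet _              = true

  quiet-runs : ∀ c m → T (quiet c) → runs c m ≡ []
  quiet-runs nop m p = refl
  quiet-runs (c ▸ d) m p = cong₂ _++_ (quiet-runs c m (T-∧ˡ p)) (quiet-runs d (memory c m) (T-∧ʳ {quiet c} p))
  quiet-runs (r := e) m p = refl
  quiet-runs (choose t c d) m p with holds m t
  ... | true  = quiet-runs c m (T-∧ˡ p)
  ... | false = quiet-runs d m (T-∧ʳ {quiet c} p)
  quiet-runs (locate e) m p = refl
  quiet-runs (fetch f) m p = refl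
  quiet-runs (flush f) m p = refl

  follow-runs : ∀ m → runs followCode m ≡ Following.followed (here-context m) palindrome (here-slot m) (m 9)
  follow-runs m with m 19 <ᵇ m 9
  ... | true  = refl
  ... | false = trans (cong (runs try m ++_) (quiet-runs (choose (success ≟ₑ lit 1) lowerCode nop) (memory try m) tt))
                      (++-identityʳ (runs try m))

  record Followed (m : Memory) (r : ℕ) (c : Context) (σ : Slot) (z : ℕ) : Set where
    field
      slot≡    : here-slot (memory (9 := reg r ▸ followCode) m) ≡ Following.follow c palindrome σ z
      context≡ : here-context (memory (9 := reg r ▸ followCode) m) ≡ c
      last≡    : memory (9 := reg r ▸ followCode) m 19 ≡ m 19
      runs≡    : runs (9 := reg r ▸ followCode) m ≡ Following.followed c palindrome σ z

  next-code : ∀ m r {c σ z} → here-context m ≡ c → here-slot m ≡ σ → m r ≡ z → Followed m r c σ z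
  next-code m r refl refl refl = record
    { slot≡ = follow-code (m [ 9 ≔ m r ]) ; context≡ = kept-context followCode (m [ 9 ≔ m r ]) tt
    ; last≡ = kept followCode (m [ 9 ≔ m r ]) 19 tt ; runs≡ = follow-runs (m [ 9 ≔ m r ]) }

  followed-cong : ∀ c {σ σ′} z → Slot.last σ ≡ Slot.last σ′ → Following.followed c palindrome σ z ≡
      Following.followed c palindrome σ′ z
  followed-cong c z l = cong (λ l → if l <ᵇ z then [] else Following.attempt c palindrome z) l

  three-follows : ∀ m {c σ z z′ z″} → here-context m ≡ c → here-slot m ≡ σ → m 11 ≡ z → m 12 ≡ z′ → m 13 ≡ z″ →
    here-slot (memory followThree m) ≡ Following.follow c palindrome
        (Following.follow c palindrome (Following.follow c palindrome σ z) z′) z″ ×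
    runs followThree m ≡ Following.followed c palindrome σ z ++ Following.followed c palindrome σ z′ ++
        Following.followed c palindrome σ z″
  three-follows m {c} {σ} {z} {z′} {z″} c≡ σ≡ z≡ z′≡ z″≡ = Followed.slot≡ F₃ ,
    cong₂ _++_ (Followed.runs≡ F₁) (cong₂ _++_
      (trans (Followed.runs≡ F₂) (followed-cong c {Following.follow c palindrome σ z} {σ} z′
          (trans (cong Slot.last (sym (Followed.slot≡ F₁))) l₁)))
      (trans (Followed.runs≡ F₃) (followed-cong c {Following.follow c palindrome
          (Following.follow c palindrome σ z) z′} {σ} z″ (trans (cong Slot.last (sym (Followed.slot≡ F₂))) l₂))))
    where
    m₁ = memory (9 := reg 11 ▸ followCode) m
    m₂ = memory (9 := reg 12 ▸ followCode) m₁
    F₁ = next-code m 11 c≡ σ≡ z≡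
    F₂ = next-code m₁ 12 (Followed.context≡ F₁) (Followed.slot≡ F₁)
        (trans (kept (9 := reg 11 ▸ followCode) m 12 tt) z′≡)
    F₃ = next-code m₂ 13 (Followed.context≡ F₂) (Followed.slot≡ F₂)
           (trans (kept (9 := reg 12 ▸ followCode) m₁ 13 tt) (trans (kept (9 := reg 11 ▸ followCode) m 13 tt) z″≡))
    l₁ : m₁ 19 ≡ Slot.last σ
    l₁ = trans (Followed.last≡ F₁) (cong Slot.last σ≡)
    l₂ : m₂ 19 ≡ Slot.last σ
    l₂ = trans (Followed.last≡ F₂) l₁

  candidate-value : ∀ m → eval m candidateₑ ≡ Following.candidate (here-context m) palindrome (here-slot m)
  candidate-value m = refl

  stride-value : ∀ m → eval m strideₑ ≡ Following.stride (here-context m) palindrome (here-slot m)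
  stride-value m = refl

  prepared : ∀ m → let m₁ = memory prepareCode m in
    m₁ 11 ≡ eval m candidateₑ × m₁ 12 ≡ eval m candidateₑ + eval m strideₑ ×
    m₁ 13 ≡ eval m candidateₑ + eval m strideₑ + eval m strideₑ
  prepared m = refl , refl , refl

  revisiting : ∀ m → let c = here-context m ; σ = here-slot m ; z = Following.candidate c palindrome σ ; st = Following.stride c palindrome σ in
    here-slot (memory (prepareCode ▸ followThree) m) ≡ Following.follow c palindrome
        (Following.follow c palindrome (Following.follow c palindrome σ z) (z + st)) (z + st + st) ×
    runs (prepareCode ▸ followThree) m ≡ Following.followed c palindrome σ z ++ Following.followed c
        palindrome σ (z + st) ++ Following.followed c palindrome σ (z + st + st)
  revisiting m = let e₁ , e₂ , e₃ = prepared m in three-follows (memory prepareCode m) refl refl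
    (trans e₁ (candidate-value m)) (trans e₂ (cong₂ _+_ (candidate-value m) (stride-value m)))
    (trans e₃ (cong₂ _+_ (cong₂ _+_ (candidate-value m) (stride-value m)) (stride-value m)))

  choose-slot : ∀ b m {m′ σ} → here-slot m′ ≡ σ → here-slot (if b then m else m′) ≡ (if b then here-slot m else σ)
  choose-slot true  m e = refl
  choose-slot false m e = e

  choose-runs : ∀ b {rs rs′ : List ℕ} → rs ≡ rs′ → (if b then [] else rs) ≡ (if b then [] else rs′)
  choose-runs b refl = refl

  revisit-code : ∀ m → here-slot (memory revisitCode m) ≡ Following.revisit (here-context m) palindrome (here-slot m)
  revisit-code m = choose-slot (m 16 ≡ᵇ 0) m (proj₁ (revisiting m))

  revisit-runs : ∀ m → runs revisitCode m ≡ Following.revisited (here-context m) palindrome (here-slot m)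
  revisit-runs m = choose-runs (m 16 ≡ᵇ 0) (proj₂ (revisiting m))

  append-code : ∀ m → m 9 ≡ m 8 + m 0 → here-slot (memory appendCode m) ≡ Following.append (here-context m)
      palindrome (here-slot m) (m 8 + m 0)
  append-code m e = by-last (m 19 ≡ᵇ 0)
    where
    X = m 8 + m 0
    fresh : Memory
    fresh = (((m [ 18 ≔ X ∸ m 19 ]) [ 20 ≔ 0 ]) [ 21 ≔ m 2 ]) [ 22 ≔ 0 ]
    appended : ∀ m′ → m′ 8 + m′ 0 ≡ X → m′ 9 ≡ X →
               here-slot (memory (19 := origin +ₑ time ▸ lowerCode) m′) ≡ record (here-slot m′)
                   { least = min₀ (m′ 17) X ; last = X }
    appended m′ x≡ e′ = trans (lower-code (m′ [ 19 ≔ m′ 8 + m′ 0 ]) (≤-reflexive (trans e′ (sym x≡))))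
      (cong₂ (λ a x → record (here-slot m′) { least = min₀ (m′ 17) a ; last = x }) e′ x≡)
    by-gap : ∀ b → here-slot (memory (19 := origin +ₑ time ▸ lowerCode) (if b then fresh else m)) ≡
             (if b then slot (m 16) (min₀ (m 17) X) (X ∸ m 19) X 0 (m 2) 0 else record (here-slot m)
                 { least = min₀ (m 17) X ; last = X })
    by-gap true  = appended fresh refl e
    by-gap false = appended m refl e
    by-last : ∀ b → here-slot (memory (19 := origin +ₑ time ▸ lowerCode)
        (if b then m else (if m 18 ≡ᵇ 0 then fresh else m))) ≡
            (if b then record (here-slot m) { least = min₀ (m 17) X ; last = X }
             else (if m 18 ≡ᵇ 0 then slot (m 16) (min₀ (m 17) X) (X ∸ m 19) X 0 (m 2) 0 else record
                 (here-slot m) { least = min₀ (m 17) X ; last = X }))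
    by-last true  = appended m refl e
    by-last false = by-gap (m 18 ≡ᵇ 0)

  module Sweeping (m : Memory) where

    private
      c = here-context m
      σ = here-slot m
      X = m 8 + m 0
      m₁ m₂ : Memory
      m₁ = m [ 9 ≔ X ]
      m₂ = memory try m₁

      c₂ : here-context m₂ ≡ c
      c₂ = kept-context try m₁ tt

      append-cong : ∀ {c c′ σ σ′ x x′} → c ≡ c′ → σ ≡ σ′ → x ≡ x′ → Following.append c palindrome σ x ≡
          Following.append c′ palindrome σ′ x′
      append-cong refl refl refl = refl

      sum₂ : m₂ 8 + m₂ 0 ≡ X
      sum₂ = cong₂ _+_ (kept try m₁ 8 tt) (kept try m₁ 0 tt)

      ok : (m₂ 10 ≡ᵇ 1) ≡ Following.hit c palindrome X
      ok = trans (cong (_≡ᵇ 1) (success-value m₁)) (outcome-test (Following.hit c palindrome X))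

      tested : ∀ b → here-slot (if b then memory appendCode m₂ else m₂) ≡
          (if b then Following.append c palindrome σ X else σ)
      tested true  = trans (append-code m₂ (trans (kept try m₁ 9 tt) (sym sum₂))) (append-cong c₂ (try-slot m₁) sum₂)
      tested false = try-slot m₁

      timed : ∀ b → here-slot (if b then (if m₂ 10 ≡ᵇ 1 then memory appendCode m₂ else m₂) else m) ≡
                    (if b then (if Following.hit c palindrome X then Following.append c palindrome σ X else σ) else σ)
      timed true  = trans (tested (m₂ 10 ≡ᵇ 1)) (cong (λ b → if b then Following.append c palindrome σ X else σ) ok)
      timed false = refl

      timed-runs : ∀ b → (if b then runs (9 := origin +ₑ time ▸ try ▸ choose (success ≟ₑ lit 1) appendCode
          nop) m else [])
                   ≡ (if b then Following.attempt c palindrome X else [])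
      timed-runs true  = trans (cong (runs try m₁ ++_) (quiet-runs (choose (success ≟ₑ lit 1) appendCode nop) m₂ tt))
                               (++-identityʳ (runs try m₁))
      timed-runs false = refl

    sweep-code : here-slot (memory sweepCode m) ≡ Following.sweep c palindrome σ
    sweep-code = timed (m 0 ∸ m 8 <ᵇ 8 * m 1)

    sweep-runs : runs sweepCode m ≡ Following.swept c palindrome
    sweep-runs = timed-runs (m 0 ∸ m 8 <ᵇ 8 * m 1)

  search-code : ∀ m → here-slot (memory searchCode m) ≡ Following.search (here-context m) palindrome (here-slot m)
  search-code m with m 18 ≡ᵇ 0
  ... | true = refl
  ... | false with m 20 <ᵇ m 2 in e
  ...   | false = refl
  ...   | true with ⟦ rem ⟧ (suc (m 20) * m 18) (m 2) ≡ᵇ 0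
  ...     | true = cong (λ i → record (here-slot m) { count = i }) (m∸[m∸n]≡n (<ᵇ-true {m 20} {m 2} e))
  ...     | false with ⟦ rem ⟧ (suc (m 20) * m 18) (m 2) <ᵇ m 21
  ...       | true  = cong₂ (λ i j → slot (m 16) (m 17) (m 18) (m 19) i (⟦ rem ⟧ (suc (m 20) * m 18) (m 2)) j)
                        (m∸[m∸n]≡n (<ᵇ-true {m 20} {m 2} e)) (m∸[m∸n]≡n (<ᵇ-true {m 20} {m 2} e))
  ...       | false = cong (λ i → record (here-slot m) { count = i }) (m∸[m∸n]≡n (<ᵇ-true {m 20} {m 2} e))

  -- The interface through which the loop sees the code of a block: its effect on slot and runs
  -- depends on the context and the slot alone.
  record Performs (F : Code) (step : Context → Slot → Slot) (log : Context → Slot → List ℕ) : Set where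
    field
      slot≡    : ∀ m → here-slot (memory F m) ≡ step (here-context m) (here-slot m)
      context≡ : ∀ m → here-context (memory F m) ≡ here-context m
      runs≡    : ∀ m → runs F m ≡ log (here-context m) (here-slot m)

  performs-seq : ∀ {F G f g k l} → Performs F f k → Performs G g l →
                 Performs (F ▸ G) (λ c σ → g c (f c σ)) (λ c σ → k c σ ++ l c (f c σ))
  performs-seq {F} {G} {f} {g} {k} {l} P Q = record
    { slot≡ = λ m → trans (Q.slot≡ (memory F m)) (cong₂ g (P.context≡ m) (P.slot≡ m))
    ; context≡ = λ m → trans (Q.context≡ (memory F m)) (P.context≡ m)
    ; runs≡ = λ m → cong₂ _++_ (P.runs≡ m) (trans (Q.runs≡ (memory F m)) (cong₂ l (P.context≡ m) (P.slot≡ m))) }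
    where
    module P = Performs P
    module Q = Performs Q

  refresh-performs : Performs refreshCode (λ c → Following.refresh c palindrome) (λ _ _ → [])
  refresh-performs = record { slot≡ = refresh-code ; context≡ = λ m → kept-context refreshCode m tt
                            ; runs≡ = λ m → quiet-runs refreshCode m tt }

  revisit-performs : Performs revisitCode (λ c → Following.revisit c palindrome)
      (λ c → Following.revisited c palindrome)
  revisit-performs = record { slot≡ = revisit-code ; context≡ = λ m → kept-context revisitCode m tt
                            ; runs≡ = revisit-runs }

  sweep-performs : Performs sweepCode (λ c → Following.sweep c palindrome) (λ c _ → Following.swept c palindrome)
  sweep-performs = record { slot≡ = Sweeping.sweep-code ; context≡ = λ m → kept-context sweepCode m tt
                          ; runs≡ = Sweeping.sweep-runs }

  search-performs : Performs searchCode (λ c → Following.search c palindrome) (λ _ _ → [])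
  search-performs = record { slot≡ = search-code ; context≡ = λ m → kept-context searchCode m tt
                           ; runs≡ = λ m → quiet-runs searchCode m tt }

  advance-performs : Performs advanceCode (λ c → Following.advance c palindrome)
      (λ c → Following.attempted c palindrome)
  advance-performs = record
    { slot≡ = λ m → trans (A.slot≡ m) (sym (Following.advance≡ (here-context m) palindrome (here-slot m)))
    ; context≡ = A.context≡
    ; runs≡ = λ m → trans (A.runs≡ m) (trans (tail (here-context m) (here-slot m))
                      (sym (Following.attempted≡ (here-context m) palindrome (here-slot m)))) }
    where
    module A = Performs (performs-seq refresh-performs (performs-seq revisit-performs
        (performs-seq sweep-performs search-performs)))
    tail : ∀ c σ → Following.revisited c palindrome (Following.refresh c palindrome σ) ++ Following.swept c
        palindrome ++ [] ≡
                   Following.revisited c palindrome (Following.refresh c palindrome σ) ++ Following.swept c palindrome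
    tail c σ = cong (Following.revisited c palindrome (Following.refresh c palindrome σ) ++_)
        (++-identityʳ (Following.swept c palindrome))

  flushes-register : ∀ F m r → r < 32 → memory (flushes F) m r ≡ m r
  flushes-register zero    m r r< = refl
  flushes-register (suc F) m r r< = trans
    (update-other (memory (flushes F) m) _ _ r (<⇒≢ (<-≤-trans r< (m≤m+n 32 _)))) (flushes-register F m r r<)

  flushes-other : ∀ F m j → (∀ f → f < F → j ≢ f + m 7) → memory (flushes F) m (32 + j) ≡ m (32 + j)
  flushes-other zero    m j apart = refl
  flushes-other (suc F) m j apart = trans
    (update-other (memory (flushes F) m) _ _ (32 + j)
      (λ e → apart F ≤-refl (trans (+-cancelˡ-≡ 32 j _ e) (cong (F +_) (flushes-register F m 7 (≤ᵇ⇒≤ 8 32 tt))))))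
    (flushes-other F m j (λ f f< → apart f (m<n⇒m<1+n f<)))

  flushes-at : ∀ F m f → F ≤ 7 → f < F → memory (flushes F) m (32 + (f + m 7)) ≡ m (16 + f)
  flushes-at (suc F) m f F<7 f< with m≤n⇒m<n∨m≡n (≤-pred f<)
  ... | inj₁ f<F = trans
    (update-other (memory (flushes F) m) _ _ (32 + (f + m 7))
      (λ e → <⇒≢ f<F (+-cancelʳ-≡ (m 7) f F (trans (+-cancelˡ-≡ 32 (f + m 7) _ e)
        (cong (F +_) (flushes-register F m 7 (≤ᵇ⇒≤ 8 32 tt)))))))
    (flushes-at F m f (<⇒≤ F<7) f<F)
  ... | inj₂ refl = trans
    (cong (λ k → (memory (flushes F) m [ 32 + (F + memory (flushes F) m 7) ≔ memory (flushes F) m (16 + F)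
        ]) (32 + (F + k)))
      (sym (flushes-register F m 7 (≤ᵇ⇒≤ 8 32 tt))))
    (trans (update-same (memory (flushes F) m) (32 + (F + memory (flushes F) m 7)) _)
      (flushes-register F m (16 + F) (<-≤-trans (+-monoʳ-< 16 F<7) (≤ᵇ⇒≤ 23 32 tt))))

  slot-≡ : ∀ {a b c d e f g a′ b′ c′ d′ e′ f′ g′} → a ≡ a′ → b ≡ b′ → c ≡ c′ → d ≡ d′ → e ≡ e′ → f ≡ f′ → g ≡ g′ →
           slot a b c d e f g ≡ slot a′ b′ c′ d′ e′ f′ g′
  slot-≡ refl refl refl refl refl refl refl = refl

  flushes-slot : ∀ m → slot-at (memory (flushes 7) m) (m 7) ≡ here-slot m
  flushes-slot m = slot-≡ (at 0) (at 1) (at 2) (at 3) (at 4) (at 5) (at 6)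
    where
    at : ∀ f {_ : T (f <ᵇ 7)} → memory (flushes 7) m (32 + (f + m 7)) ≡ m (16 + f)
    at f {p} = flushes-at 7 m f ≤-refl (<ᵇ⇒< f 7 p)

  module BlockEffect (advancing : Code) {step : Context → Slot → Slot} {log : Context → Slot → List ℕ}
                     (performs : Performs advancing step log)
                     (low-kept : ∀ m r → r < 8 → memory advancing m r ≡ m r)
                     (cell-kept : ∀ m j → memory advancing m (32 + j) ≡ m (32 + j))
                     (u : ℕ) (m : Memory) where

    private
      m₁ m₂ m₃ : Memory
      m₁ = memory (locateCode u) m
      m₂ = memory fetchAll m₁
      m₃ = memory advancing m₂
      m₄ = memory (flushes 7) m₃

    slot-offset : ℕ
    slot-offset = m 4 + 8 * ⟦ rem ⟧ (⟦ quo ⟧ (m 0) (m 1) ∸ u) 8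

    block-context : Context
    block-context = context (m 0 ∸ ⟦ rem ⟧ (m 0) (m 1) ∸ u * m 1) (m 1) (m 2) (m 0) (m 5)

    private
      c₂ : here-context m₂ ≡ block-context
      c₂ = refl

      e₂ : here-slot m₂ ≡ slot-at m slot-offset
      e₂ = refl

      e₃ : here-slot m₃ ≡ step block-context (slot-at m slot-offset)
      e₃ = trans (Performs.slot≡ performs m₂) (cong₂ step c₂ e₂)

      k₃ : m₃ 7 ≡ slot-offset
      k₃ = low-kept m₂ 7 ≤-refl

      either : ∀ {A : Set} {P : A → Set} b {x y} → P x → P y → P (if b then x else y)
      either true  p q = p
      either false p q = q

      skipped : ∀ {A : Set} {a b : A} → u ≤ ⟦ quo ⟧ (m 0) (m 1) → (if ⟦ quo ⟧ (m 0) (m 1) <ᵇ u then a else b) ≡ b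
      skipped {a = a} {b} u≤ with ⟦ quo ⟧ (m 0) (m 1) <ᵇ u in e
      ... | true  = contradiction u≤ (<⇒≱ (<ᵇ-true e))
      ... | false = refl

      idle : ∀ {A : Set} {a b : A} → ¬ u ≤ ⟦ quo ⟧ (m 0) (m 1) → (if ⟦ quo ⟧ (m 0) (m 1) <ᵇ u then a else b) ≡ a
      idle {a = a} {b} u≰ with ⟦ quo ⟧ (m 0) (m 1) <ᵇ u in e
      ... | true  = refl
      ... | false = contradiction (<ᵇ-false e) u≰

    block-idle : ¬ u ≤ ⟦ quo ⟧ (m 0) (m 1) → memory (blockWith advancing u) m ≡ m
    block-idle u≰ = idle {a = m} {b = m₄} u≰

    block-slot : u ≤ ⟦ quo ⟧ (m 0) (m 1) →
                 slot-at (memory (blockWith advancing u) m) slot-offset ≡ step block-context (slot-at m slot-offset)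
    block-slot u≤ = trans (cong (λ m′ → slot-at m′ slot-offset) (skipped {a = m} {b = m₄} u≤))
      (trans (cong (slot-at m₄) (sym k₃)) (trans (flushes-slot m₃) e₃))

    block-runs : u ≤ ⟦ quo ⟧ (m 0) (m 1) → runs (blockWith advancing u) m ≡ log block-context (slot-at m slot-offset)
    block-runs u≤ = trans (skipped {a = []} {b = runs advancing m₂ ++ runs (flushes 7) m₃} u≤)
      (trans (cong (runs advancing m₂ ++_) (quiet-runs (flushes 7) m₃ tt))
        (trans (++-identityʳ (runs advancing m₂)) (trans (Performs.runs≡ performs m₂) (cong₂ log c₂ e₂))))

    block-other : ∀ j → (∀ f → f < 7 → j ≢ f + slot-offset) → memory (blockWith advancing u) m (32 + j) ≡ m (32 + j)
    block-other j apart = either {P = λ m′ → m′ (32 + j) ≡ m (32 + j)} (⟦ quo ⟧ (m 0) (m 1) <ᵇ u) {m} {m₄} refl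
      (trans (flushes-other 7 m₃ j (λ f f< e → apart f f< (trans e (cong (f +_) k₃)))) (cell-kept m₂ j))

    block-register : ∀ r → r < 7 → memory (blockWith advancing u) m r ≡ m r
    block-register r r< = either {P = λ m′ → m′ r ≡ m r} (⟦ quo ⟧ (m 0) (m 1) <ᵇ u) {m} {m₄} refl
      (trans (flushes-register 7 m₃ r (<-≤-trans r< (≤ᵇ⇒≤ 7 32 tt))) (trans (low-kept m₂ r (m<n⇒m<1+n r<)) (low r r<)))
      where
      low : ∀ r → r < 7 → m₂ r ≡ m r
      low 0 _ = refl
      low 1 _ = refl
      low 2 _ = refl
      low 3 _ = refl
      low 4 _ = refl
      low 5 _ = refl
      low 6 _ = refl
      low (suc (suc (suc (suc (suc (suc (suc _))))))) r<7 = contradiction r<7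
          (λ { (s≤s (s≤s (s≤s (s≤s (s≤s (s≤s (s≤s ()))))))) })

  advance-low : ∀ m r → r < 8 → memory advanceCode m r ≡ m r
  advance-low m 0 _ = kept advanceCode m 0 tt
  advance-low m 1 _ = kept advanceCode m 1 tt
  advance-low m 2 _ = kept advanceCode m 2 tt
  advance-low m 3 _ = kept advanceCode m 3 tt
  advance-low m 4 _ = kept advanceCode m 4 tt
  advance-low m 5 _ = kept advanceCode m 5 tt
  advance-low m 6 _ = kept advanceCode m 6 tt
  advance-low m 7 _ = kept advanceCode m 7 tt
  advance-low m (suc (suc (suc (suc (suc (suc (suc (suc _)))))))) r<8 =
    contradiction r<8 (λ { (s≤s (s≤s (s≤s (s≤s (s≤s (s≤s (s≤s (s≤s ())))))))) })

  advance-cell : ∀ m j → memory advanceCode m (32 + j) ≡ m (32 + j)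
  advance-cell m j = kept advanceCode m (32 + j) tt

-- Landmarks

abstract

  2^>0 : ∀ n → 0 < 2 ^ n
  2^>0 n = m^n>0 2 n

quo-lower : ∀ h g → 0 < g → ⟦ quo ⟧ h g * g ≤ h
quo-lower h g@(suc _) _ = m/n*n≤m h g

quo-upper : ∀ h g → 0 < g → h < g + ⟦ quo ⟧ h g * g
quo-upper h g@(suc _) _ = subst (_< g + h / g * g) (sym (m≡m%n+[m/n]*n h g)) (+-monoˡ-< (h / g * g) (m%n<n h g))

quo-mono : ∀ {h k} g → h ≤ k → ⟦ quo ⟧ h g ≤ ⟦ quo ⟧ k g
quo-mono zero    h≤k = z≤n
quo-mono (suc g) h≤k = /-monoˡ-≤ (suc g) h≤k

rem-quo : ∀ h g → 0 < g → h ≡ ⟦ rem ⟧ h g + ⟦ quo ⟧ h g * g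
rem-quo h g@(suc _) _ = m≡m%n+[m/n]*n h g

rem-∣ : ∀ x g → 0 < g → ⟦ rem ⟧ x g ≡ 0 → g ∣ x
rem-∣ x g@(suc _) _ = m%n≡0⇒n∣m x g

∣-rem : ∀ x g → 0 < g → g ∣ x → ⟦ rem ⟧ x g ≡ 0
∣-rem x g@(suc _) _ = n∣m⇒m%n≡0 x g

n<2^n : ∀ n → n < 2 ^ n
n<2^n zero    = z<s
n<2^n (suc n) = (lin (n ∷ (2 ^ n) ∷ []) 1 ((1 , con 1 ⊕ # 0 , # 1) ∷ (1 , con 1 ⊕ con 0 , # 1) ∷ [])
    (con 1 ⊕ (con 1 ⊕ # 0)) (2 ⊛ (# 1)) (n<2^n n) (2^>0 n))

-- The least x such that x - h can be a landmark at time h of the level with the given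
-- spacing g and size.
limitOf : (g size h : ℕ) → ℕ
limitOf g size h = h + g * (⟦ quo ⟧ h g + 1 ∸ size)

limitOf-mono : ∀ {g size h k} → h ≤ k → limitOf g size h ≤ limitOf g size k
limitOf-mono {g} {size} h≤k = +-mono-≤ h≤k (*-monoʳ-≤ g (∸-monoˡ-≤ size (+-monoˡ-≤ 1 (quo-mono g h≤k))))

limitOf-≥ : ∀ {g size} h → h ≤ limitOf g size h
limitOf-≥ h = m≤m+n h _

limitOf-intro : ∀ {g size h t} → 0 < g → g ∣ t → h < t + size * g → limitOf g size h ≤ t + h
limitOf-intro {g} {size} {h} {t} 0<g (divides k refl) h< =
  subst (_≤ k * g + h) (+-comm (g * (q + 1 ∸ size)) h)
    (+-monoˡ-≤ h (subst (g * (q + 1 ∸ size) ≤_) (*-comm g k) (*-monoʳ-≤ g (m≤n+o⇒m∸n≤o (q + 1) size q<))))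
  where
  q = ⟦ quo ⟧ h g
  bound′ : q < k + size
  bound′ = *-cancelʳ-< g q (k + size) (≤-<-trans (quo-lower h g 0<g)
      (<-≤-trans h< (≤-reflexive (sym (*-distribʳ-+ g k size)))))
  q< : q + 1 ≤ size + k
  q< = (lin (q ∷ k ∷ size ∷ []) 1 ((1 , con 1 ⊕ # 0 , # 1 ⊕ # 2) ∷ []) (# 0 ⊕ con 1) (# 2 ⊕ # 1) bound′)

limitOf-elim : ∀ {g size h k} → 0 < g → limitOf g size h ≤ k * g + h → ⟦ quo ⟧ h g < k + size
limitOf-elim {g} {size} {h} {k} 0<g le = (lin (q ∷ size ∷ (q + 1 ∸ size) ∷ k ∷ []) 1
    ((1 , # 0 ⊕ con 1 , # 1 ⊕ # 2) ∷ (1 , # 2 , # 3) ∷ []) (con 1 ⊕ # 0) (# 3 ⊕ # 1) (m≤n+m∸n (q + 1) size) r≤k)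
  where
  q = ⟦ quo ⟧ h g
  r≤k : q + 1 ∸ size ≤ k
  r≤k = *-cancelˡ-≤ g {{>-nonZero 0<g}} (+-cancelˡ-≤ h _ _ (≤-trans le
      (≤-reflexive (trans (+-comm (k * g) h) (cong (h +_) (*-comm k g))))))

module Sizes (w : ℕ) (S : Scheme) where

  sizeOf : ℕ → ℕ
  sizeOf ℓ = if ℓ <ᵇ L S then saturate w [ b S ] else saturate w (bᴸ S)

  sizeOf≡ : ∀ ℓ → sizeOf ℓ ≡ saturate w (size S ℓ)
  sizeOf≡ ℓ with ℓ <ᵇ L S
  ... | true  = refl
  ... | false = refl

  below-saturate : ∀ {i} s → i < saturate w s → [ i ] <⁺ s
  below-saturate {i} [ s ] l< = [ <-≤-trans l< (m⊓n≤m s _) ]<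
  below-saturate {i} ⊤⁺    l< = [ i ]<⊤⁺

  -- Indices of landmarks are at most `h` and hence below the largest word, so cutting off a huge or
  -- infinite size loses no landmark.
  saturate-below : ∀ {i s} → i < 2 ^ w ∸ 1 → [ i ] <⁺ s → i < saturate w s
  saturate-below i< [ l< ]<   = ⊓-pres-m< l< i<
  saturate-below i< [ i ]<⊤⁺  = i<

  saturate-≥ : ∀ {k s} → k ≤ 2 ^ w ∸ 1 → [ k ] ≤⁺ s → k ≤ saturate w s
  saturate-≥ k≤ [ le ]≤    = ⊓-glb le k≤
  saturate-≥ k≤ (_ ≤⊤⁺)    = k≤

  limit : ℕ → ℕ → ℕ
  limit ℓ = limitOf (2 ^ ℓ) (sizeOf ℓ)

  abstract

    limit-mono : ∀ ℓ {h k} → h ≤ k → limit ℓ h ≤ limit ℓ k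
    limit-mono ℓ = limitOf-mono {2 ^ ℓ} {sizeOf ℓ}

    limit-≥ : ∀ ℓ h → h ≤ limit ℓ h
    limit-≥ ℓ = limitOf-≥ {2 ^ ℓ} {sizeOf ℓ}

  private
    q≡ : ∀ ℓ h → (h / 2 ^ ℓ) {{m^n≢0 2 ℓ}} ≡ ⟦ quo ⟧ h (2 ^ ℓ)
    q≡ ℓ h = sym (quo-NonZero h (2 ^ ℓ) {{m^n≢0 2 ℓ}})

  in-level : ∀ ℓ h t → 2 ^ ℓ ∣ t → t ≤ h → limit ℓ h ≤ t + h → InLevel S ℓ h t
  in-level ℓ h t (divides k refl) t≤h lim =
    q ∸ k , below-saturate (size S ℓ) (subst (q ∸ k <_) (sizeOf≡ ℓ) q-k<) , m∸n≤m q k ,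
    trans (*-comm k (2 ^ ℓ)) (cong (2 ^ ℓ *_) (sym (m∸[m∸n]≡n k≤q)))
    where
    q = (h / 2 ^ ℓ) {{m^n≢0 2 ℓ}}
    k≤q : k ≤ q
    k≤q = subst (k ≤_) (sym (q≡ ℓ h)) (≤-pred (*-cancelʳ-< (2 ^ ℓ) k _ (≤-<-trans t≤h (quo-upper h (2 ^ ℓ) (2^>0 ℓ)))))
    q< : q < k + sizeOf ℓ
    q< = subst (_< k + sizeOf ℓ) (sym (q≡ ℓ h)) (limitOf-elim {k = k} (2^>0 ℓ) lim)
    q-k< : q ∸ k < sizeOf ℓ
    q-k< = +-cancelˡ-< k _ _ (subst (_< k + sizeOf ℓ) (sym (m+[n∸m]≡n k≤q)) q<)

  record Level (ℓ h t : ℕ) : Set where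
    field
      divisible : 2 ^ ℓ ∣ t
      t≤h       : t ≤ h
      near      : h < t + sizeOf ℓ * 2 ^ ℓ

  level-of : ∀ ℓ h t → h < 2 ^ w ∸ 1 → InLevel S ℓ h t → Level ℓ h t
  level-of ℓ h t h< (i , i< , i≤q , t≡) = record
    { divisible = subst (2 ^ ℓ ∣_) (sym t≡) (m∣m*n (q ∸ i))
    ; t≤h = ≤-trans t≤qg (subst (λ q → q * 2 ^ ℓ ≤ h) (sym (q≡ ℓ h)) (quo-lower h (2 ^ ℓ) (2^>0 ℓ)))
    ; near = <-≤-trans (subst (λ q → h < 2 ^ ℓ + q * 2 ^ ℓ) (sym (q≡ ℓ h)) (quo-upper h (2 ^ ℓ) (2^>0 ℓ)))
        (≤-trans (*-monoˡ-≤ (2 ^ ℓ) q<) (≤-reflexive (trans (*-distribʳ-+ (2 ^ ℓ) (q ∸ i) (sizeOf ℓ))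
          (cong (_+ sizeOf ℓ * 2 ^ ℓ) (trans (*-comm (q ∸ i) (2 ^ ℓ)) (sym t≡)))))) }
    where
    q = (h / 2 ^ ℓ) {{m^n≢0 2 ℓ}}
    q≤h : q ≤ h
    q≤h = m/n≤m h (2 ^ ℓ) {{m^n≢0 2 ℓ}}
    i<size : i < sizeOf ℓ
    i<size = subst (i <_) (sym (sizeOf≡ ℓ)) (saturate-below (≤-<-trans (≤-trans i≤q q≤h) h<) i<)
    q< : suc q ≤ q ∸ i + sizeOf ℓ
    q< = (lin ((q ∸ i) ∷ i ∷ q ∷ (sizeOf ℓ) ∷ []) 1 ((1 , # 2 , # 0 ⊕ # 1) ∷ (1 , con 1 ⊕ # 1 , # 3) ∷ [])
        (con 1 ⊕ # 2) (# 0 ⊕ # 3) (≤-reflexive (sym (m∸n+n≡m i≤q))) i<size)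
    t≤qg : t ≤ q * 2 ^ ℓ
    t≤qg = subst (_≤ q * 2 ^ ℓ) (sym t≡) (subst (2 ^ ℓ * (q ∸ i) ≤_) (*-comm (2 ^ ℓ) q) (*-monoʳ-≤ (2 ^ ℓ) (m∸n≤m q i)))

-- Pairs of a scale 2 ^ m and a level ℓ are visited along a staircase.

2^-∣ : ∀ {a b} → a ≤ b → 2 ^ a ∣ 2 ^ b
2^-∣ {a} {b} a≤b = divides (2 ^ (b ∸ a)) (trans (cong (2 ^_) (sym (m∸n+n≡m a≤b))) (^-distribˡ-+-* 2 (b ∸ a) a))

module Walk (L : ℕ) (sizeOf : ℕ → ℕ) (large : ∀ ℓ → ℓ ≤ L → 12 ≤ sizeOf ℓ) where

  -- The distances served at a scale are less than 16 times the scale. The level is raised if it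
  -- does not reach that far, and otherwise the scale is doubled.
  next : ℕ × ℕ → ℕ × ℕ
  next (m , ℓ) = if ℓ <ᵇ L then (if sizeOf ℓ <ᵇ ⟦ quo ⟧ (16 * 2 ^ m) (2 ^ ℓ) then (m , suc ℓ) else
      (suc m , ℓ)) else (suc m , ℓ)

  walk : ℕ → ℕ × ℕ
  walk zero      = 0 , 0
  walk (suc idx) = next (walk idx)

  -- Each step raises exactly one coordinate by 1, so the index is their sum. It is thereby
  -- logarithmic, and each pair finds its own storage again at the next character.
  record Valid (idx : ℕ) (p : ℕ × ℕ) : Set where
    field
      total : proj₁ p + proj₂ p ≡ idx
      ℓ≤L   : proj₂ p ≤ L
      ℓ≤sm  : proj₂ p ≤ suc (proj₁ p)

  data Step (m ℓ : ℕ) : ℕ × ℕ → Set where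
    up    : ℓ < L → ℓ ≤ m → sizeOf ℓ < ⟦ quo ⟧ (16 * 2 ^ m) (2 ^ ℓ) → Step m ℓ (m , suc ℓ)
    along : (ℓ < L → ⟦ quo ⟧ (16 * 2 ^ m) (2 ^ ℓ) ≤ sizeOf ℓ) → Step m ℓ (suc m , ℓ)

  -- If `ℓ` exceeded `m`, then 16 scales would be at most 8 spacings, which is within the reach of a
  -- level with at least 12 landmarks.
  up-level : ∀ m ℓ → ℓ ≤ L → sizeOf ℓ < ⟦ quo ⟧ (16 * 2 ^ m) (2 ^ ℓ) → ℓ ≤ m
  up-level m ℓ ℓ≤L big = ≮⇒≥ (λ m<ℓ → <⇒≱ (<-≤-trans (*-monoˡ-< (2 ^ ℓ) {{m^n≢0 2 ℓ}} (≤-<-trans (large ℓ ℓ≤L) big))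
            (quo-lower (16 * 2 ^ m) (2 ^ ℓ) (2^>0 ℓ)))
            (lin ((2 ^ m) ∷ (2 ^ ℓ) ∷ []) 1 ((8 , 2 ⊛ (# 0) , # 1) ∷ []) (16 ⊛ (# 0)) (12 ⊛ (# 1)) (^-monoʳ-≤ 2 m<ℓ)))

  step : ∀ m ℓ → ℓ ≤ L → Step m ℓ (next (m , ℓ))
  step m ℓ ℓ≤L with ℓ <ᵇ L in e
  ... | false = along (λ ℓ<L → contradiction ℓ<L (≤⇒≯ (<ᵇ-false {ℓ} {L} e)))
  ... | true with sizeOf ℓ <ᵇ ⟦ quo ⟧ (16 * 2 ^ m) (2 ^ ℓ) in e′
  ...   | true  = up (<ᵇ-true {ℓ} {L} e) (up-level m ℓ ℓ≤L big) big
    where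
    big = <ᵇ-true {sizeOf ℓ} {⟦ quo ⟧ (16 * 2 ^ m) (2 ^ ℓ)} e′
  ...   | false = along (λ _ → <ᵇ-false {sizeOf ℓ} e′)

  valid-next : ∀ {idx m ℓ p} → Valid idx (m , ℓ) → Step m ℓ p → Valid (suc idx) p
  valid-next {m = m} {ℓ} V (up ℓ<L ℓ≤m _) = record
    { total = trans (+-suc m ℓ) (cong suc (Valid.total V)) ; ℓ≤L = ℓ<L ; ℓ≤sm = s≤s ℓ≤m }
  valid-next V (along _) = record
    { total = cong suc (Valid.total V) ; ℓ≤L = Valid.ℓ≤L V ; ℓ≤sm = m≤n⇒m≤1+n (Valid.ℓ≤sm V) }

  valid : ∀ idx → Valid idx (walk idx)
  valid zero      = record { total = refl ; ℓ≤L = z≤n ; ℓ≤sm = z≤n }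
  valid (suc idx) = valid-next (valid idx) (step _ _ (Valid.ℓ≤L (valid idx)))

  next-grows : ∀ {m ℓ p} → Step m ℓ p → m ≤ proj₁ p
  next-grows (up _ _ _)  = ≤-refl
  next-grows (along _) = n≤1+n _

  walk-grows : ∀ {i j} → i ≤ j → proj₁ (walk i) ≤ proj₁ (walk j)
  walk-grows {i} {zero}  z≤n = ≤-refl
  walk-grows {i} {suc j} i≤ with m≤n⇒m<n∨m≡n i≤
  ... | inj₁ i<  = ≤-trans (walk-grows (≤-pred i<)) (next-grows (step _ _ (Valid.ℓ≤L (valid j))))
  ... | inj₂ refl = ≤-refl

  -- By `wide` the staircase does not rise above `ℓ` before scale `m`, and by `narrow` it does not
  -- pass scale `m` below `ℓ`. It stays in the rectangle and must arrive at its corner.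
  module Reach (m ℓ : ℕ) (ℓ≤L : ℓ ≤ L) (wide : 8 * 2 ^ m ≤ sizeOf ℓ * 2 ^ ℓ)
               (narrow : ∀ k → k < ℓ → sizeOf k * 2 ^ k < 16 * 2 ^ m) where

    In : ℕ × ℕ → Set
    In (m′ , ℓ′) = m′ ≤ m × ℓ′ ≤ ℓ

    stays : ∀ {m′ ℓ′ p} → m′ ≤ m → ℓ′ ≤ ℓ → ℓ′ ≤ suc m′ → m′ + ℓ′ < m + ℓ → Step m′ ℓ′ p → In p
    stays {m′} {ℓ′} m′≤ ℓ′≤ _ l< (up _ _ big) = m′≤ , ≤∧≢⇒< ℓ′≤ not-top
      where
      not-top : ℓ′ ≢ ℓ
      not-top refl = <⇒≱ (<-≤-trans (*-monoˡ-< (2 ^ ℓ) {{m^n≢0 2 ℓ}} big) (quo-lower (16 * 2 ^ m′) (2 ^ ℓ) (2^>0 ℓ)))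
        (≤-trans (lin ((2 ^ m′) ∷ (2 ^ m) ∷ []) 1 ((8 , 2 ⊛ (# 0) , # 1) ∷ []) (16 ⊛ (# 0)) (8 ⊛ (# 1))
            (^-monoʳ-≤ 2 m′<m)) wide)
        where
        m′<m : m′ < m
        m′<m = +-cancelʳ-< ℓ m′ m l<
    stays {m′} {ℓ′} m′≤ ℓ′≤ ℓ′≤sm l< (along small) = ≤∧≢⇒< m′≤ not-last , ℓ′≤
      where
      not-last : m′ ≢ m
      not-last refl = <⇒≱ (narrow ℓ′ ℓ′<ℓ) (≤-trans (≤-reflexive (sym exact))
          (*-monoˡ-≤ (2 ^ ℓ′) (small (<-≤-trans ℓ′<ℓ ℓ≤L))))
        where
        ℓ′<ℓ : ℓ′ < ℓ
        ℓ′<ℓ = +-cancelˡ-< m ℓ′ ℓ l<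
        -- No rounding occurs, since `ℓ′ ≤ suc m` makes the spacing a divisor of 16 scales.
        exact : ⟦ quo ⟧ (16 * 2 ^ m) (2 ^ ℓ′) * 2 ^ ℓ′ ≡ 16 * 2 ^ m
        exact = trans (cong (_* 2 ^ ℓ′) (quo-NonZero (16 * 2 ^ m) (2 ^ ℓ′) {{m^n≢0 2 ℓ′}})) (m/n*n≡m {{m^n≢0 2 ℓ′}}
          (∣-trans (2^-∣ ℓ′≤sm) (divides 8 (lin≡ ((2 ^ m) ∷ []) [] (16 ⊛ (# 0)) (8 ⊛ (2 ⊛ (# 0)))))))

    inside : ∀ idx → idx ≤ m + ℓ → In (walk idx)
    inside zero      _  = z≤n , z≤n
    inside (suc idx) le = stays (proj₁ prior) (proj₂ prior) (Valid.ℓ≤sm V)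
        (subst (_< m + ℓ) (sym (Valid.total V)) le) (step _ _ (Valid.ℓ≤L V))
      where
      V = valid idx
      prior = inside idx (<⇒≤ le)

    reached : walk (m + ℓ) ≡ (m , ℓ)
    reached = same (walk (m + ℓ)) (inside (m + ℓ) ≤-refl) (Valid.total (valid (m + ℓ)))
      where
      same : ∀ p → In p → proj₁ p + proj₂ p ≡ m + ℓ → p ≡ (m , ℓ)
      same (m′ , ℓ′) (m′≤ , ℓ′≤) e = cong₂ _,_
        (≤-antisym (lin (ℓ′ ∷ ℓ ∷ m′ ∷ m ∷ []) 1 ((1 , # 2 , # 3) ∷ []) (# 2) (# 3) m′≤)
            (lin (ℓ′ ∷ ℓ ∷ m′ ∷ m ∷ []) 1 ((1 , # 0 , # 1) ∷ (1 , # 3 ⊕ # 1 , # 2 ⊕ # 0) ∷ []) (# 3) (# 2)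
            ℓ′≤ (≤-reflexive (sym e))))
        (≤-antisym (lin (ℓ′ ∷ ℓ ∷ m′ ∷ m ∷ []) 1 ((1 , # 0 , # 1) ∷ []) (# 0) (# 1) ℓ′≤)
            (lin (ℓ′ ∷ ℓ ∷ m′ ∷ m ∷ []) 1 ((1 , # 3 ⊕ # 1 , # 2 ⊕ # 0) ∷ (1 , # 2 , # 3) ∷ []) (# 1) (# 0)
            (≤-reflexive (sym e)) m′≤))

-- Searches

least-below : ∀ {P : ℕ → Set} → (∀ k → Dec (P k)) → ∀ n → P n → ∃[ k ] k ≤ n × P k × (∀ j → j < k → ¬ P j)
least-below P? zero    p = 0 , z≤n , p , λ _ ()
least-below {P} P? (suc n) p with P? 0
... | yes p₀ = 0 , z≤n , p₀ , λ _ ()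
... | no ¬p₀ = let k , k≤n , pk , below = least-below (λ j → P? (suc j)) n p in
  suc k , s≤s k≤n , pk , λ { zero _ → ¬p₀ ; (suc j) (s≤s j<k) → below j j<k }

power-between : ∀ D → 8 ≤ D → ∃[ m ] 8 * 2 ^ m ≤ D × D < 16 * 2 ^ m
power-between D 8≤D = let m , _ , D< , below = least-below (λ m → D <? 16 * 2 ^ m) D (<-≤-trans (n<2^n D) (m≤n*m (2 ^ D) 16)) in
  m , lower m below , D<
  where
  lower : ∀ m → (∀ j → j < m → ¬ D < 16 * 2 ^ j) → 8 * 2 ^ m ≤ D
  lower zero    below = 8≤D
  lower (suc m) below = (lin ((2 ^ m) ∷ D ∷ []) 1 ((1 , 16 ⊛ (# 0) , # 1) ∷ []) (8 ⊛ (2 ⊛ (# 0))) (# 1)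
      (≮⇒≥ (below m ≤-refl)))

-- Palindromes as lists

module _ {σ : ℕ} where

  nth : List (Fin σ) → ℕ → ℕ
  nth []       _       = 0
  nth (x ∷ xs) zero    = toℕ x
  nth (x ∷ xs) (suc i) = nth xs i

  nth-++ˡ : ∀ xs {ys i} → i < length xs → nth (xs ++ ys) i ≡ nth xs i
  nth-++ˡ (x ∷ xs) {i = zero}  _         = refl
  nth-++ˡ (x ∷ xs) {i = suc i} (s≤s i<) = nth-++ˡ xs i<

  nth-last : ∀ xs x → nth (xs ++ x ∷ []) (length xs) ≡ toℕ x
  nth-last []       x = refl
  nth-last (_ ∷ xs) x = nth-last xs x

  nth-reverse : ∀ xs i j → suc (i + j) ≡ length xs → nth (reverse xs) i ≡ nth xs j
  nth-reverse (x ∷ xs) i zero e = begin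
    nth (reverse (x ∷ xs)) i                               ≡⟨ cong₂ nth (unfold-reverse x xs) i≡ ⟩
    nth (reverse xs ++ x ∷ []) (length (reverse xs))       ≡⟨ nth-last (reverse xs) x ⟩
    toℕ x                                                  ∎
    where
    open ≡-Reasoning
    i≡ : i ≡ length (reverse xs)
    i≡ = trans (sym (+-identityʳ i)) (trans (suc-injective e) (sym (length-reverse xs)))
  nth-reverse (x ∷ xs) i (suc j) e = begin
    nth (reverse (x ∷ xs)) i      ≡⟨ cong (λ ys → nth ys i) (unfold-reverse x xs) ⟩
    nth (reverse xs ++ x ∷ []) i  ≡⟨ nth-++ˡ (reverse xs) (subst (i <_) (sym (length-reverse xs))
        (lin (i ∷ j ∷ (length xs) ∷ []) 1 ((1 , con 1 ⊕ (# 0 ⊕ (con 1 ⊕ # 1)) , con 1 ⊕ # 2) ∷ [])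
        (con 1 ⊕ # 0) (# 2) (≤-reflexive e))) ⟩
    nth (reverse xs) i            ≡⟨ nth-reverse xs i j (lin≡ (i ∷ j ∷ (length xs) ∷ [])
        ((1 , con 1 ⊕ (# 0 ⊕ (con 1 ⊕ # 1)) , con 1 ⊕ # 2) ∷ []) (con 1 ⊕ (# 0 ⊕ # 1)) (# 2) e) ⟩
    nth xs j                      ∎
    where open ≡-Reasoning

  nth-extensional : ∀ xs ys → length xs ≡ length ys → (∀ i → i < length xs → nth xs i ≡ nth ys i) → xs ≡ ys
  nth-extensional []       []       _ _ = refl
  nth-extensional (x ∷ xs) (y ∷ ys) e f =
    cong₂ _∷_ (toℕ-injective (f 0 z<s)) (nth-extensional xs ys (suc-injective e) (λ i i< → f (suc i) (s≤s i<)))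

  palindrome-nth : ∀ {xs} → Palindrome xs → ∀ i j → suc (i + j) ≡ length xs → nth xs i ≡ nth xs j
  palindrome-nth {xs} P i j e = trans (cong (λ ys → nth ys i) P) (nth-reverse xs i j e)

  nth-palindrome : ∀ {xs} → (∀ i j → suc (i + j) ≡ length xs → nth xs i ≡ nth xs j) → Palindrome xs
  nth-palindrome {xs} f = nth-extensional xs (reverse xs) (sym (length-reverse xs)) λ i i< →
    let j = length xs ∸ suc i
        e = trans (cong suc refl) (m+[n∸m]≡n i<)
    in trans (f i j e) (sym (nth-reverse xs i j e))

  nth-drop : ∀ t xs i → nth (drop t xs) i ≡ nth xs (t + i)
  nth-drop zero    xs       i = refl
  nth-drop (suc t) []       i = refl
  nth-drop (suc t) (x ∷ xs) i = nth-drop t xs i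

  nth-take : ∀ k xs {i} → i < k → nth (take k xs) i ≡ nth xs i
  nth-take (suc k) []       _                = refl
  nth-take (suc k) (x ∷ xs) {zero}  _        = refl
  nth-take (suc k) (x ∷ xs) {suc i} (s≤s i<) = nth-take k xs i<

module _ {σ n : ℕ} (text : Text σ n) where

  letter : ℕ → ℕ
  letter = nth (toList text)

  open Words letter

  module _ {t h : ℕ} (t≤h : t ≤ h) (h≤n : h ≤ n) where

    length-factor : length (factor text t h) ≡ h ∸ t
    length-factor = trans (length-take (h ∸ t) (drop t (toList text)))
      (m≤n⇒m⊓n≡m (subst (h ∸ t ≤_) (sym (trans (length-drop t (toList text))
          (cong (_∸ t) (length-toList text)))) (∸-monoˡ-≤ t h≤n)))

    nth-factor : ∀ {i} → i < h ∸ t → nth (factor text t h) i ≡ letter (t + i)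
    nth-factor {i} i< = trans (nth-take (h ∸ t) (drop t (toList text)) i<) (nth-drop t (toList text) i)

    factor-palindrome : Pal (t + h) h → Palindrome (factor text t h)
    factor-palindrome P = nth-palindrome λ i j e → let e′ = trans e length-factor in
      trans (nth-factor (lin (i ∷ j ∷ (h ∸ t) ∷ []) 1 ((1 , con 1 ⊕ (# 0 ⊕ # 1) , # 2) ∷ []) (con 1 ⊕ # 0)
          (# 2) (≤-reflexive e′)))
        (trans (P (t + i) (t + j) (lin≡ (i ∷ j ∷ (h ∸ t) ∷ t ∷ h ∷ [])
            ((1 , con 1 ⊕ (# 0 ⊕ # 1) , # 2) ∷ (1 , # 2 ⊕ # 3 , # 4) ∷ [])
            (con 1 ⊕ ((# 3 ⊕ # 0) ⊕ (# 3 ⊕ # 1))) (# 3 ⊕ # 4) e′ (m∸n+n≡m t≤h))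
                  (lin (i ∷ j ∷ (h ∸ t) ∷ t ∷ h ∷ []) 1 ((1 , con 1 ⊕ (# 0 ⊕ # 1) , # 2) ∷
                      (1 , # 2 ⊕ # 3 , # 4) ∷ []) (con 1 ⊕ (# 3 ⊕ # 0)) (# 4) (≤-reflexive e′)
                      (≤-reflexive (m∸n+n≡m t≤h)))
                  (lin (i ∷ j ∷ (h ∸ t) ∷ t ∷ h ∷ []) 1 ((1 , con 1 ⊕ (# 0 ⊕ # 1) , # 2) ∷
                      (1 , # 2 ⊕ # 3 , # 4) ∷ []) (con 1 ⊕ (# 3 ⊕ # 1)) (# 4) (≤-reflexive e′)
                      (≤-reflexive (m∸n+n≡m t≤h))))
          (sym (nth-factor (lin (i ∷ j ∷ (h ∸ t) ∷ []) 1 ((1 , con 1 ⊕ (# 0 ⊕ # 1) , # 2) ∷ [])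
              (con 1 ⊕ # 1) (# 2) (≤-reflexive e′)))))

    palindrome-factor : Palindrome (factor text t h) → Pal (t + h) h
    palindrome-factor P u v e u<h v<h = begin
      letter u                   ≡⟨ cong letter (m+[n∸m]≡n t≤u) ⟨
      letter (t + (u ∸ t))       ≡⟨ nth-factor (∸-monoˡ-< u<h t≤u) ⟨
      nth (factor text t h) (u ∸ t) ≡⟨ palindrome-nth {xs = factor text t h} P (u ∸ t) (v ∸ t)
          (trans total (sym length-factor)) ⟩
      nth (factor text t h) (v ∸ t) ≡⟨ nth-factor (∸-monoˡ-< v<h t≤v) ⟩
      letter (t + (v ∸ t))       ≡⟨ cong letter (m+[n∸m]≡n t≤v) ⟩
      letter v                   ∎
      where
      open ≡-Reasoning
      t≤u : t ≤ u
      t≤u = (lin (u ∷ v ∷ t ∷ h ∷ []) 1 ((1 , # 2 ⊕ # 3 , con 1 ⊕ (# 0 ⊕ # 1)) ∷ (1 , con 1 ⊕ # 1 , # 3) ∷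
          []) (# 2) (# 0) (≤-reflexive (sym e)) v<h)
      t≤v : t ≤ v
      t≤v = (lin (u ∷ v ∷ t ∷ h ∷ []) 1 ((1 , # 2 ⊕ # 3 , con 1 ⊕ (# 0 ⊕ # 1)) ∷ (1 , con 1 ⊕ # 0 , # 3) ∷
          []) (# 2) (# 1) (≤-reflexive (sym e)) u<h)
      total : suc (u ∸ t + (v ∸ t)) ≡ h ∸ t
      total = (lin≡ (u ∷ v ∷ t ∷ h ∷ (u ∸ t) ∷ (v ∸ t) ∷ (h ∸ t) ∷ [])
          ((1 , con 1 ⊕ (# 0 ⊕ # 1) , # 2 ⊕ # 3) ∷ (1 , # 4 ⊕ # 2 , # 0) ∷ (1 , # 5 ⊕ # 2 , # 1) ∷
          (1 , # 3 , # 6 ⊕ # 2) ∷ []) (con 1 ⊕ (# 4 ⊕ # 5)) (# 6) e (m∸n+n≡m t≤u) (m∸n+n≡m t≤v) (sym (m∸n+n≡m t≤h)))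

  centre-even : ∀ {x} → 2 ∣ x → 2 * centre x ≡ x + 2
  centre-even (divides k refl) = begin
    2 * (1 + k * 2 / 2) ≡⟨ cong (λ q → 2 * (1 + q)) (m*n/n≡m k 2) ⟩
    2 * (1 + k)         ≡⟨ *-distribˡ-+ 2 1 k ⟩
    2 + 2 * k           ≡⟨ +-comm 2 (2 * k) ⟩
    2 * k + 2           ≡⟨ cong (_+ 2) (*-comm 2 k) ⟩
    k * 2 + 2           ∎
    where open ≡-Reasoning

  module _ {x h : ℕ} (2∣x : 2 ∣ x) (h≤x : h ≤ x) (x≤2h : x ≤ h + h) (h≤n : h ≤ n) where

    private
      start≡ : 2 * centre x ∸ h ∸ 2 ≡ x ∸ h
      start≡ = trans (cong (λ c → c ∸ h ∸ 2) (centre-even 2∣x))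
        (trans (∸-+-assoc (x + 2) h 2) (trans (cong (x + 2 ∸_) (+-comm h 2))
          (trans (sym (∸-+-assoc (x + 2) 2 h)) (cong (_∸ h) (m+n∸n≡m x 2)))))
      t≤h : x ∸ h ≤ h
      t≤h = m≤n+o⇒m∸n≤o x h x≤2h

    succeeds⇒pal : Succeeds text h (centre x) → Pal x h
    succeeds⇒pal P = subst (λ y → Pal y h) (m∸n+n≡m h≤x)
      (palindrome-factor t≤h h≤n (subst (λ t → Palindrome (factor text t h)) start≡ P))

    pal⇒succeeds : Pal x h → Succeeds text h (centre x)
    pal⇒succeeds P = subst (λ t → Palindrome (factor text t h)) (sym start≡)
      (factor-palindrome t≤h h≤n (subst (λ y → Pal y h) (sym (m∸n+n≡m h≤x)) P))

  succeeds? : ∀ h c → Dec (Succeeds text h c)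
  succeeds? h c = ≡-dec Finₚ._≟_ _ _

-- The effect of one pass through the loop

module Pass (parameters : Param → ℕ) (palindrome : ℕ → Bool) where

  open Semantics parameters palindrome public
  open Blocks parameters palindrome public

  record Registers (h Λ g base R : ℕ) (m : Memory) : Set where
    constructor registers
    field
      time≡    : m 0 ≡ h
      scale≡   : m 1 ≡ Λ
      spacing≡ : m 2 ≡ g
      base≡    : m 4 ≡ base
      limit≡   : m 5 ≡ R

  slot-at-≡ : ∀ {m m′} k → (∀ f → f < 7 → m′ (32 + (f + k)) ≡ m (32 + (f + k))) → slot-at m′ k ≡ slot-at m k
  slot-at-≡ k e = slot-≡ (e 0 (≤ᵇ⇒≤ 1 7 tt)) (e 1 (≤ᵇ⇒≤ 2 7 tt)) (e 2 (≤ᵇ⇒≤ 3 7 tt)) (e 3 (≤ᵇ⇒≤ 4 7 tt))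
                         (e 4 (≤ᵇ⇒≤ 5 7 tt)) (e 5 (≤ᵇ⇒≤ 6 7 tt)) (e 6 (≤ᵇ⇒≤ 7 7 tt))

  module Geometry (step : Context → Slot → Slot) (log : Context → Slot → List ℕ) {h Λ g base R : ℕ} where

    offset : ℕ → ℕ
    offset u = base + 8 * ⟦ rem ⟧ (⟦ quo ⟧ h Λ ∸ u) 8

    contextOf : ℕ → Context
    contextOf u = context (h ∸ ⟦ rem ⟧ h Λ ∸ u * Λ) Λ g h R

    direct : ℕ → ℕ
    direct u = h + (h ∸ ⟦ rem ⟧ h g ∸ u * g)

    record PairDone (n k : ℕ) (m m′ : Memory) (xs : List ℕ) : Set where
      field
        registers′ : Registers h Λ g base R m′
        level′     : m′ 3 ≡ m 3
        size′      : m′ 6 ≡ m 6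
        others     : ∀ j → j < base ⊎ base + 64 ≤ j → m′ (32 + j) ≡ m (32 + j)
        advanced   : ∀ u → 6 ≤ u → u < 6 + k → u ≤ ⟦ quo ⟧ h Λ →
                     slot-at m′ (offset u) ≡ step (contextOf u) (slot-at m (offset u))
        tried      : ∀ u → 6 ≤ u → u < 6 + k → u ≤ ⟦ quo ⟧ h Λ →
                     ∀ {y} → y ∈ log (contextOf u) (slot-at m (offset u)) → y ∈ xs
        direct-∈   : ∀ u → u < n → allowed h g R (direct u) ≡ true → direct u ∈ xs

  module Passing (advancing : Code) (step : Context → Slot → Slot) (log : Context → Slot → List ℕ)
                   (performs : Performs advancing step log)
                   (low-kept : ∀ m r → r < 8 → memory advancing m r ≡ m r)
                   (cell-kept : ∀ m j → memory advancing m (32 + j) ≡ m (32 + j))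
                   {h Λ g base R : ℕ} where

    open Geometry step log {h} {Λ} {g} {base} {R}

    record BlockDone (u : ℕ) (m m′ : Memory) (xs : List ℕ) : Set where
      field
        registers′ : Registers h Λ g base R m′
        level′     : m′ 3 ≡ m 3
        size′      : m′ 6 ≡ m 6
        others     : ∀ j → (∀ f → f < 7 → j ≢ f + offset u) → m′ (32 + j) ≡ m (32 + j)
        idle       : ¬ u ≤ ⟦ quo ⟧ h Λ → m′ ≡ m
        advanced   : u ≤ ⟦ quo ⟧ h Λ → slot-at m′ (offset u) ≡ step (contextOf u) (slot-at m (offset u))
        tried      : u ≤ ⟦ quo ⟧ h Λ → xs ≡ log (contextOf u) (slot-at m (offset u))

    block-done : ∀ u {m} → Registers h Λ g base R m → BlockDone u m (memory (blockWith advancing u) m)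
        (runs (blockWith advancing u) m)
    block-done u {m} (registers refl refl refl refl refl) = record
      { registers′ = registers (E.block-register 0 (≤ᵇ⇒≤ 1 7 tt)) (E.block-register 1 (≤ᵇ⇒≤ 2 7 tt))
          (E.block-register 2 (≤ᵇ⇒≤ 3 7 tt)) (E.block-register 4 (≤ᵇ⇒≤ 5 7 tt)) (E.block-register 5 (≤ᵇ⇒≤ 6 7 tt))
      ; level′ = E.block-register 3 (≤ᵇ⇒≤ 4 7 tt) ; size′ = E.block-register 6 (≤ᵇ⇒≤ 7 7 tt)
      ; others = E.block-other ; idle = E.block-idle ; advanced = E.block-slot ; tried = E.block-runs }
      where
      module E = BlockEffect advancing performs low-kept cell-kept u m

    offset-range : ∀ u f → f < 7 → base ≤ f + offset u × f + offset u < base + 64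
    offset-range u f f< = (lin (base ∷ f ∷ z ∷ []) 1 [] (# 0) (# 1 ⊕ (# 0 ⊕ (8 ⊛ (# 2))))) ,
        (lin (z ∷ f ∷ base ∷ []) 1 ((8 , con 1 ⊕ # 0 , con 8) ∷ (1 , con 1 ⊕ # 1 , con 7) ∷ [])
        (con 1 ⊕ (# 1 ⊕ (# 2 ⊕ (8 ⊛ (# 0))))) (# 2 ⊕ con 64) (m%n<n (⟦ quo ⟧ h Λ ∸ u) 8) f<)
      where
      z = ⟦ rem ⟧ (⟦ quo ⟧ h Λ ∸ u) 8

    -- Distances between 6 and 11 differ by at most 5, too little for numbers congruent modulo 8.
    remainders-differ : ∀ {q} u v → u ≤ q → v ≤ q → 6 ≤ u → u < v → v < 12 → ⟦ rem ⟧ (q ∸ u) 8 ≢ ⟦ rem ⟧ (q ∸ v) 8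
    remainders-differ {q} u v u≤ v≤ 6≤u u<v v<12 e =
      (n≮0 (lin (d ∷ a ∷ u ∷ q ∷ v ∷ []) 0 ((1 , # 0 ⊕ con 8 , # 1) ∷ (1 , # 1 ⊕ # 2 , # 3) ∷
          (1 , # 3 , # 0 ⊕ # 4) ∷ (1 , con 1 ⊕ # 4 , con 12) ∷ (1 , con 6 , # 2) ∷ []) (con 1) (con 0)
          (≈-close (≈-sym (%≡⇒≈ {8} {a} {d} e)) d<a) (≤-reflexive (m∸n+n≡m u≤))
          (≤-reflexive (sym (m∸n+n≡m v≤))) v<12 6≤u))
      where
      a = q ∸ u
      d = q ∸ v
      d<a : d < a
      d<a = (lin (a ∷ u ∷ q ∷ d ∷ v ∷ []) 1 ((1 , # 2 , # 0 ⊕ # 1) ∷ (1 , # 3 ⊕ # 4 , # 2) ∷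
          (1 , con 1 ⊕ # 1 , # 4) ∷ []) (con 1 ⊕ # 3) (# 0) (≤-reflexive (sym (m∸n+n≡m u≤)))
          (≤-reflexive (m∸n+n≡m v≤)) u<v)

    slots-apart : ∀ {a b f f′} → f < 7 → f′ < 7 → a ≢ b → f + (base + 8 * a) ≢ f′ + (base + 8 * b)
    slots-apart {a} {b} {f} {f′} f< f′< a≢b e with <-cmp a b
    ... | tri< a<b _ _ = (n≮0 (lin (f ∷ base ∷ a ∷ f′ ∷ b ∷ []) 0
        ((1 , # 3 ⊕ (# 1 ⊕ (8 ⊛ (# 4))) , # 0 ⊕ (# 1 ⊕ (8 ⊛ (# 2)))) ∷ (8 , con 1 ⊕ # 2 , # 4) ∷
        (1 , con 1 ⊕ # 0 , con 7) ∷ []) (con 1) (con 0) (≤-reflexive (sym e)) a<b f<))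
    ... | tri≈ _ a≡b _ = a≢b a≡b
    ... | tri> _ _ b<a = (n≮0 (lin (f ∷ base ∷ a ∷ f′ ∷ b ∷ []) 0
        ((1 , # 0 ⊕ (# 1 ⊕ (8 ⊛ (# 2))) , # 3 ⊕ (# 1 ⊕ (8 ⊛ (# 4)))) ∷ (8 , con 1 ⊕ # 4 , # 2) ∷
        (1 , con 1 ⊕ # 3 , con 7) ∷ []) (con 1) (con 0) (≤-reflexive e) b<a f′<))

    offsets-apart : ∀ {u v} → u ≤ ⟦ quo ⟧ h Λ → v ≤ ⟦ quo ⟧ h Λ → 6 ≤ u → u < v → v < 12 →
                    ∀ f f′ → f < 7 → f′ < 7 → f + offset u ≢ f′ + offset v
    offsets-apart {u} {v} u≤ v≤ 6≤u u<v v< f f′ f< f′< = slots-apart f< f′< (remainders-differ u v u≤ v≤ 6≤u u<v v<)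

    record BlocksDone (k : ℕ) (m m′ : Memory) (xs : List ℕ) : Set where
      field
        registers′ : Registers h Λ g base R m′
        level′     : m′ 3 ≡ m 3
        size′      : m′ 6 ≡ m 6
        others     : ∀ j → j < base ⊎ base + 64 ≤ j → m′ (32 + j) ≡ m (32 + j)
        advanced   : ∀ u → 6 ≤ u → u < 6 + k → u ≤ ⟦ quo ⟧ h Λ →
                     slot-at m′ (offset u) ≡ step (contextOf u) (slot-at m (offset u))
        tried      : ∀ u → 6 ≤ u → u < 6 + k → u ≤ ⟦ quo ⟧ h Λ →
                     ∀ {y} → y ∈ log (contextOf u) (slot-at m (offset u)) → y ∈ xs
        -- Blocks still to be visited in this pass must be found with the slots they had at its
        -- beginning.
        waiting    : ∀ u → 6 + k ≤ u → u < 12 → u ≤ ⟦ quo ⟧ h Λ → slot-at m′ (offset u) ≡ slot-at m (offset u)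

    blocks-done : ∀ k {m} → k ≤ 6 → Registers h Λ g base R m → BlocksDone k m
        (memory (blocksWith advancing k) m) (runs (blocksWith advancing k) m)
    blocks-done zero {m} _ r = record
      { registers′ = r ; level′ = refl ; size′ = refl ; others = λ _ _ → refl
      ; advanced = λ u 6≤ u< → contradiction 6≤ (<⇒≱ (subst (u <_) (+-identityʳ 6) u<))
      ; tried = λ u 6≤ u< → contradiction 6≤ (<⇒≱ (subst (u <_) (+-identityʳ 6) u<)) ; waiting = λ _ _ _ _ → refl }
    blocks-done (suc k) {m} k<6 r = record
      { registers′ = B.registers′ ; level′ = trans B.level′ P.level′ ; size′ = trans B.size′ P.size′
      ; others = λ j out → trans (B.others j (outside j out)) (P.others j out)
      ; advanced = advanced′ ; tried = tried′
      ; waiting = λ u k<u u< u≤ → trans (slot-at-≡ {m₁} {memory (blockWith advancing v) m₁} (offset u)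
          (λ f f< → B.others (f + offset u) (λ f′ f′< e →
            offsets-apart (≤-trans (<⇒≤ (later u k<u)) u≤) u≤ (m≤m+n 6 k) (later u k<u) u< f′ f f′< f< (sym e))))
          (P.waiting u (<⇒≤ (later u k<u)) u< u≤) }
      where
      m₁ : Memory
      m₁ = memory (blocksWith advancing k) m
      v = 6 + k
      module P = BlocksDone (blocks-done k {m} (<⇒≤ k<6) r)
      module B = BlockDone (block-done v P.registers′)
      later : ∀ u → 6 + suc k ≤ u → v < u
      later u = subst (_≤ u) (+-suc 6 k)
      outside : ∀ j → j < base ⊎ base + 64 ≤ j → ∀ f → f < 7 → j ≢ f + offset v
      outside j (inj₁ j<) f f< refl = <⇒≱ j< (proj₁ (offset-range v f f<))
      outside j (inj₂ ≤j) f f< refl = <⇒≱ (proj₂ (offset-range v f f<)) ≤j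
      v<12 : v < 12
      v<12 = +-monoʳ-< 6 k<6
      kept-slot : ∀ u → 6 ≤ u → u < v → u ≤ ⟦ quo ⟧ h Λ → Dec (v ≤ ⟦ quo ⟧ h Λ) →
                  slot-at (memory (blockWith advancing v) m₁) (offset u) ≡ slot-at m₁ (offset u)
      kept-slot u 6≤u u<v u≤ (yes v≤) = slot-at-≡ {m₁} {memory (blockWith advancing v) m₁} (offset u)
          (λ f f< → B.others (f + offset u)
                                          (λ f′ f′< → offsets-apart u≤ v≤ 6≤u u<v v<12 f f′ f< f′<))
      kept-slot u _ _ _ (no v≰)       = cong (λ m′ → slot-at m′ (offset u)) (B.idle v≰)
      advanced-at : ∀ {u} → 6 ≤ u → u ≤ ⟦ quo ⟧ h Λ → u < v ⊎ u ≡ v →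
                    slot-at (memory (blockWith advancing v) m₁) (offset u) ≡ step (contextOf u) (slot-at m (offset u))
      advanced-at {u} 6≤u u≤ (inj₁ u<v) = trans (kept-slot u 6≤u u<v u≤ (v ≤? ⟦ quo ⟧ h Λ)) (P.advanced u 6≤u u<v u≤)
      advanced-at 6≤u u≤ (inj₂ refl)    = trans (B.advanced u≤) (cong (step (contextOf v)) (P.waiting v ≤-refl v<12 u≤))
      advanced′ : ∀ u → 6 ≤ u → u < 6 + suc k → u ≤ ⟦ quo ⟧ h Λ →
                  slot-at (memory (blockWith advancing v) m₁) (offset u) ≡ step (contextOf u) (slot-at m (offset u))
      advanced′ u 6≤u u< u≤ = advanced-at 6≤u u≤ (m≤n⇒m<n∨m≡n (≤-pred (subst (u <_) (+-suc 6 k) u<)))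
      tried-at : ∀ {u} → 6 ≤ u → u ≤ ⟦ quo ⟧ h Λ → u < v ⊎ u ≡ v →
                 ∀ {y} → y ∈ log (contextOf u) (slot-at m (offset u)) → y ∈ runs (blocksWith advancing k) m
                     ++ runs (blockWith advancing v) m₁
      tried-at {u} 6≤u u≤ (inj₁ u<v) y∈ = ∈-++⁺ˡ (P.tried u 6≤u u<v u≤ y∈)
      tried-at 6≤u u≤ (inj₂ refl) y∈    = ∈-++⁺ʳ (runs (blocksWith advancing k) m) (subst (_ ∈_)
              (sym (trans (B.tried u≤) (cong (log (contextOf v)) (P.waiting v ≤-refl v<12 u≤)))) y∈)
      tried′ : ∀ u → 6 ≤ u → u < 6 + suc k → u ≤ ⟦ quo ⟧ h Λ →
               ∀ {y} → y ∈ log (contextOf u) (slot-at m (offset u)) → y ∈ runs (blocksWith advancing k) m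
                   ++ runs (blockWith advancing v) m₁
      tried′ u 6≤u u< u≤ = tried-at 6≤u u≤ (m≤n⇒m<n∨m≡n (≤-pred (subst (u <_) (+-suc 6 k) u<)))

    directs-kept : ∀ k m a → T (not (a ≡ᵇ 9) ∧ not (a ≡ᵇ 10)) → memory (directs k) m a ≡ m a
    directs-kept zero    m a p = refl
    directs-kept (suc k) m a p = trans (kept (directCode k) (memory (directs k) m) a p) (directs-kept k m a p)

    directs-registers : ∀ k {m} → Registers h Λ g base R m → Registers h Λ g base R (memory (directs k) m)
    directs-registers k {m} (registers t s d e l) = registers (trans (directs-kept k m 0 tt) t)
        (trans (directs-kept k m 1 tt) s)
      (trans (directs-kept k m 2 tt) d) (trans (directs-kept k m 4 tt) e) (trans (directs-kept k m 5 tt) l)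

    direct-run : ∀ u {m} → Registers h Λ g base R m → allowed h g R (direct u) ≡ true → direct u ∈ runs (directCode u) m
    direct-run u {m} (registers refl refl refl refl refl) ok = subst
        (λ b → direct u ∈ (if b then direct u ∷ [] else [])) (sym ok) (here refl)

    directs-runs : ∀ k {m} → Registers h Λ g base R m → ∀ u → u < k → allowed h g R (direct u) ≡ true →
        direct u ∈ runs (directs k) m
    directs-runs (suc k) {m} r u u< ok = by-case (m≤n⇒m<n∨m≡n (≤-pred u<)) ok
      where
      by-case : ∀ {u} → u < k ⊎ u ≡ k → allowed h g R (direct u) ≡ true → direct u ∈ runs (directs (suc k)) m
      by-case {u} (inj₁ u<k) ok = ∈-++⁺ˡ (directs-runs k r u u<k ok)
      by-case (inj₂ refl)    ok = ∈-++⁺ʳ (runs (directs k) m) (direct-run k (directs-registers k r) ok)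

    pair-done : ∀ n k {m} → k ≤ 6 → Registers h Λ g base R m →
                PairDone n k m (memory (pairWith advancing n k) m) (runs (pairWith advancing n k) m)
    pair-done n k {m} k≤6 r = record
      { registers′ = B.registers′ ; level′ = trans B.level′ (directs-kept n m 3 tt) ; size′ = trans B.size′
          (directs-kept n m 6 tt)
      ; others = λ j out → trans (B.others j out) (directs-kept n m (32 + j) tt)
      ; advanced = λ u 6≤ u< u≤ → trans (B.advanced u 6≤ u< u≤) (cong (step (contextOf u)) (same-slot (offset u)))
      ; tried = λ u 6≤ u< u≤ y∈ → ∈-++⁺ʳ (runs (directs n) m)
          (B.tried u 6≤ u< u≤ (subst (λ σ → _ ∈ log (contextOf u) σ) (sym (same-slot (offset u))) y∈))
      ; direct-∈ = λ u u< ok → ∈-++⁺ˡ (directs-runs n r u u< ok) }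
      where
      m₁ : Memory
      m₁ = memory (directs n) m
      module B = BlocksDone (blocks-done k {m₁} k≤6 (directs-registers n r))
      same-slot : ∀ a → slot-at m₁ a ≡ slot-at m a
      same-slot a = slot-at-≡ {m} {m₁} a (λ f _ → directs-kept n m (32 + (f + a)) tt)

    pair-done-as : ∀ c n k {m} → c ≡ pairWith advancing n k → k ≤ 6 → Registers h Λ g base R m →
                   PairDone n k m (memory c m) (runs c m)
    pair-done-as _ n k refl = pair-done n k

  abstract

    pairCode-done : ∀ {h Λ g base R m} → Registers h Λ g base R m →
      Geometry.PairDone (λ c → Following.advance c palindrome) (λ c → Following.attempted c palindrome)
        {h} {Λ} {g} {base} {R} 8 6 m (memory pairCode m) (runs pairCode m)
    pairCode-done = Passing.pair-done-as advanceCode (λ c → Following.advance c palindrome)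
        (λ c → Following.attempted c palindrome)
                      advance-performs advance-low advance-cell pairCode 8 6 pairCode≡ ≤-refl

  record SetupDone (h Λ g base ℓ : ℕ) (m m′ : Memory) : Set where
    field
      size≡     : m′ 6 ≡ (if ℓ <ᵇ parameters levels then parameters commonSize else parameters topSize)
      setup-registers : Registers h Λ g base (limitOf g (m′ 6) h) m′
      level≡    : m′ 3 ≡ ℓ
      cells     : ∀ j → m′ (32 + j) ≡ m (32 + j)

  setup-done : ∀ m → SetupDone (m 0) (m 1) (m 2) (m 4) (m 3) m (memory setupCode m)
  setup-done m = record
    { size≡ = six (m 3 <ᵇ parameters levels)
    ; setup-registers = registers (k 0) (k 1) (k 2) (k 4) (cong₂ (λ t s → t + s * (⟦ quo ⟧ t s + 1 ∸ m₁ 6))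
        (kept sizing m 0 tt) (kept sizing m 2 tt))
    ; level≡ = k 3 ; cells = λ j → kept setupCode m (32 + j) tt }
    where
    sizing : Code
    sizing = choose (level <ₑ param levels) (6 := param commonSize) (6 := param topSize)
    m₁ : Memory
    m₁ = memory sizing m
    k : ∀ a {_ : T (keeps setupCode a)} → memory setupCode m a ≡ m a
    k a {p} = kept setupCode m a p
    six : ∀ b → (if b then m [ 6 ≔ parameters commonSize ] else m [ 6 ≔ parameters topSize ]) 6
              ≡ (if b then parameters commonSize else parameters topSize)
    six true  = refl
    six false = refl

  nextPair : (L z a ℓ : ℕ) → ℕ × ℕ
  nextPair L z a ℓ = if ℓ <ᵇ L then (if z <ᵇ ⟦ quo ⟧ (16 * 2 ^ a) (2 ^ ℓ) then (a , suc ℓ) else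
      (suc a , ℓ)) else (suc a , ℓ)

  record ProceedDone (m m′ : Memory) (p : ℕ × ℕ) : Set where
    field
      scale≡   : m′ 1 ≡ 2 ^ proj₁ p
      spacing≡ : m′ 2 ≡ 2 ^ proj₂ p
      level≡   : m′ 3 ≡ proj₂ p
      time≡    : m′ 0 ≡ m 0
      base≡    : m′ 4 ≡ m 4
      cells    : ∀ j → m′ (32 + j) ≡ m (32 + j)

  proceed-done : ∀ m a → m 1 ≡ 2 ^ a → m 2 ≡ 2 ^ m 3 → 2 ^ a ≤ m 0 →
    (m 3 < parameters levels → m 6 < ⟦ quo ⟧ (16 * 2 ^ a) (2 ^ m 3) → 2 ^ m 3 ≤ m 0) →
    ProceedDone m (memory proceedCode m) (nextPair (parameters levels) (m 6) a (m 3))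
  proceed-done m a Λ≡ g≡ a≤ ℓ≤ = record
    { scale≡ = proj₁ values ; spacing≡ = proj₁ (proj₂ values) ; level≡ = proj₂ (proj₂ values)
    ; time≡ = kept proceedCode m 0 tt ; base≡ = kept proceedCode m 4 tt ; cells = λ j → kept proceedCode m (32 + j) tt }
    where
    capped : ∀ c d k → d ≡ 2 ^ k → 2 ^ k ≤ c → c + c ∸ (c + c ∸ (d + d)) ≡ 2 ^ suc k
    capped c d k refl le = trans (m∸[m∸n]≡n (+-mono-≤ le le)) (cong (2 ^ k +_) (sym (+-identityʳ (2 ^ k))))
    Values : Memory → ℕ × ℕ → Set
    Values m′ p = m′ 1 ≡ 2 ^ proj₁ p × m′ 2 ≡ 2 ^ proj₂ p × m′ 3 ≡ proj₂ p
    along : Memory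
    along = memory (1 := cap (time +ₑ time) (scale +ₑ scale)) m
    upward : Memory
    upward = memory (3 := cap (param levels) (lit 1 +ₑ level) ▸ 2 := cap (time +ₑ time) (spacing +ₑ spacing)) m
    along-values : Values along (suc a , m 3)
    along-values = capped (m 0) (m 1) a Λ≡ a≤ , g≡ , refl
    inner : m 3 < parameters levels → ∀ d → (m 6 <ᵇ ⟦ quo ⟧ (16 * 2 ^ a) (2 ^ m 3)) ≡ d →
            Values (if d then upward else along) (if d then (a , suc (m 3)) else (suc a , m 3))
    inner ℓ<L false e = along-values
    inner ℓ<L true  e = Λ≡ , capped (m 0) (m 2) (m 3) g≡ (ℓ≤ ℓ<L (<ᵇ-true e)) , m∸[m∸n]≡n ℓ<L
    outer : ∀ c → (m 3 <ᵇ parameters levels) ≡ c →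
      Values (if c then (if m 6 <ᵇ ⟦ quo ⟧ (16 * 2 ^ a) (2 ^ m 3) then upward else along) else along)
             (if c then (if m 6 <ᵇ ⟦ quo ⟧ (16 * 2 ^ a) (2 ^ m 3) then (a , suc (m 3)) else (suc a , m 3))
                 else (suc a , m 3))
    outer false e = along-values
    outer true  e = inner (<ᵇ-true {m 3} {parameters levels} e) (m 6 <ᵇ ⟦ quo ⟧ (16 * 2 ^ a) (2 ^ m 3)) refl
    values : Values (memory proceedCode m) (nextPair (parameters levels) (m 6) a (m 3))
    values = subst₂ (λ Λ g → Values (if m 3 <ᵇ parameters levels then
        (if m 6 <ᵇ ⟦ quo ⟧ (16 * Λ) g then upward else along) else along)
                                    (nextPair (parameters levels) (m 6) a (m 3)))
               (sym Λ≡) (sym g≡) (outer (m 3 <ᵇ parameters levels) refl)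

-- The simulation

∧-true : ∀ {a b} → a ∧ b ≡ true → a ≡ true × b ≡ true
∧-true {true} {true} _ = refl , refl

does-true : ∀ {A : Set} (d : Dec A) → does d ≡ true → A
does-true (yes a) _ = a

true-does : ∀ {A : Set} (d : Dec A) → A → does d ≡ true
true-does (yes _) _ = refl
true-does (no ¬a) a = contradiction a ¬a

<-true : ∀ {a b} → a < b → (a <ᵇ b) ≡ true
<-true {a} {b} a<b with a <ᵇ b in e
... | true  = refl
... | false = contradiction a<b (≤⇒≯ (<ᵇ-false {a} {b} e))

≡-true : ∀ {a b} → a ≡ b → (a ≡ᵇ b) ≡ true
≡-true {a} {b} a≡b with a ≡ᵇ b in e
... | true  = refl
... | false = contradiction a≡b (≡ᵇ-false {a} {b} e)

record Allowed (h g R x : ℕ) : Set where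
  field
    inside  : R ≤ x
    divides′ : g ∣ x ∸ h
    even    : 2 ∣ x
    x≤2h    : x ≤ h + h

allowed-sound : ∀ {h g R x} → 0 < g → allowed h g R x ≡ true → Allowed h g R x
allowed-sound {h} {g} {R} {x} 0<g e = record
  { inside = ≤-pred (<ᵇ-true {R} {1 + x} (proj₁ (∧-true (proj₁ (∧-true {(R <ᵇ 1 + x) ∧ (⟦ rem ⟧ (x ∸ h) g ≡ᵇ 0)} e)))))
  ; divides′ = rem-∣ (x ∸ h) g 0<g (≡ᵇ-true (proj₂ (∧-true {R <ᵇ 1 + x}
      (proj₁ (∧-true {(R <ᵇ 1 + x) ∧ (⟦ rem ⟧ (x ∸ h) g ≡ᵇ 0)} e)))))
  ; even = rem-∣ x 2 z<s (≡ᵇ-true (proj₁ (∧-true (proj₂ (∧-true {(R <ᵇ 1 + x) ∧ (⟦ rem ⟧ (x ∸ h) g ≡ᵇ 0)} e)))))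
  ; x≤2h = ≤-pred (<ᵇ-true {x} {1 + (h + h)} (proj₂ (∧-true {⟦ rem ⟧ x 2 ≡ᵇ 0}
      (proj₂ (∧-true {(R <ᵇ 1 + x) ∧ (⟦ rem ⟧ (x ∸ h) g ≡ᵇ 0)} e))))) }

allowed-complete : ∀ {h g R x} → 0 < g → Allowed h g R x → allowed h g R x ≡ true
allowed-complete {h} {g} {R} {x} 0<g A = cong₂ _∧_
  (cong₂ _∧_ (<-true (s≤s inside)) (≡-true (∣-rem (x ∸ h) g 0<g divides′)))
  (cong₂ _∧_ (≡-true (∣-rem x 2 z<s even)) (<-true (s≤s x≤2h)))
  where open Allowed A

module Simulation {σ n : ℕ} (S : Scheme) (w : ℕ) (text : Text σ n)
                  (L≤ : L S ≤ ⌊log₂ n ⌋) (large : ∀ ℓ → ℓ ≤ L S → [ 12 ] ≤⁺ size S ℓ)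
                  (w≥ : 32 * suc ⌊log₂ (n ⊔ σ) ⌋ ≤ w) where

  -- The loop makes at most `2 * lg + 1` passes, each with 64 cells of storage; 256 per unit also
  -- leaves room for the registers and for one more step of the base. The number `M` is a power of 2
  -- above both `n` and `σ`.
  lg lgN s M : ℕ
  lg  = ⌊log₂ n ⌋
  lgN = ⌊log₂ (n ⊔ σ) ⌋
  s   = 256 * suc lg
  M   = 2 ^ suc lgN

  abstract

    log-bound : ∀ k → k < 2 ^ suc ⌊log₂ k ⌋
    log-bound k = ≰⇒> (λ le → <-irrefl refl (subst (_≤ ⌊log₂ k ⌋) (⌊log₂[2^n]⌋≡n (suc ⌊log₂ k ⌋)) (⌊log₂⌋-mono-≤ le)))

    2^-log : ∀ {m k} → 2 ^ m ≤ k → m ≤ ⌊log₂ k ⌋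
    2^-log {m} le = subst (_≤ _) (⌊log₂[2^n]⌋≡n m) (⌊log₂⌋-mono-≤ le)

    lg≤lgN : lg ≤ lgN
    lg≤lgN = ⌊log₂⌋-mono-≤ (m≤m⊔n n σ)

    M≥2 : 2 ≤ M
    M≥2 = (lin ((2 ^ lgN) ∷ []) 1 ((2 , con 1 ⊕ con 0 , # 0) ∷ []) (con 2) (2 ⊛ (# 0)) (2^>0 lgN))

    n<M : n < M
    n<M = ≤-<-trans (m≤m⊔n n σ) (log-bound (n ⊔ σ))

    powers : ∀ d → d ≤ degree-limit → M ^ d ≤ 2 ^ w
    powers d d≤ = subst (_≤ 2 ^ w) (sym (^-*-assoc 2 (suc lgN) d))
      (^-monoʳ-≤ 2 (≤-trans (*-monoʳ-≤ (suc lgN) d≤) (≤-trans (≤-reflexive (*-comm (suc lgN) 32)) w≥)))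

    lgN<M : suc lgN < M
    lgN<M = n<2^n (suc lgN)

    L<M : L S < M
    L<M = ≤-<-trans (≤-trans L≤ lg≤lgN) (<-trans (n<1+n lgN) lgN<M)

    s≥40 : 40 ≤ s
    s≥40 = (lin (lg ∷ []) 1 [] (con 40) (256 ⊛ (con 1 ⊕ # 0)))

    s≤ : s ≤ M ^ 10
    s≤ = ≤-trans (*-mono-≤ (^-monoˡ-≤ 8 M≥2) (≤-trans (s≤s lg≤lgN) (<⇒≤ lgN<M)))
           (≤-trans (≤-reflexive (*-comm (M ^ 8) M)) (^-monoʳ-≤ M {{>-nonZero (≤-trans (s≤s z≤n) M≥2)}} (≤ᵇ⇒≤ 9 10 tt)))

    words-large : ∀ {k} → k < M → k < 2 ^ w ∸ 1
    words-large {k} k<M = m+n≤o⇒m≤o∸n (suc k) (≤-trans (lin (k ∷ M ∷ (M * (M * 1)) ∷ []) 1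
        ((1 , con 1 ⊕ # 0 , # 1) ∷ (1 , con 2 , # 1) ∷ (1 , 2 ⊛ (# 1) , # 2) ∷ []) ((con 1 ⊕ # 0) ⊕ con 1)
        (# 2) k<M M≥2 double) (powers 2 (≤ᵇ⇒≤ 2 32 tt)))
      where
      double : 2 * M ≤ M * (M * 1)
      double = subst (2 * M ≤_) (cong (M *_) (sym (*-identityʳ M))) (*-monoˡ-≤ M M≥2)

  open Sizes w S

  abstract

    large′ : ∀ ℓ → ℓ ≤ L S → 12 ≤ sizeOf ℓ
    large′ ℓ ℓ≤ = subst (12 ≤_) (sym (sizeOf≡ ℓ)) (saturate-≥ 12≤ (large ℓ ℓ≤))
      where
      12≤ : 12 ≤ 2 ^ w ∸ 1
      12≤ = m+n≤o⇒m≤o∸n 12 (≤-trans (≤-trans (≤ᵇ⇒≤ 13 16 tt) (^-monoˡ-≤ 4 M≥2)) (powers 4 (≤ᵇ⇒≤ 4 32 tt)))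

  open Walk (L S) sizeOf large′
  open Words (letter text)

  scaleAt levelAt : ℕ → ℕ
  scaleAt idx = proj₁ (walk idx)
  levelAt idx = proj₂ (walk idx)

  -- Block starts have to be landmarks of the level throughout the sweep: `ℓ≤a` makes them multiples
  -- of the spacing, and `wide` keeps them for 8 scales. The slots of other visited pairs carry no
  -- invariant.
  record Useful (a ℓ : ℕ) : Set where
    field
      ℓ≤a  : ℓ ≤ a
      wide : 8 * 2 ^ a ≤ sizeOf ℓ * 2 ^ ℓ

  record Success (ℓ h x : ℕ) : Set where
    field
      allow : Allowed h (2 ^ ℓ) (limit ℓ h) x
      pal   : Pal x h
    open Allowed allow public

  module Tracked (a ℓ i : ℕ) (U : Useful a ℓ) where
    open Useful U

    t₀ Λ g : ℕ
    t₀ = i * 2 ^ a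
    Λ  = 2 ^ a
    g  = 2 ^ ℓ

    abstract

      g≤Λ : g ≤ Λ
      g≤Λ = ^-monoʳ-≤ 2 ℓ≤a

      g∣Λ : g ∣ Λ
      g∣Λ = 2^-∣ ℓ≤a

      g∣t₀ : g ∣ t₀
      g∣t₀ = ∣n⇒∣m*n i g∣Λ

      sweepable : ∀ h → h < t₀ + 8 * Λ → limit ℓ h ≤ t₀ + h
      sweepable h h< = limitOf-intro {2 ^ ℓ} {sizeOf ℓ} (2^>0 ℓ) g∣t₀ (<-≤-trans h< (+-monoʳ-≤ t₀ wide))

    AfterBlock : ℕ → Slot → Set
    AfterBlock = Advance.After (letter text) t₀ Λ g (limit ℓ) (2^>0 a) (2^>0 ℓ) g≤Λ g∣t₀ g∣Λ (limit-mono ℓ)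
        (limit-≥ ℓ) sweepable

    Finds : ℕ → List ℕ → Set
    Finds h xs = ∀ {x} v → x ≡ t₀ + v → t₀ + 6 * Λ ≤ v → v < t₀ + 8 * Λ → v ≤ h → Success ℓ h x →
                 ∃[ x″ ] x″ ≤ x × Success ℓ h x″ × x″ ∈ xs

  palindrome : ℕ → ℕ → Bool
  palindrome h x = does (succeeds? text h (centre x))

  Active : (a i h : ℕ) → Set
  Active a i h = i * 2 ^ a + 6 * 2 ^ a ≤ h × h < i * 2 ^ a + 12 * 2 ^ a

  slot-offset : (idx i : ℕ) → ℕ
  slot-offset idx i = 64 * idx + 8 * ⟦ rem ⟧ i 8

  Slots : ℕ → Memory → Set
  Slots h m = ∀ idx (U : Useful (scaleAt idx) (levelAt idx)) i → Active (scaleAt idx) i h →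
              Tracked.AfterBlock (scaleAt idx) (levelAt idx) i U h (slot-at m (slot-offset idx i))

  State-at : ℕ → Memory → Set
  State-at h m = Bounds.Bounded w s M m × m 0 ≡ h × Slots h m

  allowed-runnable : ∀ {h x} ℓ → ℓ ≤ L S → Allowed h (2 ^ ℓ) (limit ℓ h) x → Runnable S h (centre x)
  allowed-runnable {h} {x} ℓ ℓ≤L A = x ∸ h ,
    trans (cong (_+ 2) (m∸n+n≡m h≤x)) (sym (centre-even text even)) ,
    ℓ , ℓ≤L , in-level ℓ h (x ∸ h) divides′ (m≤n+o⇒m∸n≤o x h x≤2h) (subst (limit ℓ h ≤_) (sym (m∸n+n≡m h≤x)) inside)
    where
    open Allowed A
    h≤x : h ≤ x
    h≤x = ≤-trans (limit-≥ ℓ h) inside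

  module TrackedStep (a ℓ i : ℕ) (U : Useful a ℓ) (h : ℕ) (h≤n : h ≤ n) where
    open Tracked a ℓ i U

    private
      open module B = Block (letter text) t₀ Λ g (limit ℓ) (2^>0 a) (2^>0 ℓ) g≤Λ g∣t₀ (limit-mono ℓ) (limit-≥ ℓ)
        using (Hit; Swept; swept-at)
      open Following (context (i * 2 ^ a) (2 ^ a) (2 ^ ℓ) h (limit ℓ h)) (palindrome h)

    success⇒hit : ∀ {x} → Success ℓ h x → Hit h x
    success⇒hit {x} X = record { inside = inside ; class = class ; even = even ; x≤2h = x≤2h ; pal = pal }
      where
      open Success X
      class : Congruent g x h
      class = ≈-trans (≈-reflexive (sym (m∸n+n≡m (≤-trans (limit-≥ ℓ h) inside)))) (≈-+ h (∣⇒≈ divides′))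

    hit⇒success : ∀ {x} → Hit h x → Success ℓ h x
    hit⇒success {x} X = record
      { allow = record { inside = inside ; divides′ = ≈-∣ (≈-sym x-h≈0) (g ∣0) ; even = even ; x≤2h = x≤2h
          } ; pal = pal }
      where
      open Hit X
      x-h≈0 : Congruent g (x ∸ h) 0
      x-h≈0 = ≈-cancel (x ∸ h) 0 h (≈-trans (≈-reflexive (m∸n+n≡m (≤-trans (limit-≥ ℓ h) inside))) class)

    hit-sound : ∀ {x} → hit x ≡ true → Hit h x
    hit-sound {x} e = success⇒hit (record { allow = A
      ; pal = succeeds⇒pal text even (≤-trans (limit-≥ ℓ h) inside) x≤2h h≤n
          (does-true (succeeds? text h (centre x)) (proj₂ (∧-true {allowed h g (limit ℓ h) x} e))) })
      where
      A = allowed-sound {h} {g} {limit ℓ h} {x} (2^>0 ℓ) (proj₁ (∧-true e))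
      open Allowed A

    hit-complete : ∀ {x} → Hit h x → hit x ≡ true
    hit-complete {x} X = cong₂ _∧_ (allowed-complete (2^>0 ℓ) allow)
      (true-does (succeeds? text h (centre x)) (pal⇒succeeds text even (≤-trans (limit-≥ ℓ h) inside) x≤2h h≤n pal))
      where open Success (hit⇒success X)

    advance-block : t₀ + 6 * Λ ≤ h → ∀ σ′ → (∀ k → h ≡ suc k → t₀ + 6 * Λ ≤ k → AfterBlock k σ′) →
                    AfterBlock h (advance σ′) × Finds h (attempted σ′)
    advance-block from σ′ prior = proj₁ result , finds
      where
      result = Advance.AtTime.advance-correct (letter text) (i * 2 ^ a) (2 ^ a) (2 ^ ℓ) (limit ℓ) (2^>0 a)
          (2^>0 ℓ) g≤Λ g∣t₀ g∣Λ (limit-mono ℓ) (limit-≥ ℓ)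
                 sweepable h from (palindrome h) hit-sound hit-complete σ′ prior
      finds : Finds h (attempted σ′)
      finds v x≡ fr un v≤h X =
        let x″ , le , H , m = proj₂ result (swept-at v x≡ fr un (s≤s v≤h) (Success.even X) (Pal-≤ v≤h (Success.pal X))) (success⇒hit X)
        in x″ , le , hit⇒success H , m

  main : Program
  main = mainWith pairCode

  stepBound : ℕ
  stepBound = 1 + startTime + 2 * passCostOf pairCode

  time-fits : ∀ c p l m t → l ≤ m → t ≤ c + suc (2 * m + 1) * p → suc l + t ≤ (1 + c + 2 * p) * suc m
  time-fits c p l m t l≤m t≤ = ≤-trans (+-mono-≤ (s≤s l≤m) (≤-trans t≤ (+-monoˡ-≤ _ (m≤m+n c (c * m)))))
    (≤-reflexive (expand c p m))
    where
    expand : ∀ c p m → suc m + (c + c * m + suc (2 * m + 1) * p) ≡ (1 + c + 2 * p) * suc m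
    expand = solve-∀

  record Outcome (i : Fin n) (m : Memory) (r : ℕ) : Set where
    field
      m′         : Memory
      r′ t       : ℕ
      rs         : List ℕ
      derivation : Machine._,_⇓_,_,_ w s S text i main ⟨ m , r ⟩ ⟨ m′ , r′ ⟩ t rs
      in-time    : t ≤ startTime + suc (2 * lg + 1) * passCostOf pairCode
      state      : State-at (suc (toℕ i)) m′
      guaranteed : Guarantee S text (suc (toℕ i)) rs

  -- One character: the loop over the pairs of a scale and a level

  module Loop (i : Fin n) where

    h : ℕ
    h = suc (toℕ i)

    h≤n : h ≤ n
    h≤n = toℕ<n i

    record Env (m : Memory) : Set where
      field
        time≡    : m 0 ≡ h
        level≤   : m 3 ≤ L S
        spacing≡ : m 2 ≡ 2 ^ m 3
        limit≡   : m 5 ≡ limit (m 3) h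

    abstract

      Env-pres : ∀ {m} a v → 7 ≤ a → Env m → Env (m [ a ≔ v ])
      Env-pres {m} a v 7≤a E = record
        { time≡ = trans (same 0 (≤ᵇ⇒≤ 1 7 tt)) time≡ ; level≤ = subst (_≤ L S) (sym (same 3 (≤ᵇ⇒≤ 4 7 tt))) level≤
        ; spacing≡ = trans (same 2 (≤ᵇ⇒≤ 3 7 tt)) (trans spacing≡ (cong (2 ^_) (sym (same 3 (≤ᵇ⇒≤ 4 7 tt)))))
        ; limit≡ = trans (same 5 (≤ᵇ⇒≤ 6 7 tt)) (trans limit≡ (cong (λ ℓ → limit ℓ h) (sym (same 3 (≤ᵇ⇒≤ 4 7 tt))))) }
        where
        open Env E
        same : ∀ r → r < 7 → (m [ a ≔ v ]) r ≡ m r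
        same r r<7 = update-other m a v r (<⇒≢ (<-≤-trans r<7 7≤a))

      runnable : ∀ {m x} → Env m → Semantics.permitted (paramValue S w) (λ _ → false) m x ≡ true → Runnable
          S h (centre x)
      runnable {m} {x} E e = allowed-runnable (m 3) level≤ (allowed-sound {h} {2 ^ m 3} {limit (m 3) h} {x} (2^>0 (m 3))
        (subst (λ R → allowed h (2 ^ m 3) R x ≡ true) limit≡
          (subst₂ (λ t g → allowed t g (m 5) x ≡ true) time≡ spacing≡ e)))
        where open Env E

    open Execution w s S text i M M≥2 powers L<M s≥40 s≤ (succeeds? text h) Env Env-pres runnable
      using (Bounded; Executes; executes; Safely; execute; execute-seq; execute-register;
             write-register; write-base; evaluates; M≤M^1)
    open Machine w s S text i using (_,_⇓_,_,_; while-nonzero; while-zero; _⊢_⇓_)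
    open Pass (paramValue S w) (palindrome h)
    open Bounded using (base)

    module Abstract (step : Context → Slot → Slot) (log : Context → Slot → List ℕ)
      (block-correct : ∀ a ℓ j (U : Useful a ℓ) → j * 2 ^ a + 6 * 2 ^ a ≤ h → ∀ σ′ →
         (∀ k → h ≡ suc k → j * 2 ^ a + 6 * 2 ^ a ≤ k → Tracked.AfterBlock a ℓ j U k σ′) →
         Tracked.AfterBlock a ℓ j U h (step (context (j * 2 ^ a) (2 ^ a) (2 ^ ℓ) h (limit ℓ h)) σ′) ×
         Tracked.Finds a ℓ j U h (log (context (j * 2 ^ a) (2 ^ a) (2 ^ ℓ) h (limit ℓ h)) σ′))
      (pair : Code) (pair-safe : T (safe true pair))
      (pair-effect : ∀ {Λ g base R m} → Registers h Λ g base R m →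
         Geometry.PairDone step log {h} {Λ} {g} {base} {R} 8 6 m (memory pair m) (runs pair m))
      (m⁰ : Memory)
      (old-slots : Slots (toℕ i) m⁰)
      where

      DoneSlots : ℕ → Memory → List ℕ → Set
      DoneSlots k m xs = ∀ (U : Useful (scaleAt k) (levelAt k)) j → Active (scaleAt k) j h →
        Tracked.AfterBlock (scaleAt k) (levelAt k) j U h (slot-at m (slot-offset k j)) ×
        Tracked.Finds (scaleAt k) (levelAt k) j U h xs

      DoneDirect : ℕ → List ℕ → Set
      DoneDirect k xs = ∀ u → u < 8 → let g = 2 ^ levelAt k ; x = h + (h ∸ ⟦ rem ⟧ h g ∸ u * g) in
                        allowed h g (limit (levelAt k) h) x ≡ true → x ∈ xs

      Done : ℕ → Memory → List ℕ → Set
      Done idx m xs = ∀ k → k < idx → DoneSlots k m xs × DoneDirect k xs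

      record Position (idx : ℕ) (m : Memory) : Set where
        field
          in-bounds : Bounded m
          time≡    : m 0 ≡ h
          scale≡   : m 1 ≡ 2 ^ scaleAt idx
          spacing≡ : m 2 ≡ 2 ^ levelAt idx
          level≡   : m 3 ≡ levelAt idx
          base≡    : m 4 ≡ 64 * idx
          -- The storage of the pairs not yet visited is as the previous character left it.
          fresh    : ∀ j → 64 * idx ≤ j → m (32 + j) ≡ m⁰ (32 + j)

      passTime : ℕ
      passTime = passTimeOf pair

      finds-⊆ : ∀ {a ℓ} j (U : Useful a ℓ) {xs ys} → (∀ {y} → y ∈ xs → y ∈ ys) → Tracked.Finds a ℓ j U h xs
          → Tracked.Finds a ℓ j U h ys
      finds-⊆ j U included f {x} v x≡ fr un v≤ X = let x″ , le , X″ , m = f v x≡ fr un v≤ X in x″ , le , X″ , included m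

      module _ {idx : ℕ} {m : Memory} {xs : List ℕ} (P : Position idx m) (done : Done idx m xs)
               (2^a≤h : 2 ^ scaleAt idx ≤ h) (room : 64 * suc idx + 64 + 32 ≤ s) where
        open Position P

        private
          a ℓ q : ℕ
          a = scaleAt idx
          ℓ = levelAt idx
          q = ⟦ quo ⟧ h (2 ^ a)
          ℓ≤L = Valid.ℓ≤L (valid idx)
          m₁ m₂ m₃ m₄ : Memory
          m₁ = memory setupCode m
          m₂ = memory pair m₁
          m₃ = memory proceedCode m₂
          m₄ = m₃ [ 4 ≔ m₃ 4 + 64 ]

          module Setup = SetupDone (setup-done m)

          size₁ : m₁ 6 ≡ sizeOf ℓ
          size₁ = trans Setup.size≡ (cong sizeOf level≡)

          level₁ : m₁ 3 ≡ ℓ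
          level₁ = trans Setup.level≡ level≡

          R₀ = limit ℓ h

          registers-cong : ∀ {t t′ Λ Λ′ g g′ d d′ R R′} → t ≡ t′ → Λ ≡ Λ′ → g ≡ g′ → d ≡ d′ → R ≡ R′ →
                           Registers t Λ g d R m₁ → Registers t′ Λ′ g′ d′ R′ m₁
          registers-cong refl refl refl refl refl r = r

          registers₁ : Registers h (2 ^ a) (2 ^ ℓ) (64 * idx) R₀ m₁
          registers₁ = registers-cong time≡ scale≡ spacing≡ base≡ R≡ Setup.setup-registers
            where
            R≡ : limitOf (m 2) (m₁ 6) (m 0) ≡ R₀
            R≡ = trans (cong₂ (λ g z → limitOf g z (m 0)) spacing≡ size₁) (cong (limitOf (2 ^ ℓ) (sizeOf ℓ)) time≡)

          env₁ : Env m₁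
          env₁ = record
            { time≡ = Registers.time≡ registers₁ ; level≤ = subst (_≤ L S) (sym level₁) ℓ≤L
            ; spacing≡ = trans (Registers.spacing≡ registers₁) (cong (2 ^_) (sym level₁))
            ; limit≡ = trans (Registers.limit≡ registers₁) (cong (λ ℓ → limit ℓ h) (sym level₁)) }

          setup : Safely false setupCode m
          setup = execute false setupCode tt in-bounds (λ ())

          paired : Safely true pair m₁
          paired = execute true pair pair-safe (Safely.bounded′ setup) (λ _ → env₁)

          proceeding : Safely false proceedCode m₂
          proceeding = execute false proceedCode tt (Safely.bounded′ paired) (λ ())

          module Pair = Geometry.PairDone {step} {log} (pair-effect registers₁)

          level₂ : m₂ 3 ≡ ℓ
          level₂ = trans Pair.level′ level₁

          size₂ : m₂ 6 ≡ sizeOf ℓ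
          size₂ = trans Pair.size′ size₁

          up-fits : m₂ 3 < L S → m₂ 6 < ⟦ quo ⟧ (16 * 2 ^ a) (2 ^ m₂ 3) → 2 ^ m₂ 3 ≤ m₂ 0
          up-fits _ big = subst₂ _≤_ (cong (2 ^_) (sym level₂)) (sym (Registers.time≡ Pair.registers′))
            (≤-trans (^-monoʳ-≤ 2 (up-level a ℓ ℓ≤L (subst₂ (λ z ℓ → z < ⟦ quo ⟧ (16 * 2 ^ a) (2 ^ ℓ))
                size₂ level₂ big))) 2^a≤h)

          module Proceed = ProceedDone (proceed-done m₂ a (Registers.scale≡ Pair.registers′)
            (trans (Registers.spacing≡ Pair.registers′) (cong (2 ^_) (sym level₂)))
            (subst (2 ^ a ≤_) (sym (Registers.time≡ Pair.registers′)) 2^a≤h) up-fits)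

          next≡ : nextPair (L S) (m₂ 6) a (m₂ 3) ≡ walk (suc idx)
          next≡ = cong₂ (λ z ℓ → nextPair (L S) z a ℓ) size₂ level₂

          base₃ : m₃ 4 ≡ 64 * idx
          base₃ = trans Proceed.base≡ (Registers.base≡ Pair.registers′)

          base₄ : m₃ 4 + 64 ≡ 64 * suc idx
          base₄ = (lin≡ ((m₃ 4) ∷ idx ∷ []) ((1 , # 0 , 64 ⊛ (# 1)) ∷ []) (# 0 ⊕ con 64) (64 ⊛ (con 1 ⊕ # 1)) base₃)

          stepping : Executes (store (lit 4) (reg 4 +ₑ lit 64)) m₃ m₄ (suc (1 + cost (reg 4 +ₑ lit 64))) []
          stepping = execute-register (Safely.bounded′ proceeding) tt tt

          outside : ∀ j → j < 64 * idx ⊎ 64 * idx + 64 ≤ j → m₄ (32 + j) ≡ m (32 + j)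
          outside j out = trans (Proceed.cells j) (trans (Pair.others j out) (Setup.cells j))

          slot-bound : ∀ {k} j f → f < 7 → f + slot-offset k j < 64 * suc k
          slot-bound {k} j f f< = (lin ((⟦ rem ⟧ j 8) ∷ f ∷ k ∷ []) 1
              ((8 , con 1 ⊕ # 0 , con 8) ∷ (1 , con 1 ⊕ # 1 , con 7) ∷ [])
              (con 1 ⊕ (# 1 ⊕ ((64 ⊛ (# 2)) ⊕ (8 ⊛ (# 0))))) (64 ⊛ (con 1 ⊕ # 2)) (m%n<n j 8) f<)

          earlier : ∀ k → k < idx → DoneSlots k m₄ (xs ++ runs pair m₁) × DoneDirect k (xs ++ runs pair m₁)
          earlier k k<idx =
            (λ U j act → let A , F = proj₁ (done k k<idx) U j act in
               subst (Tracked.AfterBlock (scaleAt k) (levelAt k) j U h)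
                 (sym (slot-at-≡ {m} {m₄} (slot-offset k j) (λ f f< → outside (f + slot-offset k j)
                   (inj₁ (<-≤-trans (slot-bound {k} j f f<) (*-monoʳ-≤ 64 k<idx)))))) A ,
               finds-⊆ j U ∈-++⁺ˡ F) ,
            (λ u u< ok → ∈-++⁺ˡ (proj₂ (done k k<idx) u u< ok))

          module Current (U : Useful a ℓ) (j : ℕ) (active : Active a j h) where
            k : ℕ
            k = slot-offset idx j

            q≡ : 6 + j ≤ q
            q≡ = ≤-pred (*-cancelʳ-< (2 ^ a) (6 + j) (suc q)
              (≤-<-trans (≤-trans (≤-reflexive (*-distribʳ-+ (2 ^ a) 6 j))
                  (lin ((j * 2 ^ a) ∷ (2 ^ a) ∷ h ∷ []) 1 ((1 , # 0 ⊕ (6 ⊛ (# 1)) , # 2) ∷ [])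
                  ((6 ⊛ (# 1)) ⊕ # 0) (# 2) (proj₁ active)))
                         (quo-upper h (2 ^ a) (2^>0 a))))

            q< : q < 12 + j
            q< = *-cancelʳ-< (2 ^ a) q (12 + j) (≤-<-trans (quo-lower h (2 ^ a) (2^>0 a))
                   (<-≤-trans (proj₂ active) (≤-reflexive (trans (+-comm (j * 2 ^ a) (12 * 2 ^ a))
                       (sym (*-distribʳ-+ (2 ^ a) 12 j))))))

            j≤q : j ≤ q
            j≤q = ≤-trans (m≤n+m j 6) q≡

            u : ℕ
            u = q ∸ j

            q∸u : q ∸ u ≡ j
            q∸u = m∸[m∸n]≡n j≤q

            6≤u : 6 ≤ u
            6≤u = m+n≤o⇒m≤o∸n 6 q≡

            u<12 : u < 12
            u<12 = (lin ((q ∸ j) ∷ j ∷ q ∷ []) 1 ((1 , # 0 ⊕ # 1 , # 2) ∷ (1 , con 1 ⊕ # 2 , con 12 ⊕ # 1)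
                ∷ []) (con 1 ⊕ # 0) (con 12) (≤-reflexive (m∸n+n≡m j≤q)) q<)

            offset≡ : Geometry.offset step log {h} {2 ^ a} {2 ^ ℓ} {64 * idx} {R₀} u ≡ k
            offset≡ = cong (λ j → 64 * idx + 8 * ⟦ rem ⟧ j 8) q∸u

            origin≡ : h ∸ ⟦ rem ⟧ h (2 ^ a) ∸ u * 2 ^ a ≡ j * 2 ^ a
            origin≡ = trans (cong (_∸ u * 2 ^ a) (trans (cong (_∸ ⟦ rem ⟧ h (2 ^ a)) (rem-quo h (2 ^ a) (2^>0 a)))
                (m+n∸m≡n (⟦ rem ⟧ h (2 ^ a)) (q * 2 ^ a))))
              (trans (sym (*-distribʳ-∸ (2 ^ a) q u)) (cong (_* 2 ^ a) q∸u))

            ctx : Context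
            ctx = context (j * 2 ^ a) (2 ^ a) (2 ^ ℓ) h R₀

            context≡ : Geometry.contextOf step log {h} {2 ^ a} {2 ^ ℓ} {64 * idx} {R₀} u ≡ ctx
            context≡ = cong (λ t → context t (2 ^ a) (2 ^ ℓ) h R₀) origin≡

            slot₁ : slot-at m₁ k ≡ slot-at m⁰ k
            slot₁ = slot-at-≡ {m⁰} {m₁} k (λ f _ → trans (Setup.cells (f + k))
                (fresh (f + k) (lin (idx ∷ f ∷ (⟦ rem ⟧ j 8) ∷ []) 1 [] (64 ⊛ (# 0))
                (# 1 ⊕ ((64 ⊛ (# 0)) ⊕ (8 ⊛ (# 2)))))))

            slot₄ : slot-at m₄ k ≡ slot-at m₂ k
            slot₄ = slot-at-≡ {m₂} {m₄} k (λ f _ → Proceed.cells (f + k))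

            stepped : slot-at m₄ k ≡ step ctx (slot-at m⁰ k)
            stepped = trans slot₄ (trans (cong (slot-at m₂) (sym offset≡)) (trans (Pair.advanced u 6≤u u<12 (m∸n≤m q j))
              (cong₂ step context≡ (trans (cong (slot-at m₁) offset≡) slot₁))))

            logged : ∀ {y} → y ∈ log ctx (slot-at m⁰ k) → y ∈ xs ++ runs pair m₁
            logged y∈ = ∈-++⁺ʳ xs (Pair.tried u 6≤u u<12 (m∸n≤m q j)
              (subst (_ ∈_) (sym (cong₂ log context≡ (trans (cong (slot-at m₁) offset≡) slot₁))) y∈))

            prior : ∀ k′ → h ≡ suc k′ → j * 2 ^ a + 6 * 2 ^ a ≤ k′ → Tracked.AfterBlock a ℓ j U k′ (slot-at m⁰ k)
            prior k′ refl from = old-slots idx U j (from , <-trans (n<1+n k′) (proj₂ active))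

            correct = block-correct a ℓ j U (proj₁ active) (slot-at m⁰ k) prior

          current : DoneSlots idx m₄ (xs ++ runs pair m₁) × DoneDirect idx (xs ++ runs pair m₁)
          current =
            (λ U j act → let open Current U j act in
               subst (Tracked.AfterBlock a ℓ j U h) (sym stepped) (proj₁ correct) , finds-⊆ j U logged
                   (proj₂ correct)) ,
            (λ u u< ok → ∈-++⁺ʳ xs (Pair.direct-∈ u u< ok))

          all-done : Done (suc idx) m₄ (xs ++ runs pair m₁)
          all-done k k< = by-case (m≤n⇒m<n∨m≡n (≤-pred k<))
            where
            by-case : ∀ {k} → k < idx ⊎ k ≡ idx → DoneSlots k m₄ (xs ++ runs pair m₁) × DoneDirect k
                (xs ++ runs pair m₁)
            by-case (inj₁ k<idx) = earlier _ k<idx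
            by-case (inj₂ refl)  = current

          ys : List ℕ
          ys = runs setupCode m ++ runs pair m₁ ++ runs proceedCode m₂ ++ []

          only-pair : ys ≡ runs pair m₁
          only-pair = trans (cong₂ (λ as cs → as ++ runs pair m₁ ++ cs ++ []) (quiet-runs setupCode m tt)
              (quiet-runs proceedCode m₂ tt))
                            (++-identityʳ (runs pair m₁))

          position : Position (suc idx) m₄
          position = record
            { in-bounds = write-base (m₃ 4 + 64) (subst (λ v → v + 64 + 32 ≤ s) (sym base₄) room)
                (Safely.bounded′ proceeding)
            ; time≡ = trans Proceed.time≡ (Registers.time≡ Pair.registers′)
            ; scale≡ = trans Proceed.scale≡ (cong (λ p → 2 ^ proj₁ p) next≡)
            ; spacing≡ = trans Proceed.spacing≡ (cong (λ p → 2 ^ proj₂ p) next≡)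
            ; level≡ = trans Proceed.level≡ (cong proj₂ next≡)
            ; base≡ = base₄
            ; fresh = λ j le → trans (outside j (inj₂ (lin (idx ∷ j ∷ []) 1
                ((1 , 64 ⊛ (con 1 ⊕ # 0) , # 1) ∷ []) ((64 ⊛ (# 0)) ⊕ con 64) (# 1) le)))
                (fresh j (lin (idx ∷ j ∷ []) 1 ((1 , 64 ⊛ (con 1 ⊕ # 0) , # 1) ∷ []) (64 ⊛ (# 0)) (# 1) le)) }

        abstract

          pass : ∃[ m′ ] ∃[ ys ] Executes (bodyWith pair) m m′ passTime ys × Position (suc idx) m′ × Done
              (suc idx) m′ (xs ++ ys)
          pass = m₄ , ys ,
            execute-seq (Safely.execution setup) (execute-seq (Safely.execution paired)
                (execute-seq (Safely.execution proceeding) stepping)) ,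
            position , subst (λ ys → Done (suc idx) m₄ (xs ++ ys)) (sym only-pair) all-done

      passCost : ℕ
      passCost = passCostOf pair

      abstract

        index-bound : ∀ {idx} → 2 ^ scaleAt idx ≤ h → idx ≤ 2 * lg
        index-bound {idx} le = subst (_≤ 2 * lg) (Valid.total (valid idx))
          (lin ((scaleAt idx) ∷ (⌊log₂ h ⌋) ∷ lg ∷ (levelAt idx) ∷ (L S) ∷ []) 1
              ((1 , # 0 , # 1) ∷ (1 , # 1 , # 2) ∷ (1 , # 3 , # 4) ∷ (1 , # 4 , # 2) ∷ []) (# 0 ⊕ # 3)
              (2 ⊛ (# 2)) (2^-log {scaleAt idx} le) (⌊log₂⌋-mono-≤ h≤n) (Valid.ℓ≤L (valid idx)) L≤)

        room : ∀ {idx} → idx ≤ 2 * lg → 64 * suc idx + 64 + 32 ≤ s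
        room {idx} idx≤ = (lin (idx ∷ lg ∷ []) 1 ((64 , # 0 , 2 ⊛ (# 1)) ∷ [])
            (((64 ⊛ (con 1 ⊕ # 0)) ⊕ con 64) ⊕ con 32) (256 ⊛ (con 1 ⊕ # 1)) idx≤)

        continue⇓ : ∀ {idx m} → Position idx m → ∀ {c} → (2 ^ scaleAt idx <ᵇ h + 1) ≡ c → m ⊢ continueₑ ⇓
            (if c then 1 else 0)
        continue⇓ {idx} {m} P e = subst (m ⊢ continueₑ ⇓_)
          (cong (λ c → if c then 1 else 0) (trans (cong₂ (λ Λ t → Λ <ᵇ t + 1) scale≡ time≡) e))
          (proj₁ (evaluates in-bounds continueₑ tt))
          where open Position P

      stop-time : ∀ c p y → suc c ≤ p + suc c + y
      stop-time c p y = (lin (c ∷ p ∷ y ∷ []) 1 [] (con 1 ⊕ # 0) ((# 1 ⊕ (con 1 ⊕ # 0)) ⊕ # 2))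

      step-time : ∀ c p y t → t ≤ p + y → suc (c + t) ≤ p + suc c + y
      step-time c p y t t≤ = (lin (t ∷ p ∷ y ∷ c ∷ []) 1 ((1 , # 0 , # 1 ⊕ # 2) ∷ []) (con 1 ⊕ (# 3 ⊕ # 0))
          ((# 1 ⊕ (con 1 ⊕ # 3)) ⊕ # 2) t≤)

      Looped : ℕ → ℕ → Memory → List ℕ → Set
      Looped fuel idx m xs = ∃[ idx′ ] ∃[ m′ ] ∃[ ys ] Executes (while continueₑ (bodyWith pair)) m m′
          (suc fuel * passCost) ys ×
        Position idx′ m′ × Done idx′ m′ (xs ++ ys) × h < 2 ^ scaleAt idx′

      -- The fuel cannot run out: the loop continues only while the scale is at most `h`, and then
      -- `index-bound` gives `idx ≤ 2 * lg`.
      loop : ∀ fuel idx m xs → Position idx m → Done idx m xs → 2 * lg + 1 ≤ fuel + idx → Looped fuel idx m xs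
      loop fuel idx m xs P D enough = by-test fuel enough (2 ^ scaleAt idx <ᵇ h + 1) refl
        where
        by-test : ∀ fuel → 2 * lg + 1 ≤ fuel + idx → ∀ c → (2 ^ scaleAt idx <ᵇ h + 1) ≡ c → Looped fuel idx m xs
        by-test fuel _ false e = idx , m , [] ,
          executes (λ r → r , _ , [] , while-zero (continue⇓ P e) , stop-time (cost continueₑ) passTime
              (fuel * passCost) , λ ()) ,
          P , subst (Done idx m) (sym (++-identityʳ xs)) D , subst (_≤ 2 ^ scaleAt idx) (+-comm h 1)
              (<ᵇ-false {2 ^ scaleAt idx} {h + 1} e)
        by-test fuel enough true e = continue-with fuel enough
          where
          small : 2 ^ scaleAt idx ≤ h
          small = ≤-pred (subst (2 ^ scaleAt idx <_) (+-comm h 1) (<ᵇ-true {2 ^ scaleAt idx} {h + 1} e))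
          idx≤ : idx ≤ 2 * lg
          idx≤ = index-bound {idx} small
          continue-with : ∀ fuel → 2 * lg + 1 ≤ fuel + idx → Looped fuel idx m xs
          continue-with zero enough = contradiction idx≤ (<⇒≱ (subst (_≤ idx) (+-comm (2 * lg) 1) enough))
          continue-with (suc fuel) enough =
            let m₁ , ys₁ , X₁ , P₁ , D₁ = pass {idx} {m} {xs} P D small (room idx≤)
                idx′ , m′ , ys , X , P′ , D′ , end = loop fuel (suc idx) m₁ (xs ++ ys₁) P₁ D₁ (more fuel enough)
            in idx′ , m′ , ys₁ ++ ys , chain X₁ X , P′ , subst (Done idx′ m′) (++-assoc xs ys₁ ys) D′ , end
            where
            more : ∀ fuel → 2 * lg + 1 ≤ suc fuel + idx → 2 * lg + 1 ≤ fuel + suc idx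
            more fuel enough = subst (2 * lg + 1 ≤_) (sym (+-suc fuel idx)) enough
            chain : ∀ {m₁ m′ ys₁ ys} → Executes (bodyWith pair) m m₁ passTime ys₁ →
                    Executes (while continueₑ (bodyWith pair)) m₁ m′ (suc fuel * passCost) ys →
                    Executes (while continueₑ (bodyWith pair)) m m′ (suc (suc fuel) * passCost) (ys₁ ++ ys)
            chain {m₁} {m′} {ys₁} {ys} X₁ X = executes λ r →
                let r″ , t , rs , δ , le , ∈rs = Executes.derive (execute-seq X₁ X) r in
                r″ , suc (cost continueₑ + t) , rs , while-nonzero (continue⇓ P e) δ ,
                step-time (cost continueₑ) passTime (suc fuel * passCost) t le , λ y∈ → ∈rs y∈

      module Covered {idx′ m′ xs} (D : Done idx′ m′ xs) (end : h < 2 ^ scaleAt idx′) where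

        Found : ℕ → Set
        Found x = ∃[ x″ ] x″ ≤ x × (∃[ ℓ ] ℓ ≤ L S × Success ℓ h x″) × x″ ∈ xs

        FoundSlots : ℕ × ℕ → Set
        FoundSlots (a , ℓ) = ∀ (U : Useful a ℓ) j → Active a j h → Tracked.Finds a ℓ j U h xs

        FoundDirect : ℕ × ℕ → Set
        FoundDirect (_ , ℓ) = ∀ u → u < 8 → let g = 2 ^ ℓ ; x = h + (h ∸ ⟦ rem ⟧ h g ∸ u * g) in
                              allowed h g (limit ℓ h) x ≡ true → x ∈ xs

        -- The loop stopped at a scale above `h`. Since scales never decrease along the walk, a pair
        -- on it with a scale of at most `h` came before.
        visited : ∀ {a ℓ} → walk (a + ℓ) ≡ (a , ℓ) → 2 ^ a ≤ h → FoundSlots (a , ℓ) × FoundDirect (a , ℓ)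
        visited {a} {ℓ} at 2^a≤h = subst (λ p → FoundSlots p × FoundDirect p) at
          ((λ U j act → proj₂ (proj₁ (D k k<) U j act)) , proj₂ (D k k<))
          where
          k = a + ℓ
          k< : k < idx′
          k< = ≰⇒> (λ idx′≤k → <⇒≱ (<-≤-trans end (^-monoʳ-≤ 2
              (subst (scaleAt idx′ ≤_) (cong proj₁ at) (walk-grows idx′≤k)))) 2^a≤h)

        module _ (t ℓ : ℕ) (ℓ≤L : ℓ ≤ L S) (g∣t : 2 ^ ℓ ∣ t) (t≤h : t ≤ h) (near : h < t + sizeOf ℓ * 2 ^ ℓ)
                 (far : ∀ k → k < ℓ → t + sizeOf k * 2 ^ k ≤ h) (2∣x : 2 ∣ t + h) (P : Pal (t + h) h) where

          private
            x₀ D₀ : ℕ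
            x₀ = t + h
            D₀ = h ∸ t
            D₀+t : D₀ + t ≡ h
            D₀+t = m∸n+n≡m t≤h

          success₀ : Success ℓ h x₀
          success₀ = record { allow = record
            { inside = limitOf-intro {2 ^ ℓ} {sizeOf ℓ} (2^>0 ℓ) g∣t near ; divides′ = subst (2 ^ ℓ ∣_)
                (sym (m+n∸n≡m t h)) g∣t
            ; even = 2∣x ; x≤2h = +-monoˡ-≤ h t≤h } ; pal = P }

          narrow-below : ∀ {a} → D₀ < 16 * 2 ^ a → ∀ k → k < ℓ → sizeOf k * 2 ^ k < 16 * 2 ^ a
          narrow-below {a} D< k k<ℓ = (lin (t ∷ (sizeOf k * 2 ^ k) ∷ h ∷ D₀ ∷ (2 ^ a) ∷ []) 1
              ((1 , # 0 ⊕ # 1 , # 2) ∷ (1 , # 2 , # 3 ⊕ # 0) ∷ (1 , con 1 ⊕ # 3 , 16 ⊛ (# 4)) ∷ [])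
              (con 1 ⊕ # 1) (16 ⊛ (# 4)) (far k k<ℓ) (≤-reflexive (sym D₀+t)) D<)

          found-direct : FoundDirect (0 , ℓ) → D₀ < 8 * 2 ^ ℓ → Found x₀
          found-direct F D< = x₀ , ≤-refl , (ℓ , ℓ≤L , success₀) ,
                  subst (_∈ xs) x≡ (F u u<8 (subst (λ x → allowed h g (limit ℓ h) x ≡ true) (sym x≡)
                      (allowed-complete (2^>0 ℓ) (Success.allow success₀))))
            where
            g q k u : ℕ
            g = 2 ^ ℓ
            q = ⟦ quo ⟧ h g
            k = quotient g∣t
            u = q ∸ k
            t≡ : t ≡ k * g
            t≡ = _∣_.equality g∣t
            k≤q : k ≤ q
            k≤q = ≤-pred (*-cancelʳ-< g k (suc q) (≤-<-trans (subst (_≤ h) t≡ t≤h) (quo-upper h g (2^>0 ℓ))))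
            u+k : u + k ≡ q
            u+k = m∸n+n≡m k≤q
            x≡ : h + (h ∸ ⟦ rem ⟧ h g ∸ u * g) ≡ t + h
            x≡ = trans (cong (h +_) (trans (cong (_∸ u * g) (trans
                (cong (_∸ ⟦ rem ⟧ h g) (rem-quo h g (2^>0 ℓ))) (m+n∸m≡n (⟦ rem ⟧ h g) (q * g))))
                   (trans (sym (*-distribʳ-∸ g q u)) (cong (_* g) (trans (cong (_∸ u) (sym u+k)) (m+n∸m≡n u k))))))
                   (trans (+-comm h (k * g)) (cong (_+ h) (sym t≡)))
            ug : u * g + k * g ≤ h
            ug = ≤-trans (≤-reflexive (trans (sym (*-distribʳ-+ g u k)) (cong (_* g) u+k))) (quo-lower h g (2^>0 ℓ))
            u<8 : u < 8
            u<8 = *-cancelʳ-< g u 8 (lin ((u * g) ∷ (k * g) ∷ h ∷ D₀ ∷ t ∷ g ∷ []) 1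
                ((1 , # 0 ⊕ # 1 , # 2) ∷ (1 , # 2 , # 3 ⊕ # 4) ∷ (1 , # 4 , # 1) ∷
                (1 , con 1 ⊕ # 3 , 8 ⊛ (# 5)) ∷ []) (con 1 ⊕ # 0) (8 ⊛ (# 5)) ug (≤-reflexive (sym D₀+t))
                (≤-reflexive t≡) D<)

          found-slot : ∀ a → ℓ ≤ a → 8 * 2 ^ a ≤ D₀ → D₀ < 16 * 2 ^ a → Found x₀
          found-slot a ℓ≤a ≤D D< = package (proj₁ (visited {a} {ℓ}
              (Reach.reached a ℓ ℓ≤L wide (narrow-below {a} D<)) 2^a≤h) U j (low , high) v x≡ from until
              v≤h success₀)
            where
            Λ : ℕ
            Λ = 2 ^ a
            wide : 8 * Λ ≤ sizeOf ℓ * 2 ^ ℓ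
            wide = (lin (Λ ∷ D₀ ∷ t ∷ h ∷ (sizeOf ℓ * 2 ^ ℓ) ∷ []) 1
                ((1 , 8 ⊛ (# 0) , # 1) ∷ (1 , # 1 ⊕ # 2 , # 3) ∷ (1 , con 1 ⊕ # 3 , # 2 ⊕ # 4) ∷ [])
                (8 ⊛ (# 0)) (# 4) ≤D (≤-reflexive D₀+t) near)
            U : Useful a ℓ
            U = record { ℓ≤a = ℓ≤a ; wide = wide }
            2^a≤h : Λ ≤ h
            2^a≤h = (lin (Λ ∷ D₀ ∷ t ∷ h ∷ []) 8 ((1 , 8 ⊛ (# 0) , # 1) ∷ (1 , # 1 ⊕ # 2 , # 3) ∷ []) (# 0)
                (# 3) ≤D (≤-reflexive D₀+t))
            0<2Λ : 0 < Λ + Λ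
            0<2Λ = ≤-trans (2^>0 a) (m≤m+n Λ Λ)
            -- Division of `x₀ - 6 * Λ` by `2 * Λ` finds the block `j` whose sweep met this centre:
            -- `x₀ = 2 * j * Λ + 6 * Λ + r` with `r < 2 * Λ`, and `v` is the time of the meeting.
            y r j v : ℕ
            y = x₀ ∸ 6 * Λ
            r = ⟦ rem ⟧ y (Λ + Λ)
            j = ⟦ quo ⟧ y (Λ + Λ)
            v = 6 * Λ + r + j * Λ
            y+6Λ : y + 6 * Λ ≡ x₀
            y+6Λ = m∸n+n≡m (lin (Λ ∷ D₀ ∷ t ∷ h ∷ []) 4 ((3 , 8 ⊛ (# 0) , # 1) ∷ (3 , # 1 ⊕ # 2 , # 3) ∷
                []) (6 ⊛ (# 0)) (# 2 ⊕ # 3) ≤D (≤-reflexive D₀+t))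
            y≡ : y ≡ r + (j * Λ + j * Λ)
            y≡ = trans (rem-quo y (Λ + Λ) 0<2Λ) (cong (r +_) (*-distribˡ-+ j Λ Λ))
            r< : r < Λ + Λ
            r< = (lin (y ∷ Λ ∷ (j * (Λ + Λ)) ∷ r ∷ []) 1 ((1 , con 1 ⊕ # 0 , (# 1 ⊕ # 1) ⊕ # 2) ∷
                (1 , # 3 ⊕ # 2 , # 0) ∷ []) (con 1 ⊕ # 3) (# 1 ⊕ # 1) (quo-upper y (Λ + Λ) 0<2Λ)
                (≤-reflexive (sym (rem-quo y (Λ + Λ) 0<2Λ))))
            x≡ : x₀ ≡ j * Λ + v
            x≡ = (lin≡ (y ∷ Λ ∷ x₀ ∷ r ∷ (j * Λ) ∷ []) ((1 , # 2 , # 0 ⊕ (6 ⊛ (# 1))) ∷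
                (1 , # 0 , # 3 ⊕ (# 4 ⊕ # 4)) ∷ []) (# 2) (# 4 ⊕ (((6 ⊛ (# 1)) ⊕ # 3) ⊕ # 4)) (sym y+6Λ) y≡)
            from : j * Λ + 6 * Λ ≤ v
            from = (lin ((j * Λ) ∷ Λ ∷ r ∷ []) 1 [] (# 0 ⊕ (6 ⊛ (# 1))) (((6 ⊛ (# 1)) ⊕ # 2) ⊕ # 0))
            until : v < j * Λ + 8 * Λ
            until = (lin (r ∷ Λ ∷ (j * Λ) ∷ []) 1 ((1 , con 1 ⊕ # 0 , # 1 ⊕ # 1) ∷ [])
                (con 1 ⊕ (((6 ⊛ (# 1)) ⊕ # 0) ⊕ # 2)) (# 2 ⊕ (8 ⊛ (# 1))) r<)
            v≤h : v ≤ h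
            v≤h = (lin (t ∷ h ∷ (j * Λ) ∷ Λ ∷ r ∷ D₀ ∷ []) 2
                ((1 , # 2 ⊕ (((6 ⊛ (# 3)) ⊕ # 4) ⊕ # 2) , # 0 ⊕ # 1) ∷ (1 , con 1 ⊕ # 4 , # 3 ⊕ # 3) ∷
                (1 , 8 ⊛ (# 3) , # 5) ∷ (1 , # 5 ⊕ # 0 , # 1) ∷ []) (((6 ⊛ (# 3)) ⊕ # 4) ⊕ # 2) (# 1)
                (≤-reflexive (sym x≡)) r< ≤D (≤-reflexive D₀+t))
            low : j * Λ + 6 * Λ ≤ h
            low = ≤-trans from v≤h
            -- Twice `h - j * Λ` is the sum of `D₀ < 16 * Λ` and `v - j * Λ < 8 * Λ`.
            high : h < j * Λ + 12 * Λ
            high = (lin (t ∷ h ∷ (j * Λ) ∷ Λ ∷ r ∷ D₀ ∷ []) 2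
                ((1 , # 0 ⊕ # 1 , # 2 ⊕ (((6 ⊛ (# 3)) ⊕ # 4) ⊕ # 2)) ∷ (1 , con 1 ⊕ # 4 , # 3 ⊕ # 3) ∷
                (1 , con 1 ⊕ # 5 , 16 ⊛ (# 3)) ∷ (1 , # 1 , # 5 ⊕ # 0) ∷ []) (con 1 ⊕ # 1)
                (# 2 ⊕ (12 ⊛ (# 3))) (≤-reflexive x≡) r< D< (≤-reflexive (sym D₀+t)))
            package : ∃[ x″ ] x″ ≤ x₀ × Success ℓ h x″ × x″ ∈ xs → Found x₀
            package (x″ , le , X , m) = x″ , le , (ℓ , ℓ≤L , X) , m

          found : Found x₀
          found with D₀ <? 8 * 2 ^ ℓ
          ... | yes D< = near-case ℓ refl
            where
            -- Direct trials depend only on the level of the visited pair, so any pair with level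
            -- `ℓ` will do. For `ℓ = suc k` the scale `2 ^ k` is chosen: 8 spacings are 16 of these
            -- scales, and `far` at `k` shows that the scale is at most `h`.
            near-case : ∀ k → k ≡ ℓ → Found x₀
            near-case zero refl = found-direct (proj₂ (visited {0} {0}
              (Reach.reached 0 0 z≤n (≤-trans (≤-trans (≤ᵇ⇒≤ 8 12 tt) (large′ 0 z≤n))
                  (≤-reflexive (sym (*-identityʳ (sizeOf 0))))) (λ _ ()))
              (s≤s z≤n))) D<
            near-case (suc k) refl = found-direct (proj₂ (visited {k} {suc k}
              (Reach.reached k (suc k) ℓ≤L wide (narrow-below {k}
                  (lin (D₀ ∷ (2 ^ k) ∷ []) 1 ((1 , con 1 ⊕ # 0 , 8 ⊛ (2 ⊛ (# 1))) ∷ []) (con 1 ⊕ # 0)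
                  (16 ⊛ (# 1)) D<))) 2^k≤h)) D<
              where
              wide : 8 * 2 ^ k ≤ sizeOf (suc k) * 2 ^ suc k
              wide = ≤-trans (lin ((2 ^ k) ∷ []) 1 [] (8 ⊛ (# 0)) (12 ⊛ (2 ⊛ (# 0))))
                  (*-monoˡ-≤ (2 ^ suc k) (large′ (suc k) ℓ≤L))
              2^k≤h : 2 ^ k ≤ h
              2^k≤h = ≤-trans (lin ((2 ^ k) ∷ []) 1 [] (# 0) (12 ⊛ (# 0)))
                  (≤-trans (*-monoˡ-≤ (2 ^ k) (large′ k (≤-trans (n≤1+n k) ℓ≤L)))
                  (≤-trans (m≤n+m (sizeOf k * 2 ^ k) t) (far k ≤-refl)))
          ... | no D≮ = let a , ≤D , D< = power-between D₀ (≤-trans (lin ((2 ^ ℓ) ∷ []) 1 ((8 , con 1 ⊕ con 0 , # 0) ∷ []) (con 8) (8 ⊛ (# 0)) (2^>0 ℓ)) (≮⇒≥ D≮)) in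
                        found-slot a (ℓ≤ a D<) ≤D D<
            where
            ℓ≤ : ∀ a → D₀ < 16 * 2 ^ a → ℓ ≤ a
            ℓ≤ a D< = ≮⇒≥ (λ a<ℓ → D≮ (lin (D₀ ∷ (2 ^ a) ∷ (2 ^ ℓ) ∷ []) 1
                ((1 , con 1 ⊕ # 0 , 16 ⊛ (# 1)) ∷ (8 , 2 ⊛ (# 1) , # 2) ∷ []) (con 1 ⊕ # 0) (8 ⊛ (# 2)) D<
                (^-monoʳ-≤ 2 a<ℓ)))

        -- Of all levels that reach `t`, the finest is taken. The failure of the finer ones is the
        -- hypothesis `far`, from which `narrow` follows.
        covers : ∀ t ℓ₀ → ℓ₀ ≤ L S → Level ℓ₀ h t → 2 ∣ t + h → Pal (t + h) h → Found (t + h)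
        covers t ℓ₀ ℓ₀≤L V 2∣x P =
          let ℓ , ℓ≤ , near , far = least-below (λ ℓ → h <? t + sizeOf ℓ * 2 ^ ℓ) ℓ₀ (Level.near V) in
          found t ℓ (≤-trans ℓ≤ ℓ₀≤L) (∣-trans (2^-∣ ℓ≤) (Level.divisible V)) (Level.t≤h V) near
              (λ k k< → ≮⇒≥ (far k k<)) 2∣x P

        guarantee : ∀ {rs} → (∀ {x} → x ∈ xs → centre x ∈ rs) → Guarantee S text h rs
        guarantee {rs} ∈rs c _ (t , t≡ , ℓ₀ , ℓ₀≤L , level) = by-outcome (succeeds? text h c)
          where
          Covering : Set
          Covering = c ∈ rs ⊎ ¬ Succeeds text h c ⊎ (∃[ c′ ] c′ < c × Runnable S h c′ × Succeeds text h c′)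
          V : Level ℓ₀ h t
          V = level-of ℓ₀ h t (words-large (≤-<-trans h≤n n<M)) level
          h≤x : h ≤ t + h
          h≤x = m≤n+m h t
          x≤2h : t + h ≤ h + h
          x≤2h = +-monoˡ-≤ h (Level.t≤h V)
          even : 2 ∣ t + h
          even = ∣m+n∣m⇒∣n (divides c (trans (+-comm 2 (t + h)) (trans t≡ (*-comm 2 c)))) ∣-refl
          2centre : ∀ {x} → 2 ∣ x → 2 * centre x ≡ x + 2
          2centre = centre-even text
          c≡ : centre (t + h) ≡ c
          c≡ = *-cancelˡ-≡ (centre (t + h)) c 2 (trans (2centre even) t≡)
          conclude : Found (t + h) → Covering
          conclude (x″ , x″≤ , (ℓ , ℓ≤L , X) , x″∈) = by-order (m≤n⇒m<n∨m≡n x″≤)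
            where
            by-order : x″ < t + h ⊎ x″ ≡ t + h → Covering
            by-order (inj₂ x″≡) = inj₁ (subst (_∈ rs) (trans (cong centre x″≡) c≡) (∈rs x″∈))
            by-order (inj₁ x″<) = inj₂ (inj₂ (centre x″ , subst (centre x″ <_) c≡
                (*-cancelˡ-< 2 (centre x″) (centre (t + h))
                (subst₂ _<_ (sym (2centre (Success.even X))) (sym (2centre even)) (+-monoˡ-< 2 x″<))) ,
                allowed-runnable ℓ ℓ≤L (Success.allow X) ,
                pal⇒succeeds text (Success.even X) (≤-trans (limit-≥ ℓ h) (Success.inside X))
                    (Success.x≤2h X) h≤n (Success.pal X)))
          by-outcome : Dec (Succeeds text h c) → Covering
          by-outcome (no fails)     = inj₂ (inj₁ fails)
          by-outcome (yes succeeds) = conclude (covers t ℓ₀ ℓ₀≤L V even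
              (succeeds⇒pal text even h≤x x≤2h h≤n (subst (Succeeds text h) (sym c≡) succeeds)))

    module OneStep (m⁰ : Memory) (state : State-at (toℕ i) m⁰) where

      abstract

        block-correct : ∀ a ℓ j (U : Useful a ℓ) → j * 2 ^ a + 6 * 2 ^ a ≤ h → ∀ σ′ →
          (∀ k → h ≡ suc k → j * 2 ^ a + 6 * 2 ^ a ≤ k → Tracked.AfterBlock a ℓ j U k σ′) →
          Tracked.AfterBlock a ℓ j U h (Following.advance (context (j * 2 ^ a) (2 ^ a) (2 ^ ℓ) h
              (limit ℓ h)) (palindrome h) σ′) ×
          Tracked.Finds a ℓ j U h (Following.attempted (context (j * 2 ^ a) (2 ^ a) (2 ^ ℓ) h (limit ℓ h))
              (palindrome h) σ′)
        block-correct a ℓ j U from σ′ prior = TrackedStep.advance-block a ℓ j U h h≤n from σ′ prior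

      open Abstract (λ c → Following.advance c (palindrome h)) (λ c → Following.attempted c (palindrome h))
          block-correct pairCode pair-safe pairCode-done m⁰ (proj₂ (proj₂ state))

      private
        m₁ m₂ m₃ : Memory
        m₁ = m⁰ [ 0 ≔ m⁰ 0 + 1 ]
        m₂ = m₁ [ 4 ≔ 0 ]
        m₃ = memory resetCode m₂

        B₀ : Bounded m⁰
        B₀ = proj₁ state

        time₁ : m⁰ 0 + 1 ≡ h
        time₁ = trans (+-comm (m⁰ 0) 1) (cong suc (proj₁ (proj₂ state)))

        B₁ : Bounded m₁
        B₁ = write-register 0 (m⁰ 0 + 1) (s≤s z≤n) (λ ()) (λ ())
            (M≤M^1 (≤-<-trans (subst (_≤ n) (sym time₁) h≤n) n<M)) B₀

        B₂ : Bounded m₂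
        B₂ = write-base 0 (lin (lg ∷ []) 1 [] ((con 0 ⊕ con 64) ⊕ con 32) (256 ⊛ (con 1 ⊕ # 0))) B₁

        reset : Safely false resetCode m₂
        reset = execute false resetCode tt B₂ (λ ())

        start-position : Position 0 m₃
        start-position = record
          { in-bounds = Safely.bounded′ reset ; time≡ = time₁ ; scale≡ = refl ; spacing≡ = refl ; level≡ =
              refl ; base≡ = refl
          ; fresh = λ j _ → refl }

        begin-with : Executes (store (lit 0) (reg 0 +ₑ lit 1)) m⁰ m₁ (suc (1 + cost (reg 0 +ₑ lit 1))) []
        begin-with = execute-register B₀ tt tt

        clear-base : Executes (store (lit 4) (lit 0)) m₁ m₂ (suc (1 + cost (lit 0))) []
        clear-base = execute-register B₁ tt tt

      final-slots : ∀ {idx m xs} → Done idx m xs → h < 2 ^ scaleAt idx → Slots h m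
      final-slots {idx} D end k U j active = proj₁ (proj₁ (D k k<idx) U j active)
        where
        k<idx : k < idx
        k<idx = ≰⇒> (λ idx≤k → <⇒≱ (<-≤-trans end (^-monoʳ-≤ 2 (walk-grows idx≤k)))
                  (lin ((j * 2 ^ scaleAt k) ∷ (2 ^ scaleAt k) ∷ h ∷ []) 6
                      ((1 , # 0 ⊕ (6 ⊛ (# 1)) , # 2) ∷ []) (# 1) (# 2) (proj₁ active)))

      performed : ∀ r → Outcome i m⁰ r
      performed r = conclude (loop (2 * lg + 1) 0 m₃ [] start-position (λ k ())
          (≤-reflexive (sym (+-identityʳ (2 * lg + 1)))))
        where
        conclude : Looped (2 * lg + 1) 0 m₃ [] → Outcome i m⁰ r
        conclude (idx , m′ , ys , X , P , D , end) = record
          { m′ = m′ ; r′ = proj₁ Z ; t = proj₁ (proj₂ Z) ; rs = proj₁ (proj₂ (proj₂ Z))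
          ; derivation = proj₁ (proj₂ (proj₂ (proj₂ Z)))
          ; in-time = ≤-trans (proj₁ (proj₂ (proj₂ (proj₂ (proj₂ Z)))))
              (≤-reflexive (regroup (suc (1 + cost (reg 0 +ₑ lit 1))) (suc (1 + cost (lit 0)))
                  (duration resetCode) (suc (2 * lg + 1) * passCost)))
          ; state = Position.in-bounds P , Position.time≡ P , final-slots {idx} {m′} {ys} D end
          ; guaranteed = Covered.guarantee {idx} {m′} {ys} D end
              (λ {x} x∈ → proj₂ (proj₂ (proj₂ (proj₂ (proj₂ Z)))) x∈) }
          where
          whole = execute-seq begin-with (execute-seq clear-base (execute-seq (Safely.execution reset) X))
          Z = Executes.derive whole r
          regroup : ∀ a d e f → a + (d + (e + f)) ≡ a + (d + e) + f
          regroup = solve-∀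

  start-state : State-at 0 (State.memory initial)
  start-state = record
    { registers = λ r _ → positive r ; cells = λ k → m^n>0 M {{M-nonzero}} 2
    ; base = (lin (lg ∷ []) 1 [] ((con 0 ⊕ con 64) ⊕ con 32) (256 ⊛ (con 1 ⊕ # 0))) ; slot-base =
        (lin (lg ∷ []) 1 [] ((con 0 ⊕ con 8) ⊕ con 32) (256 ⊛ (con 1 ⊕ # 0))) } ,
    refl , λ idx U j active → contradiction (proj₁ active) (<⇒≱
        (≤-trans (2^>0 (scaleAt idx)) (lin ((2 ^ scaleAt idx) ∷ (j * 2 ^ scaleAt idx) ∷ []) 1 [] (# 0)
        (# 1 ⊕ (6 ⊛ (# 0))))))
    where
    M-nonzero : NonZero M
    M-nonzero = >-nonZero (≤-trans (s≤s z≤n) M≥2)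
    positive : ∀ r → 0 < Bounds.amount w s M (registerBound r)
    positive r with registerBound r
    ... | power d = m^n>0 M {{M-nonzero}} d
    ... | word    = m^n>0 2 w

  -- `Simulates` asks for a state at every natural number. Beyond `n` the last state is repeated and
  -- nothing is claimed about it.
  Reached : ℕ → Set
  Reached k = Σ[ q ∈ State ] (k ≤ n → State-at k (State.memory q))

  after : ∀ i q → State-at (toℕ i) (State.memory q) → Outcome i (State.memory q) (State.answer q)
  after i q st = Loop.OneStep.performed i (State.memory q) st (State.answer q)

  extend : ∀ k → Dec (k < n) → Reached k → Reached (suc k)
  extend k (no k≮n)  (q , st) = q , λ k<n → contradiction k<n k≮n
  extend k (yes k<n) (q , st) = ⟨ m′ , r′ ⟩ , λ _ → subst (λ j → State-at (suc j) m′) (toℕ-fromℕ< k<n) state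
    where
    open Outcome (after (fromℕ< k<n) q (subst (λ j → State-at j (State.memory q)) (sym (toℕ-fromℕ< k<n))
        (st (<⇒≤ k<n))))

  reach : ∀ k → Reached k
  reach zero    = initial , λ _ → start-state
  reach (suc k) = extend k (k <? n) (reach k)

  record Transition (i : Fin n) (q q′ : State) : Set where
    field
      t          : ℕ
      rs         : List ℕ
      derivation : Machine._,_⇓_,_,_ w s S text i main q q′ t rs
      in-time    : suc (L S) + t ≤ stepBound * suc lg
      guaranteed : Guarantee S text (suc (toℕ i)) rs

  one-step : ∀ i → Transition i (proj₁ (reach (toℕ i))) (proj₁ (reach (suc (toℕ i))))
  one-step i = by-case (toℕ i <? n) (reach (toℕ i))
    where
    by-case : ∀ (d : Dec (toℕ i < n)) (ρ : Reached (toℕ i)) → Transition i (proj₁ ρ) (proj₁ (extend (toℕ i) d ρ))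
    by-case (no i≮n)  ρ        = contradiction (toℕ<n i) i≮n
    by-case (yes i<n) (q , st) = subst (λ j → Transition j q ⟨ Outcome.m′ O , Outcome.r′ O ⟩) (fromℕ<-toℕ i i<n) (record
      { t = Outcome.t O ; rs = Outcome.rs O ; derivation = Outcome.derivation O
      ; in-time = time-fits startTime (passCostOf pairCode) (L S) lg (Outcome.t O) L≤ (Outcome.in-time O)
      ; guaranteed = Outcome.guaranteed O })
      where
      O : Outcome (fromℕ< i<n) (State.memory q) (State.answer q)
      O = after (fromℕ< i<n) q (subst (λ j → State-at j (State.memory q)) (sym (toℕ-fromℕ< i<n)) (st (<⇒≤ i<n)))

  simulates : Simulates w s (stepBound * suc lg) main S text
  simulates = record
    { state = λ k → proj₁ (reach k) ; time = λ i → Transition.t (one-step i) ; runs = λ i → Transition.rs (one-step i)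
    ; start = refl ; step = λ i → Transition.derivation (one-step i)
    ; fast = λ i → Transition.in-time (one-step i) ; guarantee = λ i → Transition.guaranteed (one-step i) }

theorem5p7 : (d : ℕ) →
    ∃[ p ] ∃[ κ ] ∃[ α ] ∃[ β ]
    ((σ n : ℕ) (S : Scheme) (w : ℕ) (T : Text σ n) →
    σ ≤ (2 + n) ^ d →
    L S ≤ ⌊log₂ n ⌋ →
    (∀ ℓ → ℓ ≤ L S → [ 12 ] ≤⁺ size S ℓ) →
    κ * suc ⌊log₂ (n ⊔ σ) ⌋ ≤ w →
    Simulates w (α * suc ⌊log₂ n ⌋) (β * suc ⌊log₂ n ⌋) p S T)
theorem5p7 d = mainWith pairCode , 32 , 256 , 1 + startTime + 2 * passCostOf pairCode ,
  λ σ n S w T σ≤ L≤ large w≥ → Simulation.simulates S w T L≤ large w≥
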